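{- There is a $\Delta_0$ such that for every $\Delta \ge \Delta_0$, every graph of maximum degree $\Delta$ has a proper $(\Delta+1)$-colouring which is $\frac{8000}{8001}\Delta$-peaceful. Consequently, for all sufficiently large $\Delta$, $f(\Delta) \le \frac{8000}{8001}\Delta$.
   Context: For a real number $p$, a $p$-peaceful colouring of a graph is a vertex colouring $f$ with no monochromatic edges such that for every vertex $v$, $|\{w \in N(v) : \exists u \in N(v)\setminus\{w\} \text{ with } f(u)=f(w)\}| \le p$. $f(\Delta)$ denotes the minimum $p$ such that every graph of maximum degree $\Delta$ has a $p$-peaceful colouring using $\Delta+1$ colours. -}

module Defs where

open import Data.Nat using (ℕ; suc; _≤_; _*_)
open import Data.Fin using (Fin; _≟_)
open import Data.Bool using (Bool; true; false; _∧_; not)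
open import Data.List using (List; length; filter)
open import Data.Bool.ListAction using (any)
open import Data.Product using (Σ; _×_; ∃)
open import Relation.Binary.PropositionalEquality using (_≡_; _≢_)
open import Relation.Nullary.Decidable using (⌊_⌋)
open import Data.Bool.Properties using () renaming (_≟_ to _≟ᵇ_)
import Data.List.Base as L

allV : (n : ℕ) → List (Fin n)
allV n = L.allFin n

record Graph (n : ℕ) : Set where
  field
    adj    : Fin n → Fin n → Bool
    sym    : ∀ u v → adj u v ≡ adj v u
    irrefl : ∀ v → adj v v ≡ false
open Graph public

countB : ∀ {n} → (Fin n → Bool) → List (Fin n) → ℕ
countB p xs = length (filter (λ x → p x ≟ᵇ true) xs)

degree : ∀ {n} → Graph n → Fin n → ℕ
degree {n} G v = countB (adj G v) (allV n)

MaxDegree : ∀ {n} → Graph n → ℕ → Set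
MaxDegree {n} G Δ = (∀ v → degree G v ≤ Δ) × ∃ λ v → degree G v ≡ Δ

Proper : ∀ {n k} → Graph n → (Fin n → Fin k) → Set
Proper G f = ∀ u v → adj G u v ≡ true → f u ≢ f v

conflicted : ∀ {n k} → Graph n → (Fin n → Fin k) → Fin n → Fin n → Bool
conflicted {n} G f v w =
  adj G v w ∧ any (λ u → adj G v u ∧ (not ⌊ u ≟ w ⌋ ∧ ⌊ f u ≟ f w ⌋)) (allV n)

conflicts : ∀ {n k} → Graph n → (Fin n → Fin k) → Fin n → ℕ
conflicts {n} G f v = countB (conflicted G f v) (allV n)

-- f is (a/b)·Δ-peaceful: for every v, conflicts v ≤ (a/b)·Δ,
-- i.e. b · conflicts v ≤ a · Δ  (b > 0)
PeacefulFrac : ∀ {n k} → Graph n → (Fin n → Fin k) → (a b Δ : ℕ) → Set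
PeacefulFrac G f a b Δ = ∀ v → b * conflicts G f v ≤ a * Δ

{-# OPTIONS --safe #-}
-- Let f be any proper (Δ + 1)-colouring, and call the following a move: recolour a vertex w with an arbitrary colour c
-- and give each neighbour of w coloured c a new colour, which exists because only Δ − 1 other neighbours and the colour
-- c itself forbid one. Let every vertex propose, with probability 1/200, a move with a uniformly random colour, and carry
-- out the proposals that interfere with no other proposal.
-- A vertex v at which at least about 0.025Δ neighbours have a unique colour keeps enough of them, since few neighbours
-- change. Otherwise about half of all colours are missing at v, so that a positive fraction of the proposals of the
-- neighbours of v use a missing colour. Each such proposal is rarely disturbed by another one, and it creates a neighbour
-- with a unique colour. These estimates fail at v with probability exponentially small in Δ and depend only on proposals
-- within distance 4 of v, so the local lemma applies.
module Submission where

open import Defs hiding (sym)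
open import Data.Bool using (Bool; true; false; T; _∧_; _∨_; not; if_then_else_)
open import Data.Bool.ListAction using (any)
open import Data.Bool.Properties using (T?; ∧-comm; ∨-zeroʳ)
open import Data.Empty using (⊥; ⊥-elim)
open import Data.Fin using (Fin; zero; suc)
open import Data.Fin.Properties using () renaming (_≟_ to _≟ᶠ_)
open import Data.List using (List; []; _∷_; _++_; [_]; _∷ʳ_; _ʳ++_; map; length; reverse; replicate; concatMap; filterᵇ; tabulate; allFin)
open import Data.List.Membership.Propositional using (_∈_)
open import Data.List.Membership.Propositional.Properties using (∈-allFin; ∈-map⁻; ∈-map⁺; ∈-++⁻; ∈-++⁺ˡ; ∈-++⁺ʳ)
open import Data.List.Properties using (unfold-reverse; length-reverse; reverse-involutive; length-tabulate; length-replicate; length-++; length-map)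
open import Data.List.Relation.Unary.All using (lookup)
open import Data.List.Relation.Unary.AllPairs using ([]; _∷_)
open import Data.List.Relation.Unary.Any using (here; there)
open import Data.List.Relation.Unary.Unique.Propositional using (Unique)
open import Data.List.Relation.Unary.Unique.Propositional.Properties using (filter⁺; allFin⁺)
open import Data.Maybe using (Maybe; just; nothing)
open import Data.Nat
open import Data.Nat.DivMod using (m≡m%n+[m/n]*n; m%n<n; m/n*n≤m; /-monoˡ-≤; m*n/n≡m)
open import Data.Nat.Properties
open import Data.Nat.Tactic.RingSolver using (solve-∀)
open import Data.Product using (Σ; ∃; _×_; _,_; proj₁; proj₂)
open import Data.Sum using (_⊎_; inj₁; inj₂)
open import Function using (_∘_; id)
open import Relation.Binary.PropositionalEquality hiding ([_])
open import Relation.Nullary using (¬_; yes; no; contradiction)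
open import Relation.Nullary.Decidable using (⌊_⌋)

-- A displaced neighbour may have very few free colours. Were the same one used for many of its
-- neighbours, a single proposal could interfere with too many others. The table built in
-- `Substitute` therefore uses any colour at most twice per vertex. This caps the interference of a
-- proposal at `32 * k` letters, while each vertex has `200 * k` of them: 0.16 expected disturbing
-- proposals. The undisturbed useful proposals are not a sum of independent variables. They number
-- at least the useful proposals minus those disturbed from the left and from the right when the
-- vertices are revealed in order. Either loss has a predictable but random drift, itself bounded by
-- a sum of independent terms. Every layer costs a factor 5/4: each loss is at most 0.16 · (5/4)² =
-- 1/4 of the expected number of useful proposals, of which at least 4/5 occur, so 4/5 - 2/4 = 3/10
-- survive, up to small multiples of `z`.

∑ : {A : Set} → List A → (A → ℕ) → ℕ
∑ [] F = 0
∑ (x ∷ xs) F = F x + ∑ xs F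

𝟙 : Bool → ℕ
𝟙 true = 1
𝟙 false = 0

-- Finite sums and indicators

module _ {A : Set} where

  ∑-cong : ∀ (xs : List A) {F G : A → ℕ} → (∀ x → F x ≡ G x) → ∑ xs F ≡ ∑ xs G
  ∑-cong [] h = refl
  ∑-cong (x ∷ xs) h = cong₂ _+_ (h x) (∑-cong xs h)

  ∑-mono : ∀ (xs : List A) {F G : A → ℕ} → (∀ x → F x ≤ G x) → ∑ xs F ≤ ∑ xs G
  ∑-mono [] h = z≤n
  ∑-mono (x ∷ xs) h = +-mono-≤ (h x) (∑-mono xs h)

  ∑-+ : ∀ (xs : List A) (F G : A → ℕ) → ∑ xs (λ x → F x + G x) ≡ ∑ xs F + ∑ xs G
  ∑-+ [] F G = refl
  ∑-+ (x ∷ xs) F G rewrite ∑-+ xs F G = +-interchange (F x) (G x) (∑ xs F) (∑ xs G)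
    where
    +-interchange : ∀ a b c d → (a + b) + (c + d) ≡ (a + c) + (b + d)
    +-interchange = solve-∀

  ∑-*ʳ : ∀ (xs : List A) (F : A → ℕ) k → ∑ xs F * k ≡ ∑ xs (λ x → F x * k)
  ∑-*ʳ [] F k = refl
  ∑-*ʳ (x ∷ xs) F k = trans (*-distribʳ-+ k (F x) (∑ xs F)) (cong (F x * k +_) (∑-*ʳ xs F k))

  ∑-*ˡ : ∀ (xs : List A) (F : A → ℕ) k → k * ∑ xs F ≡ ∑ xs (λ x → k * F x)
  ∑-*ˡ [] F k = *-zeroʳ k
  ∑-*ˡ (x ∷ xs) F k = trans (*-distribˡ-+ k (F x) (∑ xs F)) (cong (k * F x +_) (∑-*ˡ xs F k))

  ∑-const : ∀ (xs : List A) k → ∑ xs (λ _ → k) ≡ length xs * k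
  ∑-const [] k = refl
  ∑-const (x ∷ xs) k = cong (k +_) (∑-const xs k)

  ∑-≤const : ∀ (xs : List A) {F : A → ℕ} k → (∀ x → F x ≤ k) → ∑ xs F ≤ length xs * k
  ∑-≤const xs k h = ≤-trans (∑-mono xs h) (≤-reflexive (∑-const xs k))

  ∑-zero : ∀ (xs : List A) {F : A → ℕ} → (∀ x → F x ≡ 0) → ∑ xs F ≡ 0
  ∑-zero [] h = refl
  ∑-zero (x ∷ xs) h = cong₂ _+_ (h x) (∑-zero xs h)

  ∑-++ : ∀ (xs ys : List A) (F : A → ℕ) → ∑ (xs ++ ys) F ≡ ∑ xs F + ∑ ys F
  ∑-++ [] ys F = refl
  ∑-++ (x ∷ xs) ys F = trans (cong (F x +_) (∑-++ xs ys F)) (sym (+-assoc (F x) _ _))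

  ∑-reverse : ∀ (xs : List A) (F : A → ℕ) → ∑ (reverse xs) F ≡ ∑ xs F
  ∑-reverse [] F = refl
  ∑-reverse (x ∷ xs) F
    rewrite unfold-reverse x xs | ∑-++ (reverse xs) [ x ] F | ∑-reverse xs F | +-identityʳ (F x)
    = +-comm (∑ xs F) (F x)

  ∑-positive : ∀ (xs : List A) (F : A → ℕ) → 0 < ∑ xs F → ∃ λ x → 0 < F x
  ∑-positive (x ∷ xs) F pos with F x in eq
  ... | zero = ∑-positive xs F pos
  ... | suc k = x , subst (0 <_) (sym eq) z<s

∑-map : ∀ {A B : Set} (g : A → B) (xs : List A) (F : B → ℕ) → ∑ (map g xs) F ≡ ∑ xs (F ∘ g)
∑-map g [] F = refl
∑-map g (x ∷ xs) F = cong (F (g x) +_) (∑-map g xs F)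

∑-swap : ∀ {A B : Set} (xs : List A) (ys : List B) (F : A → B → ℕ) →
         ∑ xs (λ x → ∑ ys (F x)) ≡ ∑ ys (λ y → ∑ xs (λ x → F x y))
∑-swap [] ys F = sym (∑-zero ys (λ _ → refl))
∑-swap (x ∷ xs) ys F =
  trans (cong (∑ ys (F x) +_) (∑-swap xs ys F)) (sym (∑-+ ys (F x) (λ y → ∑ xs (λ x → F x y))))

∑-tabulate : ∀ {A : Set} {n} (g : Fin n → A) (F : A → ℕ) → ∑ (tabulate g) F ≡ ∑ (allFin n) (F ∘ g)
∑-tabulate {n = zero} g F = refl
∑-tabulate {n = suc n} g F =
  cong (F (g zero) +_) (trans (∑-tabulate (g ∘ suc) F) (sym (∑-tabulate suc (F ∘ g))))

∑ᶠ : ∀ {n} → (Fin n → ℕ) → ℕ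
∑ᶠ {n} = ∑ (allFin n)

∑ᶠ-suc : ∀ {n} (F : Fin (suc n) → ℕ) → ∑ᶠ F ≡ F zero + ∑ᶠ (F ∘ suc)
∑ᶠ-suc F = cong (F zero +_) (∑-tabulate suc F)

≤∑ᶠ : ∀ {n} (F : Fin n → ℕ) i → F i ≤ ∑ᶠ F
≤∑ᶠ F zero = m≤m+n _ _
≤∑ᶠ F (suc i) rewrite ∑ᶠ-suc F = ≤-trans (≤∑ᶠ (F ∘ suc) i) (m≤n+m _ (F zero))

_==_ : ∀ {n} → Fin n → Fin n → Bool
i == j = ⌊ i ≟ᶠ j ⌋

==-refl : ∀ {n} (i : Fin n) → (i == i) ≡ true
==-refl i with i ≟ᶠ i
... | yes _ = refl
... | no ¬p = contradiction refl ¬p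

==⇒≡ : ∀ {n} {i j : Fin n} → (i == j) ≡ true → i ≡ j
==⇒≡ {i = i} {j} e with i ≟ᶠ j
==⇒≡ e | yes p = p
==⇒≡ () | no _

≢⇒== : ∀ {n} {i j : Fin n} → i ≢ j → (i == j) ≡ false
≢⇒== {i = i} {j} ne with i ≟ᶠ j
... | yes p = contradiction p ne
... | no _ = refl

==-sym : ∀ {n} (i j : Fin n) → (i == j) ≡ (j == i)
==-sym i j with i ≟ᶠ j
... | yes refl = sym (==-refl i)
... | no ne = sym (≢⇒== (ne ∘ sym))

∑ᶠ-single : ∀ {n} (F : Fin n → ℕ) k → (∀ i → F i ≤ k) → (∀ i j → 0 < F i → 0 < F j → i ≡ j) → ∑ᶠ F ≤ k
∑ᶠ-single {zero} F k _ _ = z≤n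
∑ᶠ-single {suc n} F k le uniq rewrite ∑ᶠ-suc F with F zero in eq
... | zero = ∑ᶠ-single (F ∘ suc) k (le ∘ suc) λ i j p q → suc-inj (uniq (suc i) (suc j) p q)
  where
  suc-inj : ∀ {n} {i j : Fin n} → Fin.suc i ≡ suc j → i ≡ j
  suc-inj refl = refl
... | suc m = subst (_≤ k) (trans eq (sym (trans (cong (suc m +_) (∑-zero (allFin n) rest)) (+-identityʳ (suc m))))) (le zero)
  where
  rest : ∀ i → F (suc i) ≡ 0
  rest i with F (suc i) in eq′
  ... | zero = refl
  ... | suc _ with uniq zero (suc i) (subst (0 <_) (sym eq) z<s) (subst (0 <_) (sym eq′) z<s)
  ...   | ()

𝟙≤1 : ∀ b → 𝟙 b ≤ 1
𝟙≤1 true = ≤-refl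
𝟙≤1 false = z≤n

𝟙-pos : ∀ {b} → 0 < 𝟙 b → b ≡ true
𝟙-pos {true} _ = refl

∑ᶠ-δ : ∀ {n} (i : Fin n) → ∑ᶠ (λ j → 𝟙 (i == j)) ≡ 1
∑ᶠ-δ i = ≤-antisym
  (∑ᶠ-single _ 1 (λ j → 𝟙≤1 (i == j)) (λ j k p q → trans (sym (==⇒≡ (𝟙-pos p))) (==⇒≡ (𝟙-pos q))))
  (≤-trans (≤-reflexive (cong 𝟙 (sym (==-refl i)))) (≤∑ᶠ (λ j → 𝟙 (i == j)) i))

𝟙-mono : ∀ {a b} → (a ≡ true → b ≡ true) → 𝟙 a ≤ 𝟙 b
𝟙-mono {true} h rewrite h refl = ≤-refl
𝟙-mono {false} h = z≤n

𝟙-∧ : ∀ a b → 𝟙 (a ∧ b) ≡ 𝟙 a * 𝟙 b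
𝟙-∧ true b = sym (+-identityʳ _)
𝟙-∧ false b = refl

𝟙-∨ : ∀ a b → 𝟙 (a ∨ b) ≤ 𝟙 a + 𝟙 b
𝟙-∨ true b = s≤s z≤n
𝟙-∨ false b = ≤-refl

𝟙-*≤ : ∀ b k → 𝟙 b * k ≤ k
𝟙-*≤ true k = ≤-reflexive (+-identityʳ k)
𝟙-*≤ false k = z≤n

𝟙-not : ∀ b → 𝟙 b + 𝟙 (not b) ≡ 1
𝟙-not true = refl
𝟙-not false = refl

𝟙-any : ∀ {A : Set} (p : A → Bool) xs → 𝟙 (any p xs) ≤ ∑ xs (𝟙 ∘ p)
𝟙-any p [] = z≤n
𝟙-any p (x ∷ xs) = ≤-trans (𝟙-∨ (p x) _) (+-monoʳ-≤ (𝟙 (p x)) (𝟙-any p xs))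

∧-true : ∀ {a b} → (a ∧ b) ≡ true → a ≡ true × b ≡ true
∧-true {true} {true} _ = refl , refl

∨-true : ∀ {a b} → (a ∨ b) ≡ true → a ≡ true ⊎ b ≡ true
∨-true {true} _ = inj₁ refl
∨-true {false} e = inj₂ e

not-true : ∀ {a} → not a ≡ true → a ≡ false
not-true {false} _ = refl

¬true⇒false : ∀ {b} → b ≢ true → b ≡ false
¬true⇒false {true} h = contradiction refl h
¬true⇒false {false} h = refl

true≢false : ∀ {b} → b ≡ true → b ≡ false → ⊥
true≢false refl ()

≤ᵇ-true : ∀ {m n} → m ≤ n → (m ≤ᵇ n) ≡ true
≤ᵇ-true {m} {n} le with m ≤ᵇ n | ≤⇒≤ᵇ le
... | true | _ = refl

≤ᵇ-sound : ∀ {m n} → (m ≤ᵇ n) ≡ true → m ≤ n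
≤ᵇ-sound {m} {n} e = ≤ᵇ⇒≤ m n (subst T (sym e) _)

-- Words, expectation and independence

Word : Set → Set → Set
Word I A = List (I × A)

-- That a quantity depends only on the coordinates in `V` is expressed throughout as invariance
-- under `restrict V`.
restrict : {I A : Set} → (I → Bool) → Word I A → Word I A
restrict V [] = []
restrict V ((i , a) ∷ H) = if V i then (i , a) ∷ restrict V H else restrict V H

restrict-keep : ∀ {I A : Set} (V : I → Bool) {i} (a : A) H → V i ≡ true → restrict V ((i , a) ∷ H) ≡ (i , a) ∷ restrict V H
restrict-keep V a H e rewrite e = refl

restrict-drop : ∀ {I A : Set} (V : I → Bool) {i} (a : A) H → V i ≡ false → restrict V ((i , a) ∷ H) ≡ restrict V H
restrict-drop V a H e rewrite e = refl

restrict-restrict : ∀ {I A : Set} {U V : I → Bool} → (∀ i → U i ≡ true → V i ≡ true) →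
                    ∀ (H : Word I A) → restrict U (restrict V H) ≡ restrict U H
restrict-restrict h [] = refl
restrict-restrict {U = U} {V} h ((i , a) ∷ H) with V i in eqV | U i in eqU
... | true  | true  rewrite eqU = cong (_ ∷_) (restrict-restrict h H)
... | true  | false rewrite eqU = restrict-restrict h H
... | false | true  = contradiction (trans (sym (h i eqU)) eqV) λ ()
... | false | false = restrict-restrict h H

-- A product probability space without division: a word gives each index of a list, in that order, a letter of vals (with
-- multiplicity), and E is the expectation scaled by Q ^ length is.
module Words {I A : Set} (vals : List A) where

  Q : ℕ
  Q = length vals

  E : List I → (Word I A → ℕ) → ℕ
  E [] F = F []
  E (i ∷ is) F = ∑ vals (λ a → E is (λ H → F ((i , a) ∷ H)))

  count : List I → (Word I A → Bool) → ℕ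
  count is p = E is (𝟙 ∘ p)

  E-mono : ∀ is {F G} → (∀ H → map proj₁ H ≡ is → F H ≤ G H) → E is F ≤ E is G
  E-mono [] h = h [] refl
  E-mono (i ∷ is) h = ∑-mono vals λ a → E-mono is λ H e → h ((i , a) ∷ H) (cong (i ∷_) e)

  E-cong : ∀ is {F G} → (∀ H → F H ≡ G H) → E is F ≡ E is G
  E-cong is h = ≤-antisym (E-mono is λ H _ → ≤-reflexive (h H)) (E-mono is λ H _ → ≤-reflexive (sym (h H)))

  E-+ : ∀ is F G → E is (λ H → F H + G H) ≡ E is F + E is G
  E-+ [] F G = refl
  E-+ (i ∷ is) F G = trans (∑-cong vals λ a → E-+ is _ _) (∑-+ vals _ _)

  E-*ˡ : ∀ is F k → E is (λ H → k * F H) ≡ k * E is F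
  E-*ˡ [] F k = refl
  E-*ˡ (i ∷ is) F k = trans (∑-cong vals λ a → E-*ˡ is _ k) (sym (∑-*ˡ vals _ k))

  E-const : ∀ is k → E is (λ _ → k) ≡ Q ^ length is * k
  E-const [] k = sym (+-identityʳ k)
  E-const (i ∷ is) k = trans (∑-cong vals λ a → E-const is k)
    (trans (∑-const vals _) (sym (*-assoc Q (Q ^ length is) k)))

  E-∑ : ∀ {B : Set} is (xs : List B) (F : B → Word I A → ℕ) →
        E is (λ H → ∑ xs (λ x → F x H)) ≡ ∑ xs (λ x → E is (F x))
  E-∑ is [] F = trans (E-const is 0) (*-zeroʳ (Q ^ length is))
  E-∑ is (x ∷ xs) F = trans (E-+ is _ _) (cong (E is (F x) +_) (E-∑ is xs F))

  E-snoc : ∀ is i F → E (is ∷ʳ i) F ≡ E is (λ H → ∑ vals (λ a → F (H ∷ʳ (i , a))))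
  E-snoc [] i F = refl
  E-snoc (j ∷ is) i F = ∑-cong vals λ b → E-snoc is i _

  -- Allows a word to be revealed from its end: a tail bound proved for all index lists transfers to
  -- the reversed word.
  E-reverse : ∀ is F → E (reverse is) F ≡ E is (F ∘ reverse)
  E-reverse [] F = refl
  E-reverse (i ∷ is) F = begin
    E (reverse (i ∷ is)) F                                     ≡⟨ cong (λ js → E js F) (unfold-reverse i is) ⟩
    E (reverse is ∷ʳ i) F                                      ≡⟨ E-snoc (reverse is) i F ⟩
    E (reverse is) (λ H → ∑ vals (λ a → F (H ∷ʳ (i , a))))     ≡⟨ E-reverse is _ ⟩
    E is (λ H → ∑ vals (λ a → F (reverse H ∷ʳ (i , a))))       ≡⟨ E-∑ is vals _ ⟩
    ∑ vals (λ a → E is (λ H → F (reverse H ∷ʳ (i , a))))       ≡⟨ ∑-cong vals (λ a → E-cong is λ H → cong F (sym (unfold-reverse (i , a) H))) ⟩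
    E (i ∷ is) (F ∘ reverse)                                   ∎
    where open ≡-Reasoning

  E-positive : ∀ is F → 0 < E is F → ∃ λ H → map proj₁ H ≡ is × 0 < F H
  E-positive [] F pos = [] , refl , pos
  E-positive (i ∷ is) F pos with ∑-positive vals _ pos
  ... | a , pos′ with E-positive is _ pos′
  ...   | H , e , pos″ = (i , a) ∷ H , cong (i ∷_) e , pos″

  -- Induction on the coordinates: the first letter matters to only one of `F` and `G`, and summing
  -- the other, constant in it, over `vals` contributes a factor `Q`. The factor `Q ^ length is` on
  -- the left makes up for both expectations on the right being scaled.
  E-independent : ∀ (V : I → Bool) is F G →
    (∀ H → F H ≡ F (restrict V H)) → (∀ H → G H ≡ G (restrict (not ∘ V) H)) →
    Q ^ length is * E is (λ H → F H * G H) ≡ E is F * E is G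
  E-independent V [] F G hF hG = +-identityʳ _
  E-independent V (i ∷ is) F G hF hG with V i in eq
  ... | true = begin
    Q * q * ∑ vals FG              ≡⟨ *-assoc Q q _ ⟩
    Q * (q * ∑ vals FG)            ≡⟨ cong (Q *_) (∑-*ˡ vals FG q) ⟩
    Q * ∑ vals (λ a → q * FG a)    ≡⟨ cong (Q *_) (∑-cong vals λ a → step a) ⟩
    Q * ∑ vals (λ a → E is (Fₐ a) * E is G)  ≡⟨ cong (Q *_) (sym (∑-*ʳ vals _ _)) ⟩
    Q * (∑ vals (λ a → E is (Fₐ a)) * E is G)  ≡⟨ lemma Q (∑ vals (λ a → E is (Fₐ a))) (E is G) ⟩
    ∑ vals (λ a → E is (Fₐ a)) * (Q * E is G)  ≡⟨ cong (∑ vals (λ a → E is (Fₐ a)) *_) (sym (∑-const vals _)) ⟩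
    ∑ vals (λ a → E is (Fₐ a)) * ∑ vals (λ a → E is G)  ≡⟨ cong (∑ vals (λ a → E is (Fₐ a)) *_) (∑-cong vals λ a → E-cong is λ H → sym (G-drop a H)) ⟩
    E (i ∷ is) F * E (i ∷ is) G ∎
    where
    open ≡-Reasoning
    q = Q ^ length is
    Fₐ = λ (a : A) H → F ((i , a) ∷ H)
    FG = λ (a : A) → E is (λ H → F ((i , a) ∷ H) * G ((i , a) ∷ H))
    lemma : ∀ a b c → a * (b * c) ≡ b * (a * c)
    lemma = solve-∀
    G-drop : ∀ a H → G ((i , a) ∷ H) ≡ G H
    G-drop a H = trans (trans (hG ((i , a) ∷ H)) (cong G (restrict-drop (not ∘ V) a H (cong not eq)))) (sym (hG H))
    F-keep : ∀ a H → Fₐ a H ≡ Fₐ a (restrict V H)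
    F-keep a H = begin
      F ((i , a) ∷ H)                        ≡⟨ hF _ ⟩
      F (restrict V ((i , a) ∷ H))           ≡⟨ cong F (restrict-keep V a H eq) ⟩
      F ((i , a) ∷ restrict V H)             ≡⟨ cong (λ K → F ((i , a) ∷ K)) (sym (restrict-restrict (λ _ e → e) H)) ⟩
      F ((i , a) ∷ restrict V (restrict V H)) ≡⟨ cong F (sym (restrict-keep V a (restrict V H) eq)) ⟩
      F (restrict V ((i , a) ∷ restrict V H)) ≡⟨ sym (hF _) ⟩
      F ((i , a) ∷ restrict V H)             ∎
    step : ∀ a → q * FG a ≡ E is (Fₐ a) * E is G
    step a = trans (cong (q *_) (E-cong is λ H → cong (F ((i , a) ∷ H) *_) (G-drop a H)))
                   (E-independent V is (Fₐ a) G (F-keep a) hG)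
  ... | false = begin
    Q * q * ∑ vals FG              ≡⟨ *-assoc Q q _ ⟩
    Q * (q * ∑ vals FG)            ≡⟨ cong (Q *_) (∑-*ˡ vals FG q) ⟩
    Q * ∑ vals (λ a → q * FG a)    ≡⟨ cong (Q *_) (∑-cong vals λ a → step a) ⟩
    Q * ∑ vals (λ a → E is F * E is (Gₐ a))  ≡⟨ cong (Q *_) (sym (∑-*ˡ vals _ (E is F))) ⟩
    Q * (E is F * ∑ vals (λ a → E is (Gₐ a)))  ≡⟨ sym (*-assoc Q _ _) ⟩
    (Q * E is F) * ∑ vals (λ a → E is (Gₐ a))  ≡⟨ cong (_* ∑ vals (λ a → E is (Gₐ a))) (sym (∑-const vals _)) ⟩
    ∑ vals (λ a → E is F) * ∑ vals (λ a → E is (Gₐ a))  ≡⟨ cong (_* ∑ vals (λ a → E is (Gₐ a))) (∑-cong vals λ a → E-cong is λ H → sym (F-drop a H)) ⟩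
    E (i ∷ is) F * E (i ∷ is) G ∎
    where
    open ≡-Reasoning
    q = Q ^ length is
    Gₐ = λ (a : A) H → G ((i , a) ∷ H)
    FG = λ (a : A) → E is (λ H → F ((i , a) ∷ H) * G ((i , a) ∷ H))
    F-drop : ∀ a H → F ((i , a) ∷ H) ≡ F H
    F-drop a H = trans (trans (hF ((i , a) ∷ H)) (cong F (restrict-drop V a H eq))) (sym (hF H))
    G-keep : ∀ a H → Gₐ a H ≡ Gₐ a (restrict (not ∘ V) H)
    G-keep a H = begin
      G ((i , a) ∷ H)                        ≡⟨ hG _ ⟩
      G (restrict (not ∘ V) ((i , a) ∷ H))   ≡⟨ cong G (restrict-keep (not ∘ V) a H (cong not eq)) ⟩
      G ((i , a) ∷ restrict (not ∘ V) H)     ≡⟨ cong (λ K → G ((i , a) ∷ K)) (sym (restrict-restrict (λ _ e → e) H)) ⟩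
      G ((i , a) ∷ restrict (not ∘ V) (restrict (not ∘ V) H)) ≡⟨ cong G (sym (restrict-keep (not ∘ V) a (restrict (not ∘ V) H) (cong not eq))) ⟩
      G (restrict (not ∘ V) ((i , a) ∷ restrict (not ∘ V) H)) ≡⟨ sym (hG _) ⟩
      G ((i , a) ∷ restrict (not ∘ V) H)     ∎
    step : ∀ a → q * FG a ≡ E is F * E is (Gₐ a)
    step a = trans (cong (q *_) (E-cong is λ H → cong (_* G ((i , a) ∷ H)) (F-drop a H)))
                   (E-independent V is F (Gₐ a) hF (G-keep a))

  -- The symmetric local lemma

  module LocalLemma
    (is : List I) {J : Set} (bad : J → Word I A → Bool) (V : J → I → Bool) (dep : J → J → Bool) (d : ℕ)
    (0<Q : 0 < Q) (0<d : 0 < d)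
    (local : ∀ v H → bad v H ≡ bad v (restrict (V v) H))
    (disjoint : ∀ v u → dep v u ≡ false → ∀ i → V u i ≡ true → V v i ≡ false)
    (rare : ∀ v → count is (bad v) * (4 * d) ≤ Q ^ length is)
    where

    avoid : List J → Word I A → Bool
    avoid [] H = true
    avoid (u ∷ S) H = not (bad u H) ∧ avoid S H

    N : List J → ℕ
    N S = count is (avoid S)

    m+1+n≰0 : ∀ m {n} → m + suc n ≤ 0 → ⊥
    m+1+n≰0 zero ()
    m+1+n≰0 (suc m) ()

    -- The bound is asked at every `v`, in `S` or not, so that sublists inherit it. A member `v` of
    -- `S` with `dep v v` counts towards its own `d`.
    Sparse : List J → Set
    Sparse S = ∀ v → ∑ S (𝟙 ∘ dep v) ≤ d

    far : J → List J → List J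
    far v [] = []
    far v (u ∷ S) = if dep v u then far v S else u ∷ far v S

    length-far : ∀ v S → length (far v S) + ∑ S (𝟙 ∘ dep v) ≡ length S
    length-far v [] = refl
    length-far v (u ∷ S) with dep v u
    ... | true = trans (+-suc _ _) (cong suc (length-far v S))
    ... | false = cong suc (length-far v S)

    far-sparse : ∀ v {S} → Sparse S → Sparse (far v S)
    far-sparse v {S} sp w = ≤-trans (go S) (sp w)
      where
      go : ∀ S → ∑ (far v S) (𝟙 ∘ dep w) ≤ ∑ S (𝟙 ∘ dep w)
      go [] = z≤n
      go (u ∷ S) with dep v u
      ... | true = ≤-trans (go S) (m≤n+m _ _)
      ... | false = +-monoʳ-≤ _ (go S)

    avoid-far : ∀ v S H → avoid S H ≡ true → avoid (far v S) H ≡ true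
    avoid-far v [] H e = refl
    avoid-far v (u ∷ S) H e with dep v u | ∧-true {not (bad u H)} e
    ... | true | _ , e₂ = avoid-far v S H e₂
    ... | false | e₁ , e₂ rewrite e₁ = avoid-far v S H e₂

    -- `c` is meant to be the event that all of the original `far v S` is avoided. As a parameter it
    -- stays fixed while the recursion shortens `S`.
    near-union : ∀ v S H c → c ≡ true → avoid (far v S) H ≡ true →
      1 ≤ 𝟙 (avoid S H) + ∑ S (λ u → 𝟙 (dep v u) * 𝟙 (bad u H ∧ c))
    near-union v [] H c _ _ = ≤-refl
    near-union v (u ∷ S) H .true refl e with dep v u | bad u H in eq
    ... | true  | true = s≤s z≤n
    ... | true  | false = near-union v S H true refl e
    ... | false | true rewrite eq = contradiction e λ ()
    ... | false | false rewrite eq = near-union v S H true refl e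

    N-far≤ : ∀ v S → N (far v S) ≤ N S + ∑ S (λ u → 𝟙 (dep v u) * count is (λ H → bad u H ∧ avoid (far v S) H))
    N-far≤ v S = begin
      N (far v S)
        ≤⟨ E-mono is (λ H _ → pointwise H) ⟩
      E is (λ H → 𝟙 (avoid S H) + ∑ S (λ u → 𝟙 (dep v u) * 𝟙 (bad u H ∧ avoid (far v S) H)))
        ≡⟨ E-+ is _ _ ⟩
      N S + E is (λ H → ∑ S (λ u → 𝟙 (dep v u) * 𝟙 (bad u H ∧ avoid (far v S) H)))
        ≡⟨ cong (N S +_) (trans (E-∑ is S _) (∑-cong S λ u → E-*ˡ is _ (𝟙 (dep v u)))) ⟩
      N S + ∑ S (λ u → 𝟙 (dep v u) * count is (λ H → bad u H ∧ avoid (far v S) H)) ∎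
      where
      open ≤-Reasoning
      pointwise : ∀ H → 𝟙 (avoid (far v S) H) ≤ 𝟙 (avoid S H) + ∑ S (λ u → 𝟙 (dep v u) * 𝟙 (bad u H ∧ avoid (far v S) H))
      pointwise H with avoid (far v S) H in eq
      ... | true = near-union v S H true refl eq
      ... | false = z≤n

    avoid-local : ∀ v S H → avoid (far v S) H ≡ avoid (far v S) (restrict (not ∘ V v) H)
    avoid-local v [] H = refl
    avoid-local v (u ∷ S) H with dep v u in eq
    ... | true = avoid-local v S H
    ... | false = cong₂ (λ a b → not a ∧ b) one (avoid-local v S H)
      where
      one : bad u H ≡ bad u (restrict (not ∘ V v) H)
      one = trans (local u H) (trans (cong (bad u) (sym (restrict-restrict (λ i e → cong not (disjoint v u eq i e)) H)))
                  (sym (local u _)))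

    independent : ∀ v S → Q ^ length is * count is (λ H → bad v H ∧ avoid (far v S) H) ≡ count is (bad v) * N (far v S)
    independent v S = trans (cong (Q ^ length is *_) (E-cong is λ H → 𝟙-∧ (bad v H) _))
      (E-independent (V v) is _ _ (λ H → cong 𝟙 (local v H)) (λ H → cong 𝟙 (avoid-local v S H)))

    0<Qⁿ : 0 < Q ^ length is
    0<Qⁿ = m^n>0 Q {{>-nonZero 0<Q}} (length is)

    far-bound : ∀ v S → count is (λ H → bad v H ∧ avoid (far v S) H) * (4 * d) ≤ N (far v S)
    far-bound v S = *-cancelˡ-≤ (Q ^ length is) {{>-nonZero 0<Qⁿ}} (begin
      Q ^ length is * (c * (4 * d))            ≡⟨ sym (*-assoc (Q ^ length is) c _) ⟩
      Q ^ length is * c * (4 * d)              ≡⟨ cong (_* (4 * d)) (independent v S) ⟩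
      count is (bad v) * N (far v S) * (4 * d) ≡⟨ lemma (count is (bad v)) (N (far v S)) (4 * d) ⟩
      count is (bad v) * (4 * d) * N (far v S) ≤⟨ *-monoˡ-≤ _ (rare v) ⟩
      Q ^ length is * N (far v S)              ∎)
      where
      open ≤-Reasoning
      c = count is (λ H → bad v H ∧ avoid (far v S) H)
      lemma : ∀ a b c → a * b * c ≡ a * c * b
      lemma = solve-∀

    -- The classical induction. By independence the probability that `bad v` holds and `far v S` is
    -- avoided is at most 1/(4d) of that of avoiding `far v S`, so it suffices that passing from
    -- `far v S` to `S` loses at most half. By the union bound that loss comes from at most `d` near
    -- events, each with conditional probability at most 1/(2d) given `far v S`, by induction.
    conditional : ∀ k v S → length S ≤ k → Sparse S →
      count is (λ H → bad v H ∧ avoid S H) * (2 * d) ≤ N S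
    conditional k v S len sp = *-cancelˡ-≤ 2 (begin
      2 * (count is (λ H → bad v H ∧ avoid S H) * (2 * d))  ≡⟨ lemma₁ (count is (λ H → bad v H ∧ avoid S H)) d ⟩
      count is (λ H → bad v H ∧ avoid S H) * (4 * d)        ≤⟨ *-monoˡ-≤ (4 * d) (E-mono is λ H _ → 𝟙-mono (λ e → let e₁ , e₂ = ∧-true {bad v H} e in cong₂ _∧_ e₁ (avoid-far v S H e₂))) ⟩
      count is (λ H → bad v H ∧ avoid (far v S) H) * (4 * d) ≤⟨ far-bound v S ⟩
      N (far v S)                                           ≤⟨ half k len ⟩
      2 * N S                                               ∎)
      where
      open ≤-Reasoning
      lemma₁ : ∀ c d → 2 * (c * (2 * d)) ≡ c * (4 * d)
      lemma₁ = solve-∀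
      lemma₂ : ∀ a b c → a * b * c ≡ a * (b * c)
      lemma₂ = solve-∀
      lemma₃ : ∀ n d → n * (2 * d) ≡ n * d + d * n
      lemma₃ = solve-∀
      lemma₄ : ∀ n d → n * (2 * d) ≡ 2 * n * d
      lemma₄ = solve-∀
      half : ∀ k → length S ≤ k → N (far v S) ≤ 2 * N S
      half k len with ∑ S (𝟙 ∘ dep v) in eq
      half k len | zero = ≤-trans (N-far≤ v S) (≤-trans (≤-reflexive (cong (N S +_) (none S eq)))
                            (+-monoʳ-≤ (N S) z≤n))
        where
        none : ∀ T {F : J → ℕ} → ∑ T (𝟙 ∘ dep v) ≡ 0 → ∑ T (λ u → 𝟙 (dep v u) * F u) ≡ 0
        none [] e = refl
        none (u ∷ T) e rewrite m+n≡0⇒m≡0 (𝟙 (dep v u)) e = none T (m+n≡0⇒n≡0 (𝟙 (dep v u)) e)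
      half zero len | suc m = contradiction (≤-trans (≤-trans (≤-reflexive (cong (length (far v S) +_) (sym eq))) ≤-refl)
        (≤-trans (≤-reflexive (length-far v S)) len)) (m+1+n≰0 (length (far v S)))
      -- Some member of `S` is near `v`, so `far v S` is strictly shorter and the bound `k` may
      -- drop.
      half (suc k) len | suc m = *-cancelʳ-≤ (N (far v S)) (2 * N S) d {{>-nonZero 0<d}}
        (+-cancelʳ-≤ (d * N (far v S)) _ _ (begin
          N (far v S) * d + d * N (far v S)   ≡⟨ sym (lemma₃ (N (far v S)) d) ⟩
          N (far v S) * (2 * d)               ≤⟨ *-monoˡ-≤ (2 * d) (N-far≤ v S) ⟩
          (N S + ∑ S (λ u → 𝟙 (dep v u) * cnt u)) * (2 * d) ≡⟨ *-distribʳ-+ (2 * d) (N S) _ ⟩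
          N S * (2 * d) + ∑ S (λ u → 𝟙 (dep v u) * cnt u) * (2 * d) ≡⟨ cong (N S * (2 * d) +_) (∑-*ʳ S _ (2 * d)) ⟩
          N S * (2 * d) + ∑ S (λ u → 𝟙 (dep v u) * cnt u * (2 * d)) ≤⟨ +-monoʳ-≤ (N S * (2 * d)) (∑-mono S λ u → ≤-trans (≤-reflexive (lemma₂ (𝟙 (dep v u)) _ _)) (*-monoʳ-≤ (𝟙 (dep v u)) (conditional k u (far v S) shorter (far-sparse v {S} sp)))) ⟩
          N S * (2 * d) + ∑ S (λ u → 𝟙 (dep v u) * N (far v S)) ≡⟨ cong (N S * (2 * d) +_) (sym (∑-*ʳ S _ (N (far v S)))) ⟩
          N S * (2 * d) + ∑ S (𝟙 ∘ dep v) * N (far v S) ≤⟨ +-mono-≤ (≤-reflexive (lemma₄ (N S) d)) (*-monoˡ-≤ _ (sp v)) ⟩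
          2 * N S * d + d * N (far v S) ∎))
        where
        cnt = λ u → count is (λ H → bad u H ∧ avoid (far v S) H)
        shorter : length (far v S) ≤ k
        shorter = s≤s⁻¹ (≤-trans (≤-trans (s≤s (m≤m+n _ m)) (≤-reflexive (trans (sym (+-suc _ m)) (trans (cong (length (far v S) +_) (sym eq)) (length-far v S))))) len)

    N-positive : ∀ S → Sparse S → 0 < N S
    N-positive [] sp = subst (0 <_) (sym (trans (E-const is 1) (*-identityʳ _))) 0<Qⁿ
    N-positive (v ∷ S) sp = +-cancelʳ-< c 0 (N (v ∷ S)) (<-≤-trans c<NS (begin
      N S              ≡⟨ sym (E-cong is split) ⟩
      E is (λ H → 𝟙 (avoid (v ∷ S) H) + 𝟙 (bad v H ∧ avoid S H)) ≡⟨ E-+ is _ _ ⟩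
      N (v ∷ S) + c    ∎))
      where
      open ≤-Reasoning
      c = count is (λ H → bad v H ∧ avoid S H)
      sp′ : Sparse S
      sp′ u = ≤-trans (m≤n+m _ (𝟙 (dep u v))) (sp u)
      split : ∀ H → 𝟙 (avoid (v ∷ S) H) + 𝟙 (bad v H ∧ avoid S H) ≡ 𝟙 (avoid S H)
      split H with bad v H
      ... | true = refl
      ... | false = +-identityʳ _
      2c≤NS : c * 2 ≤ N S
      2c≤NS = ≤-trans (*-monoʳ-≤ c (*-monoʳ-≤ 2 0<d)) (conditional (length S) v S ≤-refl sp′)
      -- At most half is lost, since `d` is positive; when nothing is lost, strictness comes from
      -- the recursion.
      c<NS : c < N S
      c<NS with c | 2c≤NS
      ... | zero | _ = N-positive S sp′
      ... | suc c′ | le = <-≤-trans (m<m*n (suc c′) 2 ≤-refl) le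

    avoid-sound : ∀ {S H} → avoid S H ≡ true → ∀ {v} → v ∈ S → bad v H ≡ false
    avoid-sound {u ∷ S} {H} e (here refl) = not-true (proj₁ (∧-true e))
    avoid-sound {u ∷ S} {H} e (there m) = avoid-sound (proj₂ (∧-true {not (bad u H)} e)) m

    avoidable : ∀ S → Sparse S → ∃ λ H → map proj₁ H ≡ is × avoid S H ≡ true
    avoidable S sp with E-positive is _ (N-positive S sp)
    ... | H , e , pos = H , e , 𝟙-pos pos

-- Inequalities between powers

-- (1 + 1/N)ʸ ≤ N/(N − y), with k = N − y.
^-upper : ∀ {N} y k → y + k ≡ N → suc N ^ y * k ≤ N ^ y * N
^-upper zero k refl = ≤-refl
^-upper {N} (suc y) k e = begin
  suc N * suc N ^ y * k      ≡⟨ l₁ N (suc N ^ y) k ⟩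
  suc N ^ y * (k + N * k)    ≤⟨ *-monoʳ-≤ (suc N ^ y) (+-monoˡ-≤ (N * k) k≤N) ⟩
  suc N ^ y * (N + N * k)    ≡⟨ l₂ N (suc N ^ y) k ⟩
  N * (suc N ^ y * suc k)    ≤⟨ *-monoʳ-≤ N (^-upper y (suc k) (trans (+-suc y k) e)) ⟩
  N * (N ^ y * N)            ≡⟨ sym (*-assoc N (N ^ y) N) ⟩
  N ^ suc y * N              ∎
  where
  open ≤-Reasoning
  k≤N : k ≤ N
  k≤N = ≤-trans (m≤n+m k (suc y)) (≤-reflexive e)
  l₁ : ∀ N p k → suc N * p * k ≡ p * (k + N * k)
  l₁ = solve-∀
  l₂ : ∀ N p k → p * (N + N * k) ≡ N * (p * suc k)
  l₂ = solve-∀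

-- Bernoulli's inequality for 1 + 1/N with denominators cleared.
^-lower : ∀ N y → N ^ y * (N + y) ≤ suc N ^ y * N
^-lower N zero = ≤-reflexive (cong (1 *_) (+-identityʳ N))
^-lower N (suc y) = begin
  N * N ^ y * (N + suc y)          ≡⟨ l₁ N (N ^ y) y ⟩
  N ^ y * (N * N + N * y + N)      ≤⟨ *-monoʳ-≤ (N ^ y) (m≤m+n _ y) ⟩
  N ^ y * (N * N + N * y + N + y)  ≡⟨ l₂ N (N ^ y) y ⟩
  suc N * (N ^ y * (N + y))        ≤⟨ *-monoʳ-≤ (suc N) (^-lower N y) ⟩
  suc N * (suc N ^ y * N)          ≡⟨ sym (*-assoc (suc N) (suc N ^ y) N) ⟩
  suc N ^ suc y * N                ∎
  where
  open ≤-Reasoning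
  l₁ : ∀ N p y → N * p * (N + suc y) ≡ p * (N * N + N * y + N)
  l₁ = solve-∀
  l₂ : ∀ N p y → p * (N * N + N * y + N + y) ≡ suc N * (p * (N + y))
  l₂ = solve-∀

-- Bounds the exponential of one increment by the linear function 1 + m/E, whose average over the
-- letters is known. The base 1 + 1/(M + E) is small enough for all increments up to `M`: after
-- `^-upper` the slack is `m * (M ∸ m)`.
^-step : ∀ M E m → 0 < E → m ≤ M → suc (M + E) ^ m * E ≤ (M + E) ^ m * (E + m)
^-step M E m 0<E m≤M = *-cancelʳ-≤ _ _ k {{>-nonZero 0<k}} (begin
  p * E * k              ≡⟨ l₁ p E k ⟩
  p * k * E              ≤⟨ *-monoˡ-≤ E (^-upper m k e) ⟩
  q * (M + E) * E        ≤⟨ ≤-trans (≤-reflexive (*-assoc q (M + E) E)) (*-monoʳ-≤ q key) ⟩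
  q * ((E + m) * k)      ≡⟨ sym (*-assoc q (E + m) k) ⟩
  q * (E + m) * k        ∎)
  where
  open ≤-Reasoning
  j = M ∸ m
  k = j + E
  p = suc (M + E) ^ m
  q = (M + E) ^ m
  e : m + (j + E) ≡ M + E
  e = trans (sym (+-assoc m j E)) (cong (_+ E) (m+[n∸m]≡n m≤M))
  0<k : 0 < k
  0<k = ≤-trans 0<E (m≤n+m E j)
  l₁ : ∀ p E k → p * E * k ≡ p * k * E
  l₁ = solve-∀
  l₂ : ∀ m j E → (m + (j + E)) * E + m * j ≡ (E + m) * (j + E)
  l₂ = solve-∀
  key : (M + E) * E ≤ (E + m) * k
  key = subst (λ D → D * E ≤ (E + m) * k) e (≤-trans (m≤m+n _ (m * j)) (≤-reflexive (l₂ m j E)))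

-- An exchange rate: `y` units of drift, at base 1 + 1/N, weigh no more than one unit of the total,
-- at base 1 + 1/D. `^-compare-lower` is the opposite rate, for lower tails.
^-compare-upper : ∀ D N y → 0 < D → y * suc D ≤ N → suc N ^ y * D ≤ N ^ y * suc D
^-compare-upper D N zero 0<D _ = ≤-trans (≤-reflexive (*-identityˡ D)) (≤-trans (n≤1+n D) (≤-reflexive (sym (*-identityˡ (suc D)))))
^-compare-upper D N y@(suc _) 0<D le = *-cancelʳ-≤ _ _ k {{>-nonZero 0<k}} (begin
  suc N ^ y * D * k       ≡⟨ l₁ (suc N ^ y) D k ⟩
  suc N ^ y * k * D       ≤⟨ *-monoˡ-≤ D (^-upper y k e) ⟩
  N ^ y * N * D           ≤⟨ ≤-trans (≤-reflexive (*-assoc (N ^ y) N D)) (*-monoʳ-≤ (N ^ y) key) ⟩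
  N ^ y * (suc D * k)     ≡⟨ sym (*-assoc (N ^ y) (suc D) k) ⟩
  N ^ y * suc D * k       ∎)
  where
  open ≤-Reasoning
  y<N : y < N
  y<N = <-≤-trans (m<m*n y (suc D) (s≤s 0<D)) le
  k = N ∸ y
  e : y + k ≡ N
  e = m+[n∸m]≡n (<⇒≤ y<N)
  0<k : 0 < k
  0<k = m<n⇒0<n∸m y<N
  l₁ : ∀ p E k → p * E * k ≡ p * k * E
  l₁ = solve-∀
  l₂ : ∀ y k D → (y + k) * D + (y + k) ≡ suc D * k + y * suc D
  l₂ = solve-∀
  key : N * D ≤ suc D * k
  key = +-cancelʳ-≤ N (N * D) (suc D * k) (≤-trans
    (≤-reflexive (subst (λ N → N * D + N ≡ suc D * k + y * suc D) e (l₂ y k D))) (+-monoʳ-≤ (suc D * k) le))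

^-compare-lower : ∀ D N y → 0 < N → N ≤ y * D → N ^ y * suc D ≤ suc N ^ y * D
^-compare-lower D N y 0<N le = *-cancelʳ-≤ _ _ N {{>-nonZero 0<N}} (begin
  N ^ y * suc D * N         ≡⟨ l₁ (N ^ y) D N ⟩
  N ^ y * (N * D + N)       ≤⟨ *-monoʳ-≤ (N ^ y) (+-monoʳ-≤ (N * D) le) ⟩
  N ^ y * (N * D + y * D)   ≡⟨ l₂ (N ^ y) D N y ⟩
  N ^ y * (N + y) * D       ≤⟨ *-monoˡ-≤ D (^-lower N y) ⟩
  suc N ^ y * N * D         ≡⟨ l₃ (suc N ^ y) N D ⟩
  suc N ^ y * D * N         ∎)
  where
  open ≤-Reasoning
  l₁ : ∀ p D N → p * suc D * N ≡ p * (N * D + N)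
  l₁ = solve-∀
  l₂ : ∀ p D N y → p * (N * D + y * D) ≡ p * (N + y) * D
  l₂ = solve-∀
  l₃ : ∀ p N D → p * N * D ≡ p * D * N
  l₃ = solve-∀

*-^ : ∀ a b k → (a * b) ^ k ≡ a ^ k * b ^ k
*-^ a b zero = refl
*-^ a b (suc k) = trans (cong (a * b *_) (*-^ a b k)) (l a b (a ^ k) (b ^ k))
  where
  l : ∀ a b c d → a * b * (c * d) ≡ a * c * (b * d)
  l = solve-∀

^-compare-power : ∀ {a b c d} y t → a ^ y * b ≤ c ^ y * d → a ^ (y * t) * b ^ t ≤ c ^ (y * t) * d ^ t
^-compare-power {a} {b} {c} {d} y t le =
  subst₂ _≤_ (eq a b) (eq c d) (^-monoˡ-≤ t le)
  where
  eq : ∀ a b → (a ^ y * b) ^ t ≡ a ^ (y * t) * b ^ t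
  eq a b = trans (*-^ (a ^ y) b t) (cong (_* b ^ t) (^-*-assoc a y t))

-- Bernoulli gives (1 + 1/D)ᴰ ≥ 2, so each further `D` units of deviation halve a probability.
^-double : ∀ D z → 0 < D → 2 ^ z * D ^ (z * D) ≤ suc D ^ (z * D)
^-double D z 0<D = subst₂ _≤_
  (trans (*-^ 2 (D ^ D) z) (cong (2 ^ z *_) (trans (^-*-assoc D D z) (cong (D ^_) (*-comm D z)))))
  (trans (^-*-assoc (suc D) D z) (cong (suc D ^_) (*-comm D z)))
  (^-monoˡ-≤ z base)
  where
  open ≤-Reasoning
  l : ∀ p D → 2 * p * D ≡ p * (D + D)
  l = solve-∀
  base : 2 * D ^ D ≤ suc D ^ D
  base = *-cancelʳ-≤ _ _ D {{>-nonZero 0<D}} (begin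
    2 * D ^ D * D     ≡⟨ l (D ^ D) D ⟩
    D ^ D * (D + D)   ≤⟨ ^-lower D D ⟩
    suc D ^ D * D     ∎)

0<^ : ∀ m n → 0 < m → 0 < m ^ n
0<^ m n 0<m = m^n>0 m {{>-nonZero 0<m}} n

0<* : ∀ {m n} → 0 < m → 0 < n → 0 < m * n
0<* {suc m} {suc n} _ _ = z<s

-- Exponential tail bounds

module Tails {I A : Set} (vals : List A) where
  open Words {I} {A} vals

  module _ (ξ : Word I A → I × A → ℕ) where

    total : Word I A → Word I A → ℕ
    total prev [] = 0
    total prev (x ∷ H) = ξ prev x + total (x ∷ prev) H

    -- `Q` times the conditional expectation of the next increment, given the letters `prev` already
    -- read (latest first). Accordingly `drift` is `Q` times the compensator of `total`.
    mean : Word I A → I → ℕ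
    mean prev i = ∑ vals (λ a → ξ prev (i , a))

    drift : Word I A → Word I A → ℕ
    drift prev [] = 0
    drift prev (x ∷ H) = mean prev (proj₁ x) + drift (x ∷ prev) H

  total-const : ∀ (F : I × A → ℕ) prev H → total (λ _ → F) prev H ≡ ∑ H F
  total-const F prev [] = refl
  total-const F prev (x ∷ H) = cong (F x +_) (total-const F (x ∷ prev) H)

  drift-const : ∀ (F : I × A → ℕ) prev H → drift (λ _ → F) prev H ≡ ∑ (map proj₁ H) (λ i → ∑ vals (λ a → F (i , a)))
  drift-const F prev [] = refl
  drift-const F prev (x ∷ H) = cong (_ +_) (drift-const F (x ∷ prev) H)

  -- The exponential moment (1 + 1/D)^total · (1 + 1/N)^(-drift) is a supermartingale; this is the resulting Markov
  -- inequality, with all denominators cleared.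
  upper-potential : ∀ ξ M E′ → (∀ prev x → ξ prev x ≤ M) → 0 < E′ → ∀ is prev r B →
    count is (λ H → (r ≤ᵇ total ξ prev H) ∧ (drift ξ prev H ≤ᵇ B)) * (suc (M + E′) ^ r * (E′ * Q) ^ B)
      ≤ Q ^ length is * ((M + E′) ^ r * suc (E′ * Q) ^ B)
  upper-potential ξ M E′ ξ≤M 0<E′ [] prev zero B =
    ≤-trans (≤-reflexive (l ((E′ * Q) ^ B))) (≤-trans (^-monoˡ-≤ B (n≤1+n (E′ * Q))) (≤-reflexive (sym (l (suc (E′ * Q) ^ B)))))
    where
    l : ∀ p → 1 * (1 * p) ≡ p
    l = solve-∀
  upper-potential ξ M E′ ξ≤M 0<E′ [] prev (suc r) B = z≤n
  upper-potential ξ M E′ ξ≤M 0<E′ (i ∷ is) prev r B with mean ξ prev i ≤? B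
  ... | no k≰B = ≤-trans (≤-reflexive (cong (_* (suc (M + E′) ^ r * (E′ * Q) ^ B)) (∑-zero vals λ a →
                   trans (E-cong is λ H → none a H) (trans (E-const is 0) (*-zeroʳ (Q ^ length is)))))) z≤n
    where
    none : ∀ a H → 𝟙 ((r ≤ᵇ _) ∧ (mean ξ prev i + drift ξ ((i , a) ∷ prev) H ≤ᵇ B)) ≡ 0
    none a H = cong 𝟙 (¬true⇒false λ e → k≰B (≤-trans (m≤m+n _ _) (≤ᵇ-sound (proj₂ (∧-true {r ≤ᵇ _} e)))))
  ... | yes k≤B = *-cancelʳ-≤ _ _ E′ {{>-nonZero 0<E′}} (begin
    S * (sD ^ r * N ^ B) * E′              ≡⟨ cong (λ b → S * (sD ^ r * b) * E′) N^B ⟩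
    S * (sD ^ r * (N ^ B′ * N ^ k)) * E′   ≡⟨ l₁ S (sD ^ r) (N ^ B′) (N ^ k) E′ ⟩
    S * Y * N ^ k                          ≤⟨ *-monoˡ-≤ (N ^ k) sum-bound ⟩
    X * (N + k) * N ^ k                    ≡⟨ l₂ X (N + k) (N ^ k) ⟩
    X * (N ^ k * (N + k))                  ≤⟨ *-monoʳ-≤ X (^-lower N k) ⟩
    X * (suc N ^ k * N)                    ≡⟨ l₃ (Q ^ length is) (D ^ r) (suc N ^ B′) (suc N ^ k) E′ Q ⟩
    Q ^ suc (length is) * (D ^ r * (suc N ^ B′ * suc N ^ k)) * E′ ≡⟨ cong (λ b → Q ^ suc (length is) * (D ^ r * b) * E′) (sym sN^B) ⟩
    Q ^ suc (length is) * (D ^ r * suc N ^ B) * E′ ∎)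
    where
    open ≤-Reasoning
    D = M + E′
    sD = suc (M + E′)
    -- With this base for the drift, summing `E′ + ξ` over the letters gives exactly `N + k`, which
    -- `^-lower` absorbs into `k` units of drift.
    N = E′ * Q
    k = mean ξ prev i
    B′ = B ∸ k
    X = Q ^ length is * (D ^ r * suc N ^ B′)
    Y = sD ^ r * N ^ B′ * E′
    term = λ a → count is (λ H → (r ≤ᵇ ξ prev (i , a) + total ξ ((i , a) ∷ prev) H) ∧ (k + drift ξ ((i , a) ∷ prev) H ≤ᵇ B))
    S = ∑ vals term
    N^B : N ^ B ≡ N ^ B′ * N ^ k
    N^B = trans (cong (N ^_) (sym (m∸n+n≡m k≤B))) (^-distribˡ-+-* N B′ k)
    sN^B : suc N ^ B ≡ suc N ^ B′ * suc N ^ k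
    sN^B = trans (cong (suc N ^_) (sym (m∸n+n≡m k≤B))) (^-distribˡ-+-* (suc N) B′ k)
    l₁ : ∀ s a b c e → s * (a * (b * c)) * e ≡ s * (a * b * e) * c
    l₁ = solve-∀
    l₂ : ∀ x a b → x * a * b ≡ x * (b * a)
    l₂ = solve-∀
    l₃ : ∀ q d s t e Q → q * (d * s) * (t * (e * Q)) ≡ Q * q * (d * (s * t)) * e
    l₃ = solve-∀
    term-bound : ∀ a → term a * Y ≤ X * (E′ + ξ prev (i , a))
    term-bound a = begin
      term a * Y              ≤⟨ *-monoˡ-≤ Y (E-mono is λ H _ → 𝟙-mono (shift H)) ⟩
      c * Y                   ≡⟨ cong (λ p → c * (p * N ^ B′ * E′)) (split sD) ⟩
      c * (sD ^ r′ * sD ^ m * N ^ B′ * E′)  ≡⟨ l₄ c (sD ^ r′) (sD ^ m) (N ^ B′) E′ ⟩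
      c * (sD ^ r′ * N ^ B′) * (sD ^ m * E′)  ≤⟨ *-mono-≤ (upper-potential ξ M E′ ξ≤M 0<E′ is ((i , a) ∷ prev) r′ B′)
                                                        (≤-trans (^-step M E′ m 0<E′ (≤-trans m≤x (ξ≤M prev (i , a))))
                                                                 (*-monoʳ-≤ (D ^ m) (+-monoʳ-≤ E′ m≤x))) ⟩
      Q ^ length is * (D ^ r′ * suc N ^ B′) * (D ^ m * (E′ + x)) ≡⟨ l₅ (Q ^ length is) (D ^ r′) (suc N ^ B′) (D ^ m) (E′ + x) ⟩
      Q ^ length is * (D ^ r′ * D ^ m * suc N ^ B′) * (E′ + x) ≡⟨ cong (λ p → Q ^ length is * (p * suc N ^ B′) * (E′ + x)) (sym (split D)) ⟩
      X * (E′ + x) ∎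
      where
      x = ξ prev (i , a)
      -- Truncated: if the increment overshoots the remaining target `r`, only the part `m` that was
      -- still missing is charged.
      r′ = r ∸ x
      m = r ∸ r′
      c = count is (λ H → (r′ ≤ᵇ total ξ ((i , a) ∷ prev) H) ∧ (drift ξ ((i , a) ∷ prev) H ≤ᵇ B′))
      m≤x : m ≤ x
      m≤x = m≤n+o⇒m∸n≤o r r′ (≤-trans (m≤n+m∸n r x) (≤-reflexive (+-comm x r′)))
      split : ∀ p → p ^ r ≡ p ^ r′ * p ^ m
      split p = trans (cong (p ^_) (sym (m+[n∸m]≡n (m∸n≤m r x)))) (^-distribˡ-+-* p r′ m)
      shift : ∀ H → _ → _
      shift H e = let e₁ , e₂ = ∧-true {r ≤ᵇ x + total ξ ((i , a) ∷ prev) H} e in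
        cong₂ _∧_ (≤ᵇ-true (m≤n+o⇒m∸n≤o r x (≤ᵇ-sound e₁)))
                  (≤ᵇ-true (m+n≤o⇒m≤o∸n (drift ξ ((i , a) ∷ prev) H) (≤-trans (≤-reflexive (+-comm _ k)) (≤ᵇ-sound e₂))))
      l₄ : ∀ c a b d e → c * (a * b * d * e) ≡ c * (a * d) * (b * e)
      l₄ = solve-∀
      l₅ : ∀ q a b d e → q * (a * b) * (d * e) ≡ q * (a * d * b) * e
      l₅ = solve-∀
    sum-bound : S * Y ≤ X * (N + k)
    sum-bound = begin
      S * Y                                          ≡⟨ ∑-*ʳ vals term Y ⟩
      ∑ vals (λ a → term a * Y)                      ≤⟨ ∑-mono vals term-bound ⟩
      ∑ vals (λ a → X * (E′ + ξ prev (i , a)))       ≡⟨ sym (∑-*ˡ vals _ X) ⟩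
      X * ∑ vals (λ a → E′ + ξ prev (i , a))         ≡⟨ cong (X *_) (∑-+ vals _ _) ⟩
      X * (∑ vals (λ _ → E′) + k)                    ≡⟨ cong (λ e → X * (e + k)) (trans (∑-const vals E′) (*-comm Q E′)) ⟩
      X * (N + k)                                    ∎

  -- Drift at most `y * b` means a compensator of at most 4b/5. The factor 5/4 up to `b` is what
  -- makes the potential favourable; beyond `b`, `^-double` halves the probability for each
  -- `M + 4 * suc M`.
  upper-tail : ∀ ξ M → (∀ prev x → ξ prev x ≤ M) → 0 < Q → ∀ is y b z → 5 * y ≤ 4 * Q →
    count is (λ H → (b + z * (M + 4 * suc M) ≤ᵇ total ξ [] H) ∧ (drift ξ [] H ≤ᵇ y * b)) * 2 ^ z ≤ Q ^ length is
  upper-tail ξ M ξ≤M 0<Q is y b z 5y≤4Q = *-cancelʳ-≤ _ _ W {{>-nonZero 0<W}} (begin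
    c * 2 ^ z * W                                      ≡⟨ l₁ c (2 ^ z) (sD ^ b) (N ^ B) (D ^ (z * D)) ⟩
    c * (sD ^ b * N ^ B * (2 ^ z * D ^ (z * D)))       ≤⟨ *-monoʳ-≤ c (*-monoʳ-≤ (sD ^ b * N ^ B) (^-double D z 0<D)) ⟩
    c * (sD ^ b * N ^ B * sD ^ (z * D))                ≡⟨ cong (c *_) (trans (l₂ (sD ^ b) (N ^ B) (sD ^ (z * D))) (cong (_* N ^ B) (sym (^-distribˡ-+-* sD b (z * D))))) ⟩
    c * (sD ^ (b + z * D) * N ^ B)                     ≤⟨ upper-potential ξ M E′ ξ≤M z<s is [] (b + z * D) B ⟩
    q * (D ^ (b + z * D) * suc N ^ B)                  ≡⟨ cong (λ p → q * (p * suc N ^ B)) (^-distribˡ-+-* D b (z * D)) ⟩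
    q * (D ^ b * D ^ (z * D) * suc N ^ B)              ≡⟨ cong (q *_) (l₃ (D ^ b) (D ^ (z * D)) (suc N ^ B)) ⟩
    q * (suc N ^ B * D ^ b * D ^ (z * D))              ≤⟨ *-monoʳ-≤ q (*-monoˡ-≤ (D ^ (z * D)) (^-compare-power {suc N} {D} {N} {sD} y b (^-compare-upper D N y 0<D y≤))) ⟩
    q * (N ^ B * sD ^ b * D ^ (z * D))                 ≡⟨ cong (λ p → q * (p * D ^ (z * D))) (*-comm (N ^ B) (sD ^ b)) ⟩
    q * W                                              ∎)
    where
    open ≤-Reasoning
    -- Then `suc D` is `5 * suc M`, so `E′` and `suc D` are in the ratio 4 : 5 and the hypothesis on
    -- `y` becomes the exchange rate `y * suc D ≤ N`.
    E′ = 4 * suc M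
    D = M + E′
    sD = suc D
    N = E′ * Q
    B = y * b
    q = Q ^ length is
    W = sD ^ b * N ^ B * D ^ (z * D)
    c = count is (λ H → (b + z * D ≤ᵇ total ξ [] H) ∧ (drift ξ [] H ≤ᵇ B))
    0<D : 0 < D
    0<D = ≤-trans (s≤s z≤n) (m≤n+m E′ M)
    0<W : 0 < W
    0<W = 0<* (0<* (0<^ sD b z<s) (0<^ N B (0<* {E′} z<s 0<Q))) (0<^ D (z * D) 0<D)
    y≤ : y * sD ≤ N
    y≤ = subst₂ _≤_ (l₄ y M) (l₅ Q M) (*-monoˡ-≤ (suc M) 5y≤4Q)
      where
      l₄ : ∀ y M → 5 * y * suc M ≡ y * suc (M + 4 * suc M)
      l₄ = solve-∀
      l₅ : ∀ Q M → 4 * Q * suc M ≡ 4 * suc M * Q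
      l₅ = solve-∀
    l₁ : ∀ c t a b d → c * t * (a * b * d) ≡ c * (a * b * (t * d))
    l₁ = solve-∀
    l₂ : ∀ a b d → a * b * d ≡ a * d * b
    l₂ = solve-∀
    l₃ : ∀ a b d → a * b * d ≡ d * a * b
    l₃ = solve-∀

  module _ (P : I × A → Bool) where

    hits : Word I A → ℕ
    hits H = ∑ H (𝟙 ∘ P)

    -- `Q` times the expected value of `hits`.
    size : List I → ℕ
    size is = ∑ is (λ i → ∑ vals (λ a → 𝟙 (P (i , a))))

    -- Markov's inequality for (1 + 1/D) to the power -hits. An index with `k` letters in `P`
    -- contributes the mean 1 - k/N with N = Q · (D + 1), and by `^-upper` this is at most (1 + 1/N)
    -- to the power -k.
    lower-potential : ∀ D is s →
      count is (λ H → hits H ≤ᵇ s) * (suc (Q * suc D) ^ size is * D ^ s) ≤ Q ^ length is * ((Q * suc D) ^ size is * suc D ^ s)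
    lower-potential D [] s = *-monoʳ-≤ 1 (*-monoʳ-≤ 1 (^-monoˡ-≤ s (n≤1+n D)))
    lower-potential D (i ∷ is) s = *-cancelʳ-≤ _ _ (suc D) (begin
      S * (suc N ^ (k + p) * D ^ s) * suc D   ≡⟨ cong (λ e → S * (e * D ^ s) * suc D) (^-distribˡ-+-* (suc N) k p) ⟩
      S * (suc N ^ k * suc N ^ p * D ^ s) * suc D ≡⟨ l₁ S (suc N ^ k) (suc N ^ p) (D ^ s) (suc D) ⟩
      S * Y * suc N ^ k                       ≤⟨ *-monoˡ-≤ (suc N ^ k) sum-bound ⟩
      X * (N ∸ k) * suc N ^ k                 ≡⟨ l₂ X (N ∸ k) (suc N ^ k) ⟩
      X * (suc N ^ k * (N ∸ k))               ≤⟨ *-monoʳ-≤ X (^-upper k (N ∸ k) (m+[n∸m]≡n k≤N)) ⟩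
      X * (N ^ k * N)                         ≡⟨ l₃ (Q ^ length is) (N ^ p) (suc D ^ s) (N ^ k) Q (suc D) ⟩
      Q ^ suc (length is) * (N ^ k * N ^ p * suc D ^ s) * suc D ≡⟨ cong (λ e → Q ^ suc (length is) * (e * suc D ^ s) * suc D) (sym (^-distribˡ-+-* N k p)) ⟩
      Q ^ suc (length is) * (N ^ (k + p) * suc D ^ s) * suc D ∎)
      where
      open ≤-Reasoning
      N = Q * suc D
      p = size is
      k = ∑ vals (λ a → 𝟙 (P (i , a)))
      term = λ a → count is (λ H → 𝟙 (P (i , a)) + hits H ≤ᵇ s)
      S = ∑ vals term
      X = Q ^ length is * (N ^ p * suc D ^ s)
      Y = suc N ^ p * D ^ s * suc D
      k≤N : k ≤ N
      k≤N = ≤-trans (∑-≤const vals 1 (λ a → 𝟙≤1 (P (i , a)))) (*-monoʳ-≤ Q (s≤s z≤n))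
      l₁ : ∀ S a b c d → S * (a * b * c) * d ≡ S * (b * c * d) * a
      l₁ = solve-∀
      l₂ : ∀ X a b → X * a * b ≡ X * (b * a)
      l₂ = solve-∀
      l₃ : ∀ q a b c Q d → q * (a * b) * (c * (Q * d)) ≡ Q * q * (c * a * b) * d
      l₃ = solve-∀
      l₄ : ∀ c a b d → c * (a * b * d) ≡ c * (a * b) * d
      l₄ = solve-∀
      l₅ : ∀ c a b d e → c * (a * (d * b) * e) ≡ c * (a * b) * (d * e)
      l₅ = solve-∀
      l₇ : ∀ q a b d → q * (a * b) * (d * suc d) + q * (a * (suc d * b)) * 1 ≡ q * (a * (suc d * b)) * suc d
      l₇ = solve-∀
      term-bound : ∀ a s → count is (λ H → 𝟙 (P (i , a)) + hits H ≤ᵇ s) * (suc N ^ p * D ^ s * suc D) + Q ^ length is * (N ^ p * suc D ^ s) * 𝟙 (P (i , a))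
                         ≤ Q ^ length is * (N ^ p * suc D ^ s) * suc D
      term-bound a s with P (i , a)
      term-bound a s | false = begin
        c * (suc N ^ p * D ^ s * suc D) + x * 0  ≡⟨ trans (cong (c * (suc N ^ p * D ^ s * suc D) +_) (*-zeroʳ x)) (+-identityʳ _) ⟩
        c * (suc N ^ p * D ^ s * suc D)          ≡⟨ l₄ c (suc N ^ p) (D ^ s) (suc D) ⟩
        c * (suc N ^ p * D ^ s) * suc D          ≤⟨ *-monoˡ-≤ (suc D) (lower-potential D is s) ⟩
        x * suc D                                ∎
        where
        c = count is (λ H → hits H ≤ᵇ s)
        x = Q ^ length is * (N ^ p * suc D ^ s)
      -- A hit when none is allowed: the event is empty and its count is 0.
      term-bound a zero | true = begin
        c * y + x * 1   ≡⟨ cong₂ (λ c e → c * y + e) (trans (E-const is 0) (*-zeroʳ (Q ^ length is))) (*-identityʳ x) ⟩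
        x               ≤⟨ m≤m*n x (suc D) ⟩
        x * suc D       ∎
        where
        c = E is (λ _ → 0)
        x = Q ^ length is * (N ^ p * 1)
        y = suc N ^ p * 1 * suc D
      term-bound a (suc s) | true = begin
        c * (suc N ^ p * (D * D ^ s) * suc D) + x * 1    ≤⟨ +-monoˡ-≤ (x * 1) (*-monoˡ-≤ _ c≤c′) ⟩
        c′ * (suc N ^ p * (D * D ^ s) * suc D) + x * 1   ≡⟨ cong (_+ x * 1) (l₅ c′ (suc N ^ p) (D ^ s) D (suc D)) ⟩
        c′ * (suc N ^ p * D ^ s) * (D * suc D) + x * 1   ≤⟨ +-monoˡ-≤ (x * 1) (*-monoˡ-≤ (D * suc D) (lower-potential D is s)) ⟩
        Q ^ length is * (N ^ p * suc D ^ s) * (D * suc D) + x * 1 ≡⟨ l₇ (Q ^ length is) (N ^ p) (suc D ^ s) D ⟩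
        x * suc D                                        ∎
        where
        c = count is (λ H → suc (hits H) ≤ᵇ suc s)
        c′ = count is (λ H → hits H ≤ᵇ s)
        x = Q ^ length is * (N ^ p * (suc D * suc D ^ s))
        c≤c′ : c ≤ c′
        c≤c′ = E-mono is λ H _ → 𝟙-mono λ e → ≤ᵇ-true (s≤s⁻¹ (≤ᵇ-sound {suc (hits H)} {suc s} e))
      sum-bound : S * Y ≤ X * (N ∸ k)
      sum-bound = ≤-trans (m+n≤o⇒m≤o∸n (S * Y) (begin
        S * Y + X * k                                                ≡⟨ cong₂ _+_ (∑-*ʳ vals term Y) (∑-*ˡ vals _ X) ⟩
        ∑ vals (λ a → term a * Y) + ∑ vals (λ a → X * 𝟙 (P (i , a))) ≡⟨ sym (∑-+ vals _ _) ⟩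
        ∑ vals (λ a → term a * Y + X * 𝟙 (P (i , a)))                ≤⟨ ∑-≤const vals (X * suc D) (λ a → term-bound a s) ⟩
        Q * (X * suc D)                                              ≡⟨ l₈ Q X (suc D) ⟩
        X * N                                                        ∎))
        (≤-reflexive (sym (*-distribˡ-∸ X N k)))
        where
        l₈ : ∀ Q X d → Q * (X * d) ≡ X * (Q * d)
        l₈ = solve-∀

    -- The expected number of hits is at least 5/4 of `s + z * 4`. Taking `D = 4` makes 5 : 4 the
    -- exact exchange rate, and every four hits of the margin `z * 4` halve the probability.
    lower-tail : 0 < Q → ∀ is y s z → 5 * Q ≤ 4 * y → y * (s + z * 4) ≤ size is →
      count is (λ H → hits H ≤ᵇ s) * 2 ^ z ≤ Q ^ length is
    lower-tail 0<Q is y s z 5Q≤4y le = *-cancelʳ-≤ _ _ W {{>-nonZero 0<W}} (begin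
      c * 2 ^ z * W                                    ≡⟨ l₁ c (2 ^ z) (suc N ^ p) (4 ^ s) (4 ^ (z * 4)) ⟩
      c * (suc N ^ p * 4 ^ s) * (2 ^ z * 4 ^ (z * 4))  ≤⟨ *-mono-≤ (lower-potential 4 is s) (^-double 4 z z<s) ⟩
      q * (N ^ p * 5 ^ s) * 5 ^ (z * 4)                ≡⟨ l₂ q (N ^ p) (5 ^ s) (5 ^ (z * 4)) ⟩
      q * (N ^ p * (5 ^ s * 5 ^ (z * 4)))              ≡⟨ cong (λ e → q * (N ^ p * e)) (sym (^-distribˡ-+-* 5 s (z * 4))) ⟩
      q * (N ^ p * 5 ^ t)                              ≤⟨ *-monoʳ-≤ q comparison ⟩
      q * (suc N ^ p * 4 ^ t)                          ≡⟨ cong (λ e → q * (suc N ^ p * e)) (^-distribˡ-+-* 4 s (z * 4)) ⟩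
      q * (suc N ^ p * (4 ^ s * 4 ^ (z * 4)))          ∎)
      where
      open ≤-Reasoning
      N = Q * 5
      p = size is
      q = Q ^ length is
      t = s + z * 4
      W = suc N ^ p * (4 ^ s * 4 ^ (z * 4))
      c = count is (λ H → hits H ≤ᵇ s)
      0<W : 0 < W
      0<W = 0<* (0<^ (suc N) p z<s) (0<* (0<^ 4 s z<s) (0<^ 4 (z * 4) z<s))
      l₁ : ∀ c t a b d → c * t * (a * (b * d)) ≡ c * (a * b) * (t * d)
      l₁ = solve-∀
      l₂ : ∀ q a b d → q * (a * b) * d ≡ q * (a * (b * d))
      l₂ = solve-∀
      l₃ : ∀ a b c → a * b * c ≡ a * c * b
      l₃ = solve-∀
      rest = p ∸ y * t
      split : ∀ x → x ^ p ≡ x ^ (y * t) * x ^ rest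
      split x = trans (cong (x ^_) (sym (m+[n∸m]≡n le))) (^-distribˡ-+-* x (y * t) rest)
      comparison : N ^ p * 5 ^ t ≤ suc N ^ p * 4 ^ t
      comparison = begin
        N ^ p * 5 ^ t                              ≡⟨ trans (cong (_* 5 ^ t) (split N)) (l₃ (N ^ (y * t)) (N ^ rest) (5 ^ t)) ⟩
        N ^ (y * t) * 5 ^ t * N ^ rest             ≤⟨ *-mono-≤ (^-compare-power {N} {5} {suc N} {4} y t
                                                        (^-compare-lower 4 N y (0<* 0<Q z<s) (subst₂ _≤_ (*-comm 5 Q) (*-comm 4 y) 5Q≤4y)))
                                                      (^-monoˡ-≤ rest (n≤1+n N)) ⟩
        suc N ^ (y * t) * 4 ^ t * suc N ^ rest     ≡⟨ trans (l₃ (suc N ^ (y * t)) (4 ^ t) (suc N ^ rest)) (cong (_* 4 ^ t) (sym (split (suc N)))) ⟩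
        suc N ^ p * 4 ^ t                          ∎

-- Letters that survive pairwise interference

module Blocking {I A : Set} (vals : List A) (P : I × A → Bool) (R : I × A → I × A → Bool)
  (R-sym : ∀ x y → R x y ≡ R y x) (R-irrefl : ∀ x → R x x ≡ false) where

  open Words {I} {A} vals
  open Tails {I} {A} vals

  survivors : Word I A → ℕ
  survivors H = ∑ H (λ x → 𝟙 (P x ∧ not (any (R x) H)))

  blocked : Word I A → I × A → ℕ
  blocked prev x = 𝟙 (P x ∧ any (R x) prev)

  earlier : Word I A → ℕ
  earlier = total blocked []

  later : Word I A → ℕ
  later [] = 0
  later (x ∷ H) = blocked H x + later H

  total-snoc : ∀ prev H x → total blocked prev (H ∷ʳ x) ≡ total blocked prev H + blocked (H ʳ++ prev) x
  total-snoc prev [] x = +-identityʳ _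
  total-snoc prev (y ∷ H) x = trans (cong (blocked prev y +_) (total-snoc (y ∷ prev) H x)) (sym (+-assoc (blocked prev y) _ _))

  -- Interference with what follows is not predictable from the left, but it is from the right, so a
  -- single tail bound serves both directions.
  later≡ : ∀ H → later H ≡ earlier (reverse H)
  later≡ [] = refl
  later≡ (x ∷ H) = begin
    blocked H x + later H                                    ≡⟨ +-comm (blocked H x) _ ⟩
    later H + blocked H x                                    ≡⟨ cong₂ (λ a K → a + blocked K x) (later≡ H) (sym (reverse-involutive H)) ⟩
    earlier (reverse H) + blocked (reverse (reverse H)) x    ≡⟨ sym (total-snoc [] (reverse H) x) ⟩
    earlier (reverse H ∷ʳ x)                                 ≡⟨ cong earlier (sym (unfold-reverse x H)) ⟩
    earlier (reverse (x ∷ H))                                ∎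
    where open ≡-Reasoning

  -- A letter of P that does not survive interferes with an earlier or with a later one. Revealing the word from the left
  -- or from the right makes either of these predictable, and load bounds the accumulated probability.
  hits≤ : ∀ H → hits P H ≤ survivors H + (earlier H + earlier (reverse H))
  hits≤ H = subst (λ l → hits P H ≤ survivors H + (earlier H + l)) (later≡ H) (go [] H λ _ → inj₂)
    where
    regroup : ∀ a b c d e f → (a + b + c) + (d + (e + f)) ≡ (a + d) + ((b + e) + (c + f))
    regroup = solve-∀
    -- Invariant: interference with the whole word is located either in the part already read or in
    -- the part still to come.
    go : ∀ prev K → (∀ x → any (R x) H ≡ true → any (R x) prev ≡ true ⊎ any (R x) K ≡ true) →
      hits P K ≤ ∑ K (λ x → 𝟙 (P x ∧ not (any (R x) H))) + (total blocked prev K + later K)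
    go prev [] h = z≤n
    go prev (x ∷ K) h = ≤-trans (+-mono-≤ at-head (go (x ∷ prev) K at-tail))
      (≤-reflexive (regroup (𝟙 (P x ∧ not (any (R x) H))) (blocked prev x) (blocked K x) _ _ _))
      where
      at-head : 𝟙 (P x) ≤ 𝟙 (P x ∧ not (any (R x) H)) + blocked prev x + blocked K x
      at-head with P x | any (R x) H | h x
      ... | false | _ | _ = z≤n
      ... | true | false | _ = s≤s z≤n
      ... | true | true | alt with alt refl
      ...   | inj₁ e rewrite e = s≤s z≤n
      ...   | inj₂ e rewrite R-irrefl x | e = m≤n+m 1 _
      at-tail : ∀ y → any (R y) H ≡ true → any (R y) (x ∷ prev) ≡ true ⊎ any (R y) K ≡ true
      at-tail y e with h y e
      ... | inj₁ e′ rewrite e′ with R y x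
      ...   | true = inj₁ refl
      ...   | false = inj₁ refl
      at-tail y e | inj₂ e′ with R y x
      ...   | true = inj₁ refl
      ...   | false = inj₂ e′

  weight : I → I × A → ℕ
  weight i x = ∑ vals (λ a → 𝟙 (P (i , a)) * 𝟙 (R (i , a) x))

  load : List I → I × A → ℕ
  load is x = ∑ is (λ i → weight i x)

  mean≤ : ∀ prev i → mean blocked prev i ≤ ∑ prev (weight i)
  mean≤ prev i = begin
    ∑ vals (λ a → 𝟙 (P (i , a) ∧ any (R (i , a)) prev))                ≡⟨ ∑-cong vals (λ a → 𝟙-∧ (P (i , a)) _) ⟩
    ∑ vals (λ a → 𝟙 (P (i , a)) * 𝟙 (any (R (i , a)) prev))            ≤⟨ ∑-mono vals (λ a → *-monoʳ-≤ (𝟙 (P (i , a))) (𝟙-any (R (i , a)) prev)) ⟩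
    ∑ vals (λ a → 𝟙 (P (i , a)) * ∑ prev (λ x → 𝟙 (R (i , a) x)))      ≡⟨ ∑-cong vals (λ a → ∑-*ˡ prev _ (𝟙 (P (i , a)))) ⟩
    ∑ vals (λ a → ∑ prev (λ x → 𝟙 (P (i , a)) * 𝟙 (R (i , a) x)))      ≡⟨ ∑-swap vals prev _ ⟩
    ∑ prev (weight i)                                                  ∎
    where open ≤-Reasoning

  -- The drift of `earlier` is random. The union bound of `mean≤` charges it to the single letters,
  -- and exchanging the sums leaves a sum of one load per letter, to which `upper-tail` applies once
  -- more. The first summand carries the letters read before, for the induction.
  drift-load : ∀ prev H → drift blocked prev H ≤ ∑ (map proj₁ H) (λ i → ∑ prev (weight i)) + ∑ H (load (map proj₁ H))
  drift-load prev [] = z≤n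
  drift-load prev ((i , a) ∷ H) = begin
    mean blocked prev i + drift blocked ((i , a) ∷ prev) H
      ≤⟨ +-mono-≤ (mean≤ prev i) (drift-load ((i , a) ∷ prev) H) ⟩
    p + (∑ js (λ j → weight j (i , a) + ∑ prev (weight j)) + ∑ H (load js))
      ≡⟨ cong (λ e → p + (e + ∑ H (load js))) (∑-+ js _ _) ⟩
    p + ((load js (i , a) + q) + ∑ H (load js))
      ≡⟨ regroup p (load js (i , a)) q (∑ H (load js)) ⟩
    (p + q) + (load js (i , a) + ∑ H (load js))
      ≤⟨ +-monoʳ-≤ (p + q) (+-mono-≤ (m≤n+m _ (weight i (i , a))) (∑-mono H λ x → m≤n+m _ (weight i x))) ⟩
    (p + q) + (load (i ∷ js) (i , a) + ∑ H (load (i ∷ js))) ∎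
    where
    open ≤-Reasoning
    js = map proj₁ H
    p = ∑ prev (weight i)
    q = ∑ js (λ j → ∑ prev (weight j))
    regroup : ∀ p l q s → p + ((l + q) + s) ≡ (p + q) + (l + s)
    regroup = solve-∀

  module _ (0<Q : 0 < Q) (M z : ℕ) where

    Degree : List I → Set
    Degree is = ∀ x → ∑ is (λ i → ∑ vals (λ a → 𝟙 (R x (i , a)))) ≤ M

    module _ (is : List I) (deg : Degree is) where

      load≤M : ∀ x → load is x ≤ M
      load≤M x = ≤-trans (∑-mono is λ i → ∑-mono vals λ a → ≤-trans (𝟙-*≤ (P (i , a)) _)
        (≤-reflexive (cong 𝟙 (R-sym (i , a) x)))) (deg x)

      -- Double counting of interfering pairs: seen from its member in `P`, each pair has one of at
      -- most `M` partners.
      load-total : ∑ is (λ j → ∑ vals (λ b → load is (j , b))) ≤ size P is * M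
      load-total = begin
        ∑ is (λ j → ∑ vals (λ b → ∑ is (λ i → weight i (j , b))))
          ≡⟨ ∑-cong is (λ j → ∑-swap vals is _) ⟩
        ∑ is (λ j → ∑ is (λ i → ∑ vals (λ b → weight i (j , b))))
          ≡⟨ ∑-swap is is _ ⟩
        ∑ is (λ i → ∑ is (λ j → ∑ vals (λ b → weight i (j , b))))
          ≡⟨ ∑-cong is (λ i → ∑-cong is λ j → ∑-swap vals vals _) ⟩
        ∑ is (λ i → ∑ is (λ j → ∑ vals (λ a → ∑ vals (λ b → 𝟙 (P (i , a)) * 𝟙 (R (i , a) (j , b))))))
          ≡⟨ ∑-cong is (λ i → ∑-swap is vals _) ⟩
        ∑ is (λ i → ∑ vals (λ a → ∑ is (λ j → ∑ vals (λ b → 𝟙 (P (i , a)) * 𝟙 (R (i , a) (j , b))))))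
          ≡⟨ ∑-cong is (λ i → ∑-cong vals λ a → trans (∑-cong is λ j → sym (∑-*ˡ vals _ (𝟙 (P (i , a))))) (sym (∑-*ˡ is _ (𝟙 (P (i , a)))))) ⟩
        ∑ is (λ i → ∑ vals (λ a → 𝟙 (P (i , a)) * ∑ is (λ j → ∑ vals (λ b → 𝟙 (R (i , a) (j , b))))))
          ≤⟨ ∑-mono is (λ i → ∑-mono vals λ a → *-monoʳ-≤ (𝟙 (P (i , a))) (deg (i , a))) ⟩
        ∑ is (λ i → ∑ vals (λ a → 𝟙 (P (i , a)) * M))
          ≡⟨ trans (∑-cong is λ i → sym (∑-*ʳ vals _ M)) (sym (∑-*ʳ is _ M)) ⟩
        size P is * M ∎
        where open ≤-Reasoning

      -- Either the drift stays within `y * b` and `earlier` still exceeds its bound (`U`), or the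
      -- loads sum to more than expected (`W`). The 9 is `M + 4 * suc M` for increments of at most
      -- 1.
      earlier-tail : ∀ y b₀ b → 5 * y ≤ 4 * Q → size P is * M ≤ y * b₀ → b₀ + z * (M + 4 * suc M) ≤ y * b →
        count is (λ H → b + z * 9 ≤ᵇ earlier H) * 2 ^ z ≤ 2 * Q ^ length is
      earlier-tail y b₀ b 5y≤4Q h₁ h₂ = begin
        count is (λ H → b + z * 9 ≤ᵇ earlier H) * 2 ^ z
          ≤⟨ *-monoˡ-≤ (2 ^ z) (≤-trans (E-mono is λ H e → pointwise H e) (≤-reflexive (E-+ is _ _))) ⟩
        (count is U + count is W) * 2 ^ z
          ≡⟨ *-distribʳ-+ (2 ^ z) (count is U) (count is W) ⟩
        count is U * 2 ^ z + count is W * 2 ^ z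
          ≤⟨ +-mono-≤ (upper-tail blocked 1 (λ prev x → 𝟙≤1 _) 0<Q is y b z 5y≤4Q)
                      (upper-tail (λ _ → load is) M (λ _ → load≤M) 0<Q is y b₀ z 5y≤4Q) ⟩
        Q ^ length is + Q ^ length is
          ≡⟨ cong (Q ^ length is +_) (sym (+-identityʳ _)) ⟩
        2 * Q ^ length is ∎
        where
        open ≤-Reasoning
        U = λ H → (b + z * 9 ≤ᵇ earlier H) ∧ (drift blocked [] H ≤ᵇ y * b)
        W = λ H → (b₀ + z * (M + 4 * suc M) ≤ᵇ total (λ _ → load is) [] H) ∧ (drift (λ _ → load is) [] H ≤ᵇ y * b₀)
        pointwise : ∀ H → map proj₁ H ≡ is → 𝟙 (b + z * 9 ≤ᵇ earlier H) ≤ 𝟙 (U H) + 𝟙 (W H)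
        pointwise H e with b + z * 9 ≤ᵇ earlier H
        ... | false = z≤n
        ... | true with drift blocked [] H ≤? y * b
        ...   | yes le rewrite ≤ᵇ-true le = s≤s z≤n
        ...   | no gt = ≤-trans (≤-reflexive (cong 𝟙 (sym W-true))) (m≤n+m _ (𝟙 (drift blocked [] H ≤ᵇ y * b)))
          where
          drift≤ : drift blocked [] H ≤ ∑ H (load is)
          drift≤ = ≤-trans (drift-load [] H) (≤-reflexive (cong₂ _+_ (∑-zero (map proj₁ H) λ _ → refl) (cong (λ js → ∑ H (load js)) e)))
          W-true : W H ≡ true
          W-true = cong₂ _∧_
            (≤ᵇ-true (≤-trans h₂ (≤-trans (<⇒≤ (≰⇒> gt)) (≤-trans drift≤ (≤-reflexive (sym (total-const (load is) [] H)))))))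
            (≤ᵇ-true (≤-trans (≤-reflexive (trans (drift-const (load is) [] H) (cong (λ js → ∑ js (λ i → ∑ vals (λ a → load is (i , a)))) e)))
                              (≤-trans load-total h₁)))

    -- Few survivors mean few hits or much interference from one side. The factor 5 is 1 for the
    -- hits and 2 for each side.
    survivors-tail : ∀ is → Degree is → ∀ yᵤ yₗ b₀ b t → 5 * yᵤ ≤ 4 * Q → 5 * Q ≤ 4 * yₗ →
      size P is * M ≤ yᵤ * b₀ → b₀ + z * (M + 4 * suc M) ≤ yᵤ * b →
      yₗ * (t + ((b + z * 9) + (b + z * 9)) + z * 4) ≤ size P is →
      count is (λ H → survivors H ≤ᵇ t) * 2 ^ z ≤ 5 * Q ^ length is
    survivors-tail is deg yᵤ yₗ b₀ b t hᵤ hₗ h₁ h₂ h₃ = begin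
      count is (λ H → survivors H ≤ᵇ t) * 2 ^ z
        ≤⟨ *-monoˡ-≤ (2 ^ z) (≤-trans (E-mono is λ H _ → pointwise H)
             (≤-reflexive (trans (E-+ is _ _) (cong (count is X +_) (E-+ is _ _))))) ⟩
      (count is X + (count is Y + count is Y′)) * 2 ^ z
        ≡⟨ distr (count is X) (count is Y) (count is Y′) (2 ^ z) ⟩
      count is X * 2 ^ z + (count is Y * 2 ^ z + count is Y′ * 2 ^ z)
        ≤⟨ +-mono-≤ (lower-tail P 0<Q is yₗ (t + (r + r)) z hₗ h₃)
             (+-mono-≤ (earlier-tail is deg yᵤ b₀ b hᵤ h₁ h₂)
                       (≤-trans (*-monoˡ-≤ (2 ^ z) (≤-reflexive (sym (E-reverse is (𝟙 ∘ Y)))))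
                         (≤-trans (earlier-tail (reverse is) deg′ yᵤ b₀ b hᵤ (subst (λ s → s * M ≤ yᵤ * b₀) (sym (∑-reverse is _)) h₁) h₂)
                                  (≤-reflexive (cong (λ l → 2 * Q ^ l) (length-reverse is)))))) ⟩
      Q ^ length is + (2 * Q ^ length is + 2 * Q ^ length is)
        ≡⟨ five (Q ^ length is) ⟩
      5 * Q ^ length is ∎
      where
      open ≤-Reasoning
      r = b + z * 9
      X = λ H → hits P H ≤ᵇ t + (r + r)
      Y = λ H → r ≤ᵇ earlier H
      Y′ = λ H → r ≤ᵇ earlier (reverse H)
      distr : ∀ a b c d → (a + (b + c)) * d ≡ a * d + (b * d + c * d)
      distr = solve-∀
      five : ∀ q → q + (2 * q + 2 * q) ≡ 5 * q
      five = solve-∀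
      deg′ : Degree (reverse is)
      deg′ x = subst (_≤ M) (sym (∑-reverse is _)) (deg x)
      pointwise : ∀ H → 𝟙 (survivors H ≤ᵇ t) ≤ 𝟙 (X H) + (𝟙 (Y H) + 𝟙 (Y′ H))
      pointwise H with survivors H ≤ᵇ t in eq
      ... | false = z≤n
      ... | true with r ≤? earlier H | r ≤? earlier (reverse H)
      ...   | yes le | _ rewrite ≤ᵇ-true le = ≤-trans (m≤n+m 1 (𝟙 (X H))) (+-monoʳ-≤ (𝟙 (X H)) (s≤s z≤n))
      ...   | no _ | yes le rewrite ≤ᵇ-true le = ≤-trans (m≤n+m 1 (𝟙 (Y H))) (m≤n+m _ (𝟙 (X H)))
      ...   | no gt | no gt′ = ≤-trans (≤-reflexive (cong 𝟙 (sym (≤ᵇ-true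
                (≤-trans (hits≤ H) (+-mono-≤ (≤ᵇ-sound {survivors H} {t} eq) (+-mono-≤ (<⇒≤ (≰⇒> gt)) (<⇒≤ (≰⇒> gt′))))))))) (m≤m+n (𝟙 (X H)) _)

-- Counting in lists and colour classes

countB≡∑ : ∀ {n} (p : Fin n → Bool) xs → countB p xs ≡ ∑ xs (𝟙 ∘ p)
countB≡∑ p [] = refl
countB≡∑ p (x ∷ xs) with p x
... | true = cong suc (countB≡∑ p xs)
... | false = countB≡∑ p xs

any-intro : ∀ {n} (p : Fin n → Bool) i → p i ≡ true → any p (allFin n) ≡ true
any-intro {n} p i e = go (∈-allFin i)
  where
  go : ∀ {xs} → i ∈ xs → any p xs ≡ true
  go (here refl) rewrite e = refl
  go {x ∷ xs} (there m) with p x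
  ... | true = refl
  ... | false = go m

any-elim : ∀ {A : Set} (p : A → Bool) xs → any p xs ≡ true → ∃ λ x → x ∈ xs × p x ≡ true
any-elim p (x ∷ xs) e with p x in eq
... | true = x , here refl , eq
... | false with any-elim p xs e
...   | y , m , e′ = y , there m , e′

∑ᶠ-zero-term : ∀ {n} (F : Fin n → ℕ) → ∑ᶠ F < n → ∃ λ i → F i ≡ 0
∑ᶠ-zero-term {suc n} F lt with F zero in eq
... | zero = zero , eq
... | suc k with ∑ᶠ-zero-term (F ∘ suc) (≤-trans (s≤s (≤-trans (≤-reflexive (sym (∑-tabulate suc F))) (m≤n+m _ k))) (s≤s⁻¹ lt))
...   | i , e = suc i , e

∑ᶠ-two : ∀ {n} (F : Fin n → ℕ) {i j} → i ≢ j → F i + F j ≤ ∑ᶠ F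
∑ᶠ-two F {zero} {zero} ne = contradiction refl ne
∑ᶠ-two F {zero} {suc j} ne rewrite ∑ᶠ-suc F = +-monoʳ-≤ (F zero) (≤∑ᶠ (F ∘ suc) j)
∑ᶠ-two F {suc i} {zero} ne rewrite ∑ᶠ-suc F | +-comm (F (suc i)) (F zero) = +-monoʳ-≤ (F zero) (≤∑ᶠ (F ∘ suc) i)
∑ᶠ-two F {suc i} {suc j} ne rewrite ∑ᶠ-suc F = ≤-trans (∑ᶠ-two (F ∘ suc) (ne ∘ cong suc)) (m≤n+m _ (F zero))

∑-cong-∈ : ∀ {A : Set} (xs : List A) {F G : A → ℕ} → (∀ {x} → x ∈ xs → F x ≡ G x) → ∑ xs F ≡ ∑ xs G
∑-cong-∈ [] h = refl
∑-cong-∈ (x ∷ xs) h = cong₂ _+_ (h (here refl)) (∑-cong-∈ xs (h ∘ there))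

∑-filterᵇ : ∀ {A : Set} (p : A → Bool) xs (F : A → ℕ) → ∑ (filterᵇ p xs) F ≡ ∑ xs (λ x → 𝟙 (p x) * F x)
∑-filterᵇ p [] F = refl
∑-filterᵇ p (x ∷ xs) F with p x
... | true = cong₂ _+_ (sym (+-identityʳ (F x))) (∑-filterᵇ p xs F)
... | false = ∑-filterᵇ p xs F

length-filterᵇ : ∀ {A : Set} (p : A → Bool) xs → length (filterᵇ p xs) ≡ ∑ xs (𝟙 ∘ p)
length-filterᵇ p [] = refl
length-filterᵇ p (x ∷ xs) with p x
... | true = cong suc (length-filterᵇ p xs)
... | false = length-filterᵇ p xs

∈-filterᵇ⁻ : ∀ {A : Set} (p : A → Bool) {x} xs → x ∈ filterᵇ p xs → p x ≡ true × x ∈ xs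
∈-filterᵇ⁻ p (y ∷ xs) m with p y in eq
∈-filterᵇ⁻ p (y ∷ xs) (here refl) | true = eq , here refl
∈-filterᵇ⁻ p (y ∷ xs) (there m) | true = let a , b = ∈-filterᵇ⁻ p xs m in a , there b
∈-filterᵇ⁻ p (y ∷ xs) m | false = let a , b = ∈-filterᵇ⁻ p xs m in a , there b

∈-filterᵇ⁺ : ∀ {A : Set} (p : A → Bool) {x xs} → p x ≡ true → x ∈ xs → x ∈ filterᵇ p xs
∈-filterᵇ⁺ p e (here refl) rewrite e = here refl
∈-filterᵇ⁺ p {xs = y ∷ xs} e (there m) with p y
... | true = there (∈-filterᵇ⁺ p e m)
... | false = ∈-filterᵇ⁺ p e m

∑ᶠ-pick : ∀ {n} (i : Fin n) (k : ℕ) → ∑ᶠ (λ j → k * 𝟙 (i == j)) ≡ k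
∑ᶠ-pick {n} i k = trans (sym (∑-*ˡ (allFin n) (λ j → 𝟙 (i == j)) k)) (trans (cong (k *_) (∑ᶠ-δ i)) (*-identityʳ k))

-- The entries of `M` are dealt out in order, each to two consecutive entries of `R`; the first
-- argument is a default value once `R` is exhausted.
two-to-one : ∀ {n k} → Fin k → (M : List (Fin k)) (R : List (Fin n)) → Unique R → length R ≤ 2 * length M →
  ∃ λ (g : Fin n → Fin k) → (∀ {r} → r ∈ R → g r ∈ M) × (∀ e → ∑ R (λ r → 𝟙 (g r == e)) ≤ 2 * ∑ M (λ c → 𝟙 (c == e)))
two-to-one c₀ M [] _ _ = (λ _ → c₀) , (λ ()) , λ e → z≤n
two-to-one c₀ (c ∷ M) (r ∷ []) _ _ = (λ _ → c) , (λ _ → here refl) , λ e →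
  ≤-trans (≤-reflexive (+-identityʳ _)) (≤-trans (m≤m+n _ _) (m≤n*m _ 2))
two-to-one c₀ (c ∷ M) (r ∷ s ∷ R) (p ∷ q ∷ uniq) le = g , mem , bound
  where
  double : ∀ m → 2 * suc m ≡ suc (suc (2 * m))
  double = solve-∀
  ih = two-to-one c₀ M R uniq (s≤s⁻¹ (s≤s⁻¹ (≤-trans le (≤-reflexive (double (length M))))))
  g′ = proj₁ ih
  g = λ t → if t == r then c else (if t == s then c else g′ t)
  g-r : g r ≡ c
  g-r rewrite ==-refl r = refl
  g-s : g s ≡ c
  g-s with s == r
  ... | true = refl
  ... | false rewrite ==-refl s = refl
  g-R : ∀ {t} → t ∈ R → g t ≡ g′ t
  g-R {t} m rewrite ≢⇒== {i = t} {r} (lookup p (there m) ∘ sym) | ≢⇒== {i = t} {s} (lookup q m ∘ sym) = refl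
  mem : ∀ {t} → t ∈ r ∷ s ∷ R → g t ∈ c ∷ M
  mem (here refl) = here g-r
  mem (there (here refl)) = here g-s
  mem (there (there m)) = subst (_∈ c ∷ M) (sym (g-R m)) (there (proj₁ (proj₂ ih) m))
  regroup : ∀ a b → a + (a + 2 * b) ≡ 2 * (a + b)
  regroup = solve-∀
  bound : ∀ e → ∑ (r ∷ s ∷ R) (λ t → 𝟙 (g t == e)) ≤ 2 * ∑ (c ∷ M) (λ c → 𝟙 (c == e))
  bound e = begin
    𝟙 (g r == e) + (𝟙 (g s == e) + ∑ R (λ t → 𝟙 (g t == e)))
      ≡⟨ cong₂ (λ a b → 𝟙 (a == e) + b) g-r (cong₂ (λ a b → 𝟙 (a == e) + b) g-s (∑-cong-∈ R λ m → cong (λ a → 𝟙 (a == e)) (g-R m))) ⟩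
    𝟙 (c == e) + (𝟙 (c == e) + ∑ R (λ t → 𝟙 (g′ t == e)))
      ≤⟨ +-monoʳ-≤ (𝟙 (c == e)) (+-monoʳ-≤ (𝟙 (c == e)) (proj₂ (proj₂ ih) e)) ⟩
    𝟙 (c == e) + (𝟙 (c == e) + 2 * ∑ M (λ c → 𝟙 (c == e)))
      ≡⟨ regroup (𝟙 (c == e)) _ ⟩
    2 * ∑ (c ∷ M) (λ c → 𝟙 (c == e)) ∎
    where open ≤-Reasoning

≡ᵇ-sound : ∀ {k l} → (k ≡ᵇ l) ≡ true → k ≡ l
≡ᵇ-sound {k} {l} e = ≡ᵇ⇒≡ k l (subst T (sym e) _)

length-allFin : ∀ k → length (allFin k) ≡ k
length-allFin k = length-tabulate id

module _ {n k : ℕ} (a : Fin n → Bool) (f : Fin n → Fin k) where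

  multiplicity : Fin k → ℕ
  multiplicity c = ∑ᶠ (λ w → 𝟙 (a w) * 𝟙 (f w == c))

  ∑-fibres : ∀ (F : Fin k → ℕ) → ∑ᶠ (λ w → 𝟙 (a w) * F (f w)) ≡ ∑ᶠ (λ c → multiplicity c * F c)
  ∑-fibres F = begin
    ∑ᶠ (λ w → 𝟙 (a w) * F (f w))                              ≡⟨ ∑-cong (allFin n) (λ w → sym (trans (∑-cong (allFin k) (localise w)) (∑ᶠ-pick (f w) _))) ⟩
    ∑ᶠ (λ w → ∑ᶠ (λ c → 𝟙 (a w) * 𝟙 (f w == c) * F c))        ≡⟨ ∑-swap (allFin n) (allFin k) _ ⟩
    ∑ᶠ (λ c → ∑ᶠ (λ w → 𝟙 (a w) * 𝟙 (f w == c) * F c))        ≡⟨ ∑-cong (allFin k) (λ c → sym (∑-*ʳ (allFin n) _ _)) ⟩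
    ∑ᶠ (λ c → multiplicity c * F c)                           ∎
    where
    open ≡-Reasoning
    l₁ : ∀ a b → a * 1 * b ≡ a * b * 1
    l₁ = solve-∀
    l₀ : ∀ a b b′ → a * 0 * b ≡ a * b′ * 0
    l₀ = solve-∀
    localise : ∀ w c → 𝟙 (a w) * 𝟙 (f w == c) * F c ≡ 𝟙 (a w) * F (f w) * 𝟙 (f w == c)
    localise w c with f w == c in e
    ... | true rewrite ==⇒≡ e = l₁ (𝟙 (a w)) (F c)
    ... | false = l₀ (𝟙 (a w)) (F c) (F (f w))

  ∑-multiplicity : ∑ᶠ multiplicity ≡ ∑ᶠ (𝟙 ∘ a)
  ∑-multiplicity = trans (∑-cong (allFin k) λ c → sym (*-identityʳ _))
    (trans (sym (∑-fibres (λ _ → 1))) (∑-cong (allFin n) λ w → *-identityʳ _))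

  multiplicity-zero : ∀ c → multiplicity c ≡ 0 → ∀ w → a w ≡ true → f w ≢ c
  multiplicity-zero c e w w∈a refl = contradiction
    (≤-trans (≤-reflexive (sym one)) (≤-trans (≤∑ᶠ (λ w → 𝟙 (a w) * 𝟙 (f w == c)) w) (≤-reflexive e))) λ ()
    where
    one : 𝟙 (a w) * 𝟙 (f w == f w) ≡ 1
    one rewrite w∈a | ==-refl (f w) = refl

  multiplicity-two : ∀ {u w} → u ≢ w → a u ≡ true → a w ≡ true → f u ≡ f w → 2 ≤ multiplicity (f w)
  multiplicity-two {u} {w} ne u∈a w∈a e = ≤-trans (≤-reflexive (sym two-terms)) (∑ᶠ-two _ ne)
    where
    two-terms : 𝟙 (a u) * 𝟙 (f u == f w) + 𝟙 (a w) * 𝟙 (f w == f w) ≡ 2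
    two-terms rewrite u∈a | w∈a | e | ==-refl (f w) = refl

  absent-colour : ∑ᶠ (𝟙 ∘ a) < k → ∃ λ c → multiplicity c ≡ 0
  absent-colour lt = ∑ᶠ-zero-term multiplicity (≤-trans (s≤s (≤-reflexive ∑-multiplicity)) lt)

-- Replacement colours

-- The colour that a vertex coloured o with neighbourhood a takes when its neighbour w gives up f w: that colour if no
-- other neighbour has it, and a missing colour otherwise. At least half as many colours are missing as there are
-- neighbours of the second kind, so every colour need only be used for two of them.
module Substitute {n k : ℕ} (a : Fin n → Bool) (f : Fin n → Fin k) (o : Fin k)
  (a∌o : ∀ w → a w ≡ true → f w ≢ o) (a<k : ∑ᶠ (𝟙 ∘ a) < k) where

  open ≤-Reasoning

  private
    m = multiplicity a f

  repeated : Fin n → Bool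
  repeated w = a w ∧ not (m (f w) ≡ᵇ 1)
  missing : Fin k → Bool
  missing c = (m c ≡ᵇ 0) ∧ not (o == c)
  R = filterᵇ repeated (allFin n)
  M = filterᵇ missing (allFin k)

  R-sum : length R ≡ ∑ᶠ (λ c → m c * 𝟙 (not (m c ≡ᵇ 1)))
  R-sum = trans (length-filterᵇ repeated (allFin n))
    (trans (∑-cong (allFin n) (λ w → 𝟙-∧ (a w) _)) (∑-fibres a f (λ c → 𝟙 (not (m c ≡ᵇ 1)))))

  -- Sum `per-colour` over all `k` colours; the multiplicities add up to the degree. The own colour
  -- `o` is excluded from `missing`, and the strict inequality between degree and `k` pays for it.
  R≤2M : length R ≤ 2 * length M
  R≤2M = +-cancelʳ-≤ (2 * k) _ _ (begin
    length R + 2 * k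
      ≡⟨ cong₂ _+_ R-sum (trans (*-comm 2 k) (trans (cong (_* 2) (sym (length-allFin k))) (sym (∑-const (allFin k) 2)))) ⟩
    ∑ᶠ (λ c → m c * 𝟙 (not (m c ≡ᵇ 1))) + ∑ (allFin k) (λ _ → 2)
      ≡⟨ sym (∑-+ (allFin k) _ _) ⟩
    ∑ᶠ (λ c → m c * 𝟙 (not (m c ≡ᵇ 1)) + 2)
      ≤⟨ ∑-mono (allFin k) (λ c → ≤-trans (per-colour (m c)) (+-monoʳ-≤ (2 * m c) (*-monoʳ-≤ 2 (split c)))) ⟩
    ∑ᶠ (λ c → 2 * m c + 2 * (𝟙 (missing c) + 𝟙 (o == c)))
      ≡⟨ trans (∑-+ (allFin k) _ _) (cong₂ _+_ (sym (∑-*ˡ (allFin k) _ 2)) (sym (∑-*ˡ (allFin k) _ 2))) ⟩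
    2 * ∑ᶠ m + 2 * ∑ᶠ (λ c → 𝟙 (missing c) + 𝟙 (o == c))
      ≡⟨ cong₂ (λ a b → 2 * a + 2 * b) (∑-multiplicity a f) (trans (∑-+ (allFin k) _ _) (cong₂ _+_ (sym (length-filterᵇ missing (allFin k))) (∑ᶠ-δ o))) ⟩
    2 * ∑ᶠ (𝟙 ∘ a) + 2 * (length M + 1)
      ≡⟨ l (∑ᶠ (𝟙 ∘ a)) (length M) ⟩
    2 * length M + 2 * suc (∑ᶠ (𝟙 ∘ a))
      ≤⟨ +-monoʳ-≤ (2 * length M) (*-monoʳ-≤ 2 a<k) ⟩
    2 * length M + 2 * k ∎)
    where
    l : ∀ d k → 2 * d + 2 * (k + 1) ≡ 2 * k + 2 * suc d
    l = solve-∀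
    per-colour : ∀ k → k * 𝟙 (not (k ≡ᵇ 1)) + 2 ≤ 2 * k + 2 * 𝟙 (k ≡ᵇ 0)
    per-colour 0 = ≤-refl
    per-colour 1 = ≤-refl
    per-colour (suc (suc k)) = ≤-trans (≤-reflexive (l₁ k)) (≤-trans (m≤m+n (4 + k) k) (≤-reflexive (l₂ k)))
      where
      l₁ : ∀ k → (2 + k) * 1 + 2 ≡ 4 + k
      l₁ = solve-∀
      l₂ : ∀ k → 4 + k + k ≡ 2 * (2 + k) + 2 * 0
      l₂ = solve-∀
    split : ∀ c → 𝟙 (m c ≡ᵇ 0) ≤ 𝟙 (missing c) + 𝟙 (o == c)
    split c with m c ≡ᵇ 0 | o == c
    ... | false | _ = z≤n
    ... | true | true = ≤-refl
    ... | true | false = ≤-refl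

  abstract
    distribution : ∃ λ (g : Fin n → Fin k) →
      (∀ {r} → r ∈ R → g r ∈ M) × (∀ e → ∑ R (λ r → 𝟙 (g r == e)) ≤ 2 * ∑ M (λ c → 𝟙 (c == e)))
    distribution = two-to-one o M R (filter⁺ (T? ∘ repeated) (allFin⁺ n)) R≤2M

  g : Fin n → Fin k
  g = proj₁ distribution

  g-missing : ∀ w → repeated w ≡ true → missing (g w) ≡ true
  g-missing w e = proj₁ (∈-filterᵇ⁻ missing (allFin k) (proj₁ (proj₂ distribution) (∈-filterᵇ⁺ repeated e (∈-allFin w))))

  new : Fin n → Fin k
  new w = if m (f w) ≡ᵇ 1 then f w else g w

  is-missing : ∀ w → a w ≡ true → (m (f w) ≡ᵇ 1) ≡ false → missing (g w) ≡ true
  is-missing w w∈a e = g-missing w (cong₂ (λ b c → b ∧ not c) w∈a e)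

  new≢ : ∀ w → a w ≡ true → new w ≢ o
  new≢ w w∈a with m (f w) ≡ᵇ 1 in e
  ... | true = a∌o w w∈a
  ... | false = λ eq → true≢false (trans (cong (_== g w) (sym eq)) (==-refl (g w)))
                                   (not-true (proj₂ (∧-true {m (g w) ≡ᵇ 0} (is-missing w w∈a e))))

  available : ∀ w → a w ≡ true → ∀ y → a y ≡ true → y ≢ w → f y ≢ new w
  available w w∈a y y∈a ne with m (f w) ≡ᵇ 1 in e
  ... | true = λ eq → contradiction (≤-trans (multiplicity-two a f ne y∈a w∈a eq) (≤-reflexive (≡ᵇ-sound e))) λ { (s≤s ()) }
  ... | false = multiplicity-zero a f (g w) (≡ᵇ-sound (proj₁ (∧-true {m (g w) ≡ᵇ 0} (is-missing w w∈a e)))) y y∈a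

  -- A colour held by exactly one neighbour serves only for that neighbour, an absent one for at
  -- most two by `distribution`, and any other for none.
  two : ∀ e → ∑ᶠ (λ w → 𝟙 (a w) * 𝟙 (new w == e)) ≤ 2
  two e = begin
    ∑ᶠ (λ w → 𝟙 (a w) * 𝟙 (new w == e))
      ≤⟨ ∑-mono (allFin n) per-vertex ⟩
    ∑ᶠ (λ w → 𝟙 (a w) * 𝟙 (f w == e) * 𝟙 (m e ≡ᵇ 1) + 𝟙 (repeated w) * 𝟙 (g w == e))
      ≡⟨ ∑-+ (allFin n) _ _ ⟩
    ∑ᶠ (λ w → 𝟙 (a w) * 𝟙 (f w == e) * 𝟙 (m e ≡ᵇ 1)) + ∑ᶠ (λ w → 𝟙 (repeated w) * 𝟙 (g w == e))
      ≡⟨ cong₂ _+_ (sym (∑-*ʳ (allFin n) _ _)) (sym (∑-filterᵇ repeated (allFin n) _)) ⟩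
    m e * 𝟙 (m e ≡ᵇ 1) + ∑ R (λ w → 𝟙 (g w == e))
      ≤⟨ +-monoʳ-≤ _ (≤-trans (proj₂ (proj₂ distribution) e) (*-monoʳ-≤ 2 M-count)) ⟩
    m e * 𝟙 (m e ≡ᵇ 1) + 2 * 𝟙 (m e ≡ᵇ 0)
      ≤⟨ final (m e) ⟩
    2 ∎
    where
    per-vertex : ∀ w → 𝟙 (a w) * 𝟙 (new w == e) ≤
      𝟙 (a w) * 𝟙 (f w == e) * 𝟙 (m e ≡ᵇ 1) + 𝟙 (repeated w) * 𝟙 (g w == e)
    per-vertex w with a w | m (f w) ≡ᵇ 1 in eq
    ... | false | _ = z≤n
    ... | true | false = m≤n+m (1 * 𝟙 (g w == e)) (1 * 𝟙 (f w == e) * 𝟙 (m e ≡ᵇ 1))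
    ... | true | true with f w == e in eq′
    ...   | false = z≤n
    ...   | true rewrite sym (==⇒≡ eq′) | eq = s≤s z≤n
    M-count : ∑ M (λ c → 𝟙 (c == e)) ≤ 𝟙 (m e ≡ᵇ 0)
    M-count = begin
      ∑ M (λ c → 𝟙 (c == e)) ≡⟨ ∑-filterᵇ missing (allFin k) _ ⟩
      ∑ᶠ (λ c → 𝟙 (missing c) * 𝟙 (c == e)) ≤⟨ ∑-mono (allFin k) (λ c → here′ c) ⟩
      ∑ᶠ (λ c → 𝟙 (m e ≡ᵇ 0) * 𝟙 (e == c)) ≡⟨ ∑ᶠ-pick e _ ⟩
      𝟙 (m e ≡ᵇ 0) ∎
      where
      here′ : ∀ c → 𝟙 (missing c) * 𝟙 (c == e) ≤ 𝟙 (m e ≡ᵇ 0) * 𝟙 (e == c)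
      here′ c with c == e in eq
      ... | false = ≤-trans (≤-reflexive (*-zeroʳ (𝟙 (missing c)))) z≤n
      ... | true rewrite ==⇒≡ eq | ==-refl e = *-monoˡ-≤ 1 (𝟙-mono {missing e} {m e ≡ᵇ 0} λ t → proj₁ (∧-true {m e ≡ᵇ 0} t))
    final : ∀ k → k * 𝟙 (k ≡ᵇ 1) + 2 * 𝟙 (k ≡ᵇ 0) ≤ 2
    final 0 = ≤-refl
    final 1 = s≤s z≤n
    final (suc (suc k)) rewrite *-zeroʳ k = z≤n

-- Greedy colouring

module _ {n k : ℕ} (G : Graph n) (deg< : ∀ v → ∑ᶠ (𝟙 ∘ adj G v) < k) where

  adj-sym : ∀ {u v} → adj G u v ≡ true → adj G v u ≡ true
  adj-sym {u} {v} e = trans (sym (Graph.sym G u v)) e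

  greedy-colouring : Fin k → ∃ λ (f : Fin n → Fin k) → Proper G f
  greedy-colouring c₀ = let f , h = go (allFin n) in f , λ u v → h u v (∈-allFin u) (∈-allFin v)
    where
    go : ∀ xs → ∃ λ (f : Fin n → Fin k) → ∀ u v → u ∈ xs → v ∈ xs → adj G u v ≡ true → f u ≢ f v
    go [] = (λ _ → c₀) , λ _ _ ()
    go (x ∷ xs) = f′ , proper
      where
      f = proj₁ (go xs)
      free = absent-colour (adj G x) f (deg< x)
      c = proj₁ free
      f′ : Fin n → Fin k
      f′ u = if u == x then c else f u
      fresh : ∀ w → adj G x w ≡ true → f w ≢ c
      fresh = multiplicity-zero (adj G x) f c (proj₂ free)
      old : ∀ {u} → u ∈ x ∷ xs → (u == x) ≡ false → u ∈ xs
      old (here refl) e = ⊥-elim (true≢false (==-refl x) e)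
      old (there m) _ = m
      proper : ∀ u v → u ∈ x ∷ xs → v ∈ x ∷ xs → adj G u v ≡ true → f′ u ≢ f′ v
      proper u v mu mv a with u == x in eu | v == x in ev
      ... | true | true = λ _ → true≢false (subst₂ (λ u v → adj G u v ≡ true) (==⇒≡ eu) (==⇒≡ ev) a) (irrefl G x)
      ... | true | false = λ e → fresh v (subst (λ u → adj G u v ≡ true) (==⇒≡ eu) a) (sym e)
      ... | false | true = fresh u (adj-sym (subst (λ v → adj G u v ≡ true) (==⇒≡ ev) a))
      ... | false | false = proj₂ (go xs) u v (old mu eu) (old mv ev) a

bool-ext : ∀ {a b} → (a ≡ true → b ≡ true) → (b ≡ true → a ≡ true) → a ≡ b
bool-ext {true} f g = sym (f refl)
bool-ext {false} {true} f g = g refl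
bool-ext {false} {false} f g = refl

any-∈ : ∀ {A : Set} (p : A → Bool) {x xs} → x ∈ xs → p x ≡ true → any p xs ≡ true
any-∈ p (here refl) e rewrite e = refl
any-∈ p {xs = y ∷ xs} (there m) e with p y
... | true = refl
... | false = any-∈ p m e

any-any-sym : ∀ {A : Set} (r : A → A → Bool) → (∀ x y → r x y ≡ r y x) → ∀ xs ys →
  any (λ x → any (r x) ys) xs ≡ any (λ y → any (r y) xs) ys
any-any-sym r r-sym xs ys = bool-ext (flip′ xs ys) (flip′ ys xs)
  where
  flip′ : ∀ xs ys → any (λ x → any (r x) ys) xs ≡ true → any (λ y → any (r y) xs) ys ≡ true
  flip′ xs ys e with any-elim (λ x → any (r x) ys) xs e
  ... | x , x∈ , e₁ with any-elim (r x) ys e₁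
  ...   | y , y∈ , e₂ = any-∈ (λ y → any (r y) xs) y∈ (any-∈ (r y) x∈ (trans (r-sym y x) e₂))

𝟙-any-any : ∀ {A B : Set} (r : A → B → Bool) xs ys → 𝟙 (any (λ x → any (r x) ys) xs) ≤ ∑ xs (λ x → ∑ ys (λ y → 𝟙 (r x y)))
𝟙-any-any r xs ys = ≤-trans (𝟙-any _ xs) (∑-mono xs λ x → 𝟙-any (r x) ys)

∑-mono-∈ : ∀ {A : Set} (xs : List A) {F G : A → ℕ} → (∀ {x} → x ∈ xs → F x ≤ G x) → ∑ xs F ≤ ∑ xs G
∑-mono-∈ [] h = z≤n
∑-mono-∈ (x ∷ xs) h = +-mono-≤ (h (here refl)) (∑-mono-∈ xs (h ∘ there))

≤∑ : ∀ {A : Set} {xs : List A} (F : A → ℕ) {x} → x ∈ xs → F x ≤ ∑ xs F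
≤∑ F (here refl) = m≤m+n _ _
≤∑ F {x} (there {x = y} m) = ≤-trans (≤∑ F m) (m≤n+m _ (F y))

-- The alphabet of proposals, and locality of sums

module Letters (k W : ℕ) where

  vals : List (Maybe (Fin k))
  vals = replicate W nothing ++ map just (allFin k)

  length-vals : length vals ≡ W + k
  length-vals = trans (length-++ (replicate W nothing))
    (cong₂ _+_ (length-replicate W) (trans (length-map just (allFin k)) (length-allFin k)))

  ∑-vals : ∀ (F : Maybe (Fin k) → ℕ) → F nothing ≡ 0 → ∑ vals F ≡ ∑ᶠ (F ∘ just)
  ∑-vals F e = trans (∑-++ (replicate W nothing) _ F) (cong₂ _+_ (blank W) (∑-map just (allFin k) F))
    where
    blank : ∀ W → ∑ (replicate W nothing) F ≡ 0
    blank zero = refl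
    blank (suc W) = cong₂ _+_ e (blank W)

restrict-∑ : ∀ {I A : Set} (V : I → Bool) (F : I × A → ℕ) → (∀ x → V (proj₁ x) ≡ false → F x ≡ 0) →
  ∀ H → ∑ H F ≡ ∑ (restrict V H) F
restrict-∑ V F h [] = refl
restrict-∑ V F h ((i , a) ∷ H) with V i in e
... | true = cong (F (i , a) +_) (restrict-∑ V F h H)
... | false = cong₂ _+_ (h (i , a) e) (restrict-∑ V F h H)

restrict-any : ∀ {I A : Set} (V : I → Bool) (p : I × A → Bool) → (∀ x → p x ≡ true → V (proj₁ x) ≡ true) →
  ∀ H → any p H ≡ any p (restrict V H)
restrict-any V p h [] = refl
restrict-any V p h ((i , a) ∷ H) with V i in e
... | true = cong (p (i , a) ∨_) (restrict-any V p h H)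
... | false = trans (cong (_∨ any p H) (¬true⇒false λ t → true≢false (h (i , a) t) e)) (restrict-any V p h H)

-- Unique neighbours and absent colours

module Uniqueness {n : ℕ} (G : Graph n) where

  module _ {k : ℕ} (g : Fin n → Fin k) where

    unique : Fin n → Fin n → Bool
    unique v w = adj G v w ∧ not (conflicted G g v w)

    uniques : Fin n → ℕ
    uniques v = ∑ᶠ (𝟙 ∘ unique v)

    conflicts+uniques : ∀ v → conflicts G g v + uniques v ≡ ∑ᶠ (𝟙 ∘ adj G v)
    conflicts+uniques v = trans (cong (_+ uniques v) (countB≡∑ (conflicted G g v) (allFin n)))
      (trans (sym (∑-+ (allFin n) (𝟙 ∘ conflicted G g v) (𝟙 ∘ unique v))) (∑-cong (allFin n) λ w → split (adj G v w) _))
      where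
      split : ∀ a b → 𝟙 (a ∧ b) + 𝟙 (a ∧ not (a ∧ b)) ≡ 𝟙 a
      split true b = 𝟙-not b
      split false b = refl

    unique-intro : ∀ v w → adj G v w ≡ true → (∀ u → adj G v u ≡ true → u ≢ w → g u ≢ g w) → unique v w ≡ true
    unique-intro v w a h with conflicted G g v w in eq
    ... | false rewrite a = refl
    ... | true with any-elim _ (allFin n) (proj₂ (∧-true {adj G v w} eq))
    ...   | u , _ , e with ∧-true {adj G v u} e
    ...     | a′ , e′ with ∧-true {not (u == w)} e′
    ...       | ne , same = ⊥-elim (h u a′ (λ { refl → true≢false (==-refl u) (not-true ne) }) (==⇒≡ same))

    unique-elim : ∀ v w → unique v w ≡ true → adj G v w ≡ true × (∀ u → adj G v u ≡ true → u ≢ w → g u ≢ g w)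
    unique-elim v w e = a , λ u a′ ne same → true≢false
      (cong₂ _∧_ a (any-intro (λ u → adj G v u ∧ (not (u == w) ∧ (g u == g w))) u
        (cong₂ _∧_ a′ (cong₂ (λ b c → not b ∧ c) (≢⇒== ne) (trans (cong (_== g w) same) (==-refl (g w)))))))
      (not-true (proj₂ (∧-true {adj G v w} e)))
      where
      a = proj₁ (∧-true {adj G v w} e)

    non-unique : ∀ v w → adj G v w ≡ true → unique v w ≡ false → ∃ λ u → adj G v u ≡ true × u ≢ w × g u ≡ g w
    non-unique v w a e with conflicted G g v w in eq
    ... | false = ⊥-elim (true≢false (cong (_∧ true) a) e)
    ... | true with any-elim _ (allFin n) (proj₂ (∧-true {adj G v w} eq))
    ...   | u , _ , e₁ with ∧-true {adj G v u} e₁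
    ...     | a′ , e₂ with ∧-true {not (u == w)} e₂
    ...       | ne , same = u , a′ , (λ { refl → true≢false (==-refl u) (not-true ne) }) , ==⇒≡ same

    absent : Fin n → ℕ
    absent v = ∑ᶠ (λ c → 𝟙 (multiplicity (adj G v) g c ≡ᵇ 0))

    -- Per colour, 2 is at most twice the indicator of absence, plus the multiplicity, plus one more
    -- if the multiplicity is 1. Hence few unique neighbours force about half of the colours to be
    -- absent.
    absent-bound : ∀ v → 2 * k ≤ 2 * absent v + (∑ᶠ (𝟙 ∘ adj G v) + uniques v)
    absent-bound v = begin
      2 * k
        ≡⟨ trans (*-comm 2 k) (trans (cong (_* 2) (sym (length-allFin k))) (sym (∑-const (allFin k) 2))) ⟩
      ∑ (allFin k) (λ _ → 2)
        ≤⟨ ∑-mono (allFin k) per-colour ⟩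
      ∑ᶠ (λ c → 2 * 𝟙 (m c ≡ᵇ 0) + (m c + once c))
        ≡⟨ trans (∑-+ (allFin k) _ _) (cong₂ _+_ (sym (∑-*ˡ (allFin k) _ 2)) (∑-+ (allFin k) m once)) ⟩
      2 * absent v + (∑ᶠ m + ∑ᶠ once)
        ≡⟨ cong (2 * absent v +_) (cong₂ _+_ (∑-multiplicity (adj G v) g) (trans (∑-swap (allFin k) (allFin n) _) (∑-cong (allFin n) λ w → ∑ᶠ-pick (g w) (𝟙 (unique v w))))) ⟩
      2 * absent v + (∑ᶠ (𝟙 ∘ adj G v) + uniques v) ∎
      where
      open ≤-Reasoning
      m = multiplicity (adj G v) g
      once : Fin k → ℕ
      once c = ∑ᶠ (λ w → 𝟙 (unique v w) * 𝟙 (g w == c))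
      per-colour : ∀ c → 2 ≤ 2 * 𝟙 (m c ≡ᵇ 0) + (m c + once c)
      per-colour c with m c in eq
      ... | zero = s≤s (s≤s z≤n)
      ... | suc (suc j) = s≤s (s≤s z≤n)
      ... | suc zero with ∑-positive (allFin n) (λ w → 𝟙 (adj G v w) * 𝟙 (g w == c)) (≤-reflexive (sym eq))
      ...   | w , pos with adj G v w in a | g w == c in e
      ...     | true | true = s≤s (≤-trans (≤-reflexive (sym one)) (≤∑ᶠ (λ w → 𝟙 (unique v w) * 𝟙 (g w == c)) w))
        where
        u-w : unique v w ≡ true
        u-w = unique-intro v w a λ u a′ ne same → contradiction
          (≤-trans (multiplicity-two (adj G v) g ne a′ a same) (≤-reflexive (trans (cong m (==⇒≡ e)) eq))) λ { (s≤s ()) }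
        one : 𝟙 (unique v w) * 𝟙 (g w == c) ≡ 1
        one rewrite u-w | e = refl

-- Balls and the dependency relation

module Balls {n k : ℕ} (G : Graph n) (deg< : ∀ v → ∑ᶠ (𝟙 ∘ adj G v) < k) where

  close : Fin n → Fin n → Bool
  close u w = (u == w) ∨ adj G u w

  close-refl : ∀ u → close u u ≡ true
  close-refl u rewrite ==-refl u = refl

  adj⇒close : ∀ {u w} → adj G u w ≡ true → close u w ≡ true
  adj⇒close {u} {w} e rewrite e = ∨-zeroʳ (u == w)

  close-sym : ∀ u w → close u w ≡ close w u
  close-sym u w = cong₂ _∨_ (==-sym u w) (Graph.sym G u w)

  close-count : ∀ u → ∑ᶠ (𝟙 ∘ close u) ≤ k
  close-count u = ≤-trans (∑-mono (allFin n) λ w → 𝟙-∨ (u == w) (adj G u w))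
    (≤-trans (≤-reflexive (trans (∑-+ (allFin n) _ _) (cong (_+ ∑ᶠ (𝟙 ∘ adj G u)) (∑ᶠ-δ u)))) (deg< u))

  within : ℕ → Fin n → Fin n → Bool
  within zero v w = v == w
  within (suc r) v w = any (λ y → close v y ∧ within r y w) (allFin n)

  within-step : ∀ r {v} y {w} → close v y ≡ true → within r y w ≡ true → within (suc r) v w ≡ true
  within-step r {v} y {w} a b = any-intro (λ y → close v y ∧ within r y w) y (cong₂ _∧_ a b)

  within-refl : ∀ r v → within r v v ≡ true
  within-refl zero v = ==-refl v
  within-refl (suc r) v = within-step r v (close-refl v) (within-refl r v)

  within-suc≤ : ∀ r v w → 𝟙 (within (suc r) v w) ≤ ∑ᶠ (λ y → 𝟙 (close v y) * 𝟙 (within r y w))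
  within-suc≤ r v w = ≤-trans (𝟙-any _ (allFin n)) (≤-reflexive (∑-cong (allFin n) λ y → 𝟙-∧ (close v y) (within r y w)))

  ball-count : ∀ r v → ∑ᶠ (λ w → 𝟙 (within r v w)) ≤ k ^ r
  ball-count zero v = ≤-reflexive (∑ᶠ-δ v)
  ball-count (suc r) v = begin
    ∑ᶠ (λ w → 𝟙 (within (suc r) v w))                             ≤⟨ ∑-mono (allFin n) (within-suc≤ r v) ⟩
    ∑ᶠ (λ w → ∑ᶠ (λ y → 𝟙 (close v y) * 𝟙 (within r y w)))        ≡⟨ trans (∑-swap (allFin n) (allFin n) _) (∑-cong (allFin n) λ y → sym (∑-*ˡ (allFin n) _ (𝟙 (close v y)))) ⟩
    ∑ᶠ (λ y → 𝟙 (close v y) * ∑ᶠ (λ w → 𝟙 (within r y w)))        ≤⟨ ∑-mono (allFin n) (λ y → *-monoʳ-≤ (𝟙 (close v y)) (ball-count r y)) ⟩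
    ∑ᶠ (λ y → 𝟙 (close v y) * k ^ r)                              ≡⟨ sym (∑-*ʳ (allFin n) (𝟙 ∘ close v) (k ^ r)) ⟩
    ∑ᶠ (𝟙 ∘ close v) * k ^ r                                      ≤⟨ *-monoˡ-≤ (k ^ r) (close-count v) ⟩
    k * k ^ r                                                     ∎
    where open ≤-Reasoning

  ball-count′ : ∀ r w → ∑ᶠ (λ v → 𝟙 (within r v w)) ≤ k ^ r
  ball-count′ zero w = ≤-reflexive (trans (∑-cong (allFin n) λ v → cong 𝟙 (==-sym v w)) (∑ᶠ-δ w))
  ball-count′ (suc r) w = begin
    ∑ᶠ (λ v → 𝟙 (within (suc r) v w))                             ≤⟨ ∑-mono (allFin n) (λ v → within-suc≤ r v w) ⟩
    ∑ᶠ (λ v → ∑ᶠ (λ y → 𝟙 (close v y) * 𝟙 (within r y w)))        ≡⟨ trans (∑-swap (allFin n) (allFin n) _) (∑-cong (allFin n) λ y → sym (∑-*ʳ (allFin n) (λ v → 𝟙 (close v y)) (𝟙 (within r y w)))) ⟩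
    ∑ᶠ (λ y → ∑ᶠ (λ v → 𝟙 (close v y)) * 𝟙 (within r y w))        ≤⟨ ∑-mono (allFin n) (λ y → *-monoˡ-≤ (𝟙 (within r y w)) (≤-trans (≤-reflexive (∑-cong (allFin n) λ v → cong 𝟙 (close-sym v y))) (close-count y))) ⟩
    ∑ᶠ (λ y → k * 𝟙 (within r y w))                               ≡⟨ sym (∑-*ˡ (allFin n) (λ y → 𝟙 (within r y w)) k) ⟩
    k * ∑ᶠ (λ y → 𝟙 (within r y w))                               ≤⟨ *-monoʳ-≤ k (ball-count′ r w) ⟩
    k * k ^ r                                                     ∎
    where open ≤-Reasoning

  -- The dependency relation for the local lemma: events read off disjoint balls are independent.
  meet : ℕ → Fin n → Fin n → Bool
  meet r v u = any (λ w → within r v w ∧ within r u w) (allFin n)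

  meet-count : ∀ r v → ∑ᶠ (𝟙 ∘ meet r v) ≤ k ^ r * k ^ r
  meet-count r v = begin
    ∑ᶠ (𝟙 ∘ meet r v)                                          ≤⟨ ∑-mono (allFin n) (λ u → ≤-trans (𝟙-any _ (allFin n)) (≤-reflexive (∑-cong (allFin n) λ w → 𝟙-∧ (within r v w) (within r u w)))) ⟩
    ∑ᶠ (λ u → ∑ᶠ (λ w → 𝟙 (within r v w) * 𝟙 (within r u w)))     ≡⟨ trans (∑-swap (allFin n) (allFin n) _) (∑-cong (allFin n) λ w → sym (∑-*ˡ (allFin n) (λ u → 𝟙 (within r u w)) (𝟙 (within r v w)))) ⟩
    ∑ᶠ (λ w → 𝟙 (within r v w) * ∑ᶠ (λ u → 𝟙 (within r u w)))     ≤⟨ ∑-mono (allFin n) (λ w → *-monoʳ-≤ (𝟙 (within r v w)) (ball-count′ r w)) ⟩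
    ∑ᶠ (λ w → 𝟙 (within r v w) * k ^ r)                           ≡⟨ sym (∑-*ʳ (allFin n) (λ w → 𝟙 (within r v w)) (k ^ r)) ⟩
    ∑ᶠ (λ w → 𝟙 (within r v w)) * k ^ r                           ≤⟨ *-monoˡ-≤ (k ^ r) (ball-count r v) ⟩
    k ^ r * k ^ r                                                 ∎
    where open ≤-Reasoning

  disjoint : ∀ r v u → meet r v u ≡ false → ∀ w → within r u w ≡ true → within r v w ≡ false
  disjoint r v u e w b = ¬true⇒false λ a → true≢false (any-intro (λ w → within r v w ∧ within r u w) w (cong₂ _∧_ a b)) e

-- Arithmetic of the thresholds

scale : ∀ x a b {_ : T (a ≤ᵇ b)} → x * a ≤ x * b
scale x a b {t} = *-monoʳ-≤ x (≤ᵇ⇒≤ a b t)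

floor : ∀ s m → 0 < m → ∃ λ β → m * β ≤ s × s < m * suc β × (∀ γ → m * γ ≤ s → γ ≤ β)
floor s m 0<m = s / m , ≤-trans (≤-reflexive (*-comm m (s / m))) (m/n*n≤m s m) , (begin-strict
  s                        ≡⟨ m≡m%n+[m/n]*n s m ⟩
  s % m + s / m * m        <⟨ +-monoˡ-< _ (m%n<n s m) ⟩
  m + s / m * m            ≡⟨ *-comm (suc (s / m)) m ⟩
  m * suc (s / m)          ∎) , λ γ h → begin
  γ                        ≡⟨ sym (m*n/n≡m γ m) ⟩
  γ * m / m                ≤⟨ /-monoˡ-≤ m (≤-trans (≤-reflexive (*-comm γ m)) h) ⟩
  s / m                    ∎
  where
  open ≤-Reasoning
  instance _ = >-nonZero 0<m

≰ᵇ⇒≥ : ∀ {m n} → (m ≤ᵇ n) ≡ false → n ≤ m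
≰ᵇ⇒≥ e = <⇒≤ (≰⇒> λ le → true≢false (≤ᵇ-true le) e)

-- The local lemma with at most k⁸ dependent events needs this; 20 is its 4 times the 5 of
-- `survivors-tail`. Of nine factors `suc j`, each at most 2ʲ, eight come from k⁸ and the ninth
-- absorbs the constant.
power-beats-polynomial : ∀ κ j k → k ≤ suc j * κ → κ ^ 8 * 20 ≤ suc j → k ^ 4 * k ^ 4 * 20 ≤ 2 ^ (j * 9)
power-beats-polynomial κ j k k≤ big = begin
  k ^ 4 * k ^ 4 * 20              ≡⟨ cong (_* 20) (sym (^-distribˡ-+-* k 4 4)) ⟩
  k ^ 8 * 20                      ≤⟨ *-monoˡ-≤ 20 (^-monoˡ-≤ 8 k≤) ⟩
  (suc j * κ) ^ 8 * 20            ≡⟨ cong (_* 20) (*-^ (suc j) κ 8) ⟩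
  suc j ^ 8 * κ ^ 8 * 20          ≡⟨ *-assoc (suc j ^ 8) (κ ^ 8) 20 ⟩
  suc j ^ 8 * (κ ^ 8 * 20)        ≤⟨ *-monoʳ-≤ (suc j ^ 8) big ⟩
  suc j ^ 8 * suc j               ≡⟨ *-comm (suc j ^ 8) (suc j) ⟩
  suc j ^ 9                       ≤⟨ ^-monoˡ-≤ 9 (suc≤2^ j) ⟩
  (2 ^ j) ^ 9                     ≡⟨ ^-*-assoc 2 j 9 ⟩
  2 ^ (j * 9)                     ∎
  where
  open ≤-Reasoning
  suc≤2^ : ∀ j → suc j ≤ 2 ^ j
  suc≤2^ zero = ≤-refl
  suc≤2^ (suc j) = +-mono-≤ (0<^ 2 j z<s) (≤-trans (suc≤2^ j) (≤-reflexive (sym (+-identityʳ (2 ^ j)))))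

-- All thresholds are multiples of z or y, which are approximately Δ/10⁶.
module Thresholds (y z : ℕ) (y≤z : y * 5 ≤ z * 6) (0<z : 0 < z) where
  open ≤-Reasoning

  -- `β` is about a quarter of the expected number of hits. At rate `k * 250`, `s` is worth 800/250
  -- = 3.2 times `β`; the two interference bounds use 2 of these, and the other 1.2 cover at least
  -- `z * 180`, more than the `z * 178` required.
  enough-targets : ∀ β → z * 150 ≤ β → ∀ k s → k * 800 * β ≤ s →
    k * 250 * (y * 125 + ((suc β + z * 2 + z * 9) + (suc β + z * 2 + z * 9)) + z * 4) ≤ s
  enough-targets β zβ k s hs = begin
    k * 250 * x            ≡⟨ l₂ k 250 x ⟩
    k * (x * 250)          ≤⟨ *-monoʳ-≤ k x≤ ⟩
    k * (β * 800)          ≡⟨ sym (l₂ k 800 β) ⟩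
    k * 800 * β            ≤⟨ hs ⟩
    s                      ∎
    where
    x = y * 125 + ((suc β + z * 2 + z * 9) + (suc β + z * 2 + z * 9)) + z * 4
    l₁ : ∀ w z β → w + ((suc β + z * 2 + z * 9) + (suc β + z * 2 + z * 9)) + z * 4 ≡ β * 2 + (w + (2 + z * 26))
    l₁ = solve-∀
    l₂ : ∀ k a x → k * a * x ≡ k * (x * a)
    l₂ = solve-∀
    y125 : y * 125 ≤ z * 150
    y125 = subst₂ _≤_ (*-assoc y 5 25) (*-assoc z 6 25) (*-monoˡ-≤ 25 y≤z)
    x≤ : x * 250 ≤ β * 800
    x≤ = begin
      x * 250
        ≡⟨ cong (_* 250) (l₁ (y * 125) z β) ⟩
      (β * 2 + (y * 125 + (2 + z * 26))) * 250
        ≤⟨ *-monoˡ-≤ 250 (+-monoʳ-≤ (β * 2) (+-mono-≤ y125 (+-monoˡ-≤ (z * 26) (*-monoˡ-≤ 2 0<z)))) ⟩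
      (β * 2 + (z * 150 + (z * 2 + z * 26))) * 250
        ≡⟨ cong (λ e → (β * 2 + e) * 250) (trans (cong (z * 150 +_) (sym (*-distribˡ-+ z 2 26))) (sym (*-distribˡ-+ z 150 28))) ⟩
      (β * 2 + z * 178) * 250
        ≡⟨ trans (*-distribʳ-+ 250 (β * 2) (z * 178)) (cong₂ _+_ (*-assoc β 2 250) (*-assoc z 178 250)) ⟩
      β * 500 + z * 44500
        ≤⟨ +-monoʳ-≤ (β * 500) (≤-trans (scale z 44500 45000) (≤-reflexive (sym (*-assoc z 150 300)))) ⟩
      β * 500 + z * 150 * 300
        ≤⟨ +-monoʳ-≤ (β * 500) (*-monoˡ-≤ 300 zβ) ⟩
      β * 500 + β * 300
        ≡⟨ sym (*-distribˡ-+ β 500 300) ⟩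
      β * 800 ∎

  -- The unique neighbours cost at most 7 percent of `D * k`, as `u` is at most 0.035 of `k`. The
  -- other 93 percent bound `4 * s`, and the crude estimate `z≤D` already suffices.
  many-targets : ∀ Δ D k s u → z * 1000000 ≤ Δ → Δ ≤ k → Δ * 8000 ≤ D * 8001 → u ≤ y * 25200 →
    D * k ≤ 4 * s + 2 * (D * u) → k * 800 * (z * 150) ≤ s
  many-targets Δ D k s u zΔ Δk ΔD u≤ h = *-cancelʳ-≤ _ _ 400 (begin
    k * 800 * (z * 150) * 400    ≡⟨ l₁ k z 800 150 400 ⟩
    k * (z * 48000000)           ≤⟨ *-monoʳ-≤ k (≤-trans (scale z 48000000 55800000) (≤-reflexive (sym (*-assoc z 600000 93)))) ⟩
    k * (z * 600000 * 93)        ≤⟨ *-monoʳ-≤ k (*-monoˡ-≤ 93 z≤D) ⟩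
    k * (D * 93)                 ≤⟨ +-cancelʳ-≤ (k * (D * 7)) _ _ main ⟩
    s * 400                      ∎)
    where
    l₁ : ∀ k z a b c → k * a * (z * b) * c ≡ k * (z * (a * b * c))
    l₁ = solve-∀
    l₂ : ∀ k D a b → k * (D * a) + k * (D * b) ≡ D * k * (a + b)
    l₂ = solve-∀
    l₃ : ∀ s D u → (4 * s + 2 * (D * u)) * 100 ≡ s * 400 + D * (u * 200)
    l₃ s D u = trans (*-distribʳ-+ 100 (4 * s) (2 * (D * u)))
      (cong₂ _+_ (l₄ 4 s 100) (trans (l₄ 2 (D * u) 100) (*-assoc D u 200)))
      where
      l₄ : ∀ a s b → a * s * b ≡ s * (a * b)
      l₄ = solve-∀
    z≤D : z * 600000 ≤ D
    z≤D = *-cancelʳ-≤ _ _ 8001 (begin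
      z * 600000 * 8001      ≡⟨ *-assoc z 600000 8001 ⟩
      z * 4800600000         ≤⟨ scale z 4800600000 8000000000 ⟩
      z * 8000000000         ≡⟨ sym (*-assoc z 1000000 8000) ⟩
      z * 1000000 * 8000     ≤⟨ *-monoˡ-≤ 8000 zΔ ⟩
      Δ * 8000               ≤⟨ ΔD ⟩
      D * 8001               ∎)
    u200 : u * 200 ≤ k * 7
    u200 = begin
      u * 200                ≤⟨ *-monoˡ-≤ 200 u≤ ⟩
      y * 25200 * 200        ≡⟨ trans (*-assoc y 25200 200) (sym (*-assoc y 5 1008000)) ⟩
      y * 5 * 1008000        ≤⟨ *-monoˡ-≤ 1008000 y≤z ⟩
      z * 6 * 1008000        ≡⟨ *-assoc z 6 1008000 ⟩
      z * 6048000            ≤⟨ scale z 6048000 7000000 ⟩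
      z * 7000000            ≡⟨ sym (*-assoc z 1000000 7) ⟩
      z * 1000000 * 7        ≤⟨ *-monoˡ-≤ 7 (≤-trans zΔ Δk) ⟩
      k * 7                  ∎
    main : k * (D * 93) + k * (D * 7) ≤ s * 400 + k * (D * 7)
    main = begin
      k * (D * 93) + k * (D * 7)     ≡⟨ l₂ k D 93 7 ⟩
      D * k * 100                    ≤⟨ *-monoˡ-≤ 100 h ⟩
      (4 * s + 2 * (D * u)) * 100    ≡⟨ l₃ s D u ⟩
      s * 400 + D * (u * 200)        ≤⟨ +-monoʳ-≤ (s * 400) (*-monoʳ-≤ D u200) ⟩
      s * 400 + D * (k * 7)          ≡⟨ cong (s * 400 +_) (l₅ D k 7) ⟩
      s * 400 + k * (D * 7)          ∎
      where
      l₅ : ∀ D k a → D * (k * a) ≡ k * (D * a)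
      l₅ = solve-∀

  -- Origin of 25200: the loss is at most 2 · (12500 + 24) = 25048 units and 125 must remain.
  stable : ∀ u L → y * 25200 ≤ u + 2 * L → L ≤ y * 12500 + z * 24 → z ≤ y → y * 125 ≤ u
  stable u L h L≤ z≤y = +-cancelʳ-≤ (y * 25048) _ _ (begin
    y * 125 + y * 25048          ≡⟨ sym (*-distribˡ-+ y 125 25048) ⟩
    y * 25173                    ≤⟨ scale y 25173 25200 ⟩
    y * 25200                    ≤⟨ h ⟩
    u + 2 * L                    ≤⟨ +-monoʳ-≤ u (*-monoʳ-≤ 2 (≤-trans L≤ (+-monoʳ-≤ (y * 12500) (*-monoˡ-≤ 24 z≤y)))) ⟩
    u + 2 * (y * 12500 + y * 24) ≡⟨ cong (u +_) (trans (cong (2 *_) (sym (*-distribˡ-+ y 12500 24))) (trans (*-comm 2 (y * 12524)) (*-assoc y 12524 2))) ⟩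
    u + y * 25048                ∎)

  -- Origin of 8001: Δ/8001 unique neighbours are needed, and 125 · 8001 just exceeds 1000000.
  peaceful : ∀ Δ c u D → c + u ≡ D → D ≤ Δ → Δ ≤ y * 1000000 → y * 125 ≤ u → c * 8001 ≤ Δ * 8000
  peaceful Δ c u D e D≤Δ Δ≤y hu = +-cancelʳ-≤ Δ _ _ (begin
    c * 8001 + Δ                 ≤⟨ +-monoʳ-≤ (c * 8001) (≤-trans Δ≤y (≤-trans (scale y 1000000 1000125) (≤-reflexive (sym (*-assoc y 125 8001))))) ⟩
    c * 8001 + y * 125 * 8001    ≤⟨ +-monoʳ-≤ (c * 8001) (*-monoˡ-≤ 8001 hu) ⟩
    c * 8001 + u * 8001          ≡⟨ sym (*-distribʳ-+ 8001 c u) ⟩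
    (c + u) * 8001               ≤⟨ *-monoˡ-≤ 8001 (≤-trans (≤-reflexive e) D≤Δ) ⟩
    Δ * 8001                     ≡⟨ trans (*-distribˡ-+ Δ 8000 1) (cong (Δ * 8000 +_) (*-identityʳ Δ)) ⟩
    Δ * 8000 + Δ                 ∎)

-- The recolouring process

module Recolouring {n k : ℕ} (G : Graph n) (deg< : ∀ v → ∑ᶠ (𝟙 ∘ adj G v) < k)
  (f : Fin n → Fin k) (proper : Proper G f) (d : Fin n → Fin n → Fin k)
  (d≢ : ∀ x w → adj G x w ≡ true → d x w ≢ f x)
  (d-available : ∀ x w → adj G x w ≡ true → ∀ y → adj G x y ≡ true → y ≢ w → f y ≢ d x w)
  (d-two : ∀ x e → ∑ᶠ (λ w → 𝟙 (adj G x w) * 𝟙 (d x w == e)) ≤ 2) where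

  -- With 199k blank letters against k colours, a vertex proposes with probability 1/200.
  open Letters k (k * 199)

  private
    deg≤ : ∀ v → ∑ᶠ (𝟙 ∘ adj G v) ≤ k
    deg≤ v = <⇒≤ (deg< v)

  Letter : Set
  Letter = Fin n × Maybe (Fin k)

  Claim : Set
  Claim = Fin n × Fin k

  class : Fin n → Fin k → List (Fin n)
  class w c = filterᵇ (λ x → adj G w x ∧ (f x == c)) (allFin n)

  -- To recolour w with c, every neighbour x of w coloured c moves to d x w. Proposals that move more than three neighbours
  -- are void, which bounds the interference; at any vertex fewer than a quarter of the colours are lost in this way.
  claims : Letter → List Claim
  claims (w , nothing) = []
  claims (w , just c) = if length (class w c) ≤ᵇ 3 then (w , c) ∷ map (λ x → x , d x w) (class w c) else []

  claims-elim : ∀ {w a t} → t ∈ claims (w , a) → ∃ λ c → a ≡ just c ×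
    (t ≡ (w , c) ⊎ ∃ λ x → adj G w x ≡ true × f x ≡ c × t ≡ (x , d x w))
  claims-elim {w} {just c} t∈ with length (class w c) ≤ᵇ 3
  claims-elim {w} {just c} (here e) | true = c , refl , inj₁ e
  claims-elim {w} {just c} (there m) | true with ∈-map⁻ (λ x → x , d x w) m
  ... | x , x∈ , e = let h = proj₁ (∈-filterᵇ⁻ (λ x → adj G w x ∧ (f x == c)) (allFin n) x∈)
                         a , b = ∧-true {adj G w x} h in c , refl , inj₂ (x , a , ==⇒≡ b , e)

  claims-head : ∀ {w c} → (length (class w c) ≤ᵇ 3) ≡ true → (w , c) ∈ claims (w , just c)
  claims-head e rewrite e = here refl

  claims-fix : ∀ {w c t x} → t ∈ claims (w , just c) → adj G w x ≡ true → f x ≡ c → (x , d x w) ∈ claims (w , just c)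
  claims-fix {w} {c} {t} {x} t∈ a e with length (class w c) ≤ᵇ 3
  ... | true = there (∈-map⁺ (λ x → x , d x w) (∈-filterᵇ⁺ (λ x → adj G w x ∧ (f x == c)) (cong₂ _∧_ a (trans (cong (_== c) e) (==-refl c))) (∈-allFin x)))

  length-claims : ∀ x → length (claims x) ≤ 4
  length-claims (w , nothing) = z≤n
  length-claims (w , just c) with length (class w c) ≤ᵇ 3 in e
  ... | true = s≤s (≤-trans (≤-reflexive (length-map (λ x → x , d x w) (class w c))) (≤ᵇ-sound {length (class w c)} e))
  ... | false = z≤n

  ∑-claims-just : ∀ w c (φ : Claim → ℕ) → ∑ (claims (w , just c)) φ ≤
    φ (w , c) + ∑ᶠ (λ x → 𝟙 (adj G w x) * φ (x , d x w) * 𝟙 (f x == c))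
  ∑-claims-just w c φ with length (class w c) ≤ᵇ 3
  ... | false = z≤n
  ... | true = +-monoʳ-≤ (φ (w , c)) (≤-reflexive (trans (∑-map (λ x → x , d x w) (class w c) φ)
      (trans (∑-filterᵇ (λ x → adj G w x ∧ (f x == c)) (allFin n) _)
             (∑-cong (allFin n) λ x → trans (cong (_* φ (x , d x w)) (𝟙-∧ (adj G w x) (f x == c)))
                                            (l (𝟙 (adj G w x)) (𝟙 (f x == c)) (φ (x , d x w)))))))
    where
    l : ∀ a b c → a * b * c ≡ a * c * b
    l = solve-∀

  -- A neighbour `x` of `i` is displaced by only one letter at `i`, the one proposing `f x`. So over
  -- all colours every adjacent pair yields at most one displacement.
  ∑-claims : ∀ (φ : Claim → ℕ) → ∑ᶠ (λ i → ∑ vals (λ a → ∑ (claims (i , a)) φ)) ≤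
    ∑ᶠ (λ i → ∑ᶠ (λ c → φ (i , c))) + ∑ᶠ (λ x → ∑ᶠ (λ i → 𝟙 (adj G x i) * φ (x , d x i)))
  ∑-claims φ = begin
    ∑ᶠ (λ i → ∑ vals (λ a → ∑ (claims (i , a)) φ))
      ≡⟨ ∑-cong (allFin n) (λ i → ∑-vals (λ a → ∑ (claims (i , a)) φ) refl) ⟩
    ∑ᶠ (λ i → ∑ᶠ (λ c → ∑ (claims (i , just c)) φ))
      ≤⟨ ∑-mono (allFin n) (λ i → ≤-trans (∑-mono (allFin k) λ c → ∑-claims-just i c φ) (≤-reflexive (∑-+ (allFin k) _ _))) ⟩
    ∑ᶠ (λ i → ∑ᶠ (λ c → φ (i , c)) + ∑ᶠ (λ c → ∑ᶠ (λ x → 𝟙 (adj G i x) * φ (x , d x i) * 𝟙 (f x == c))))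
      ≡⟨ ∑-+ (allFin n) _ _ ⟩
    ∑ᶠ (λ i → ∑ᶠ (λ c → φ (i , c))) + ∑ᶠ (λ i → ∑ᶠ (λ c → ∑ᶠ (λ x → 𝟙 (adj G i x) * φ (x , d x i) * 𝟙 (f x == c))))
      ≡⟨ cong (∑ᶠ (λ i → ∑ᶠ (λ c → φ (i , c))) +_) (trans
           (∑-cong (allFin n) λ i → trans (∑-swap (allFin k) (allFin n) _) (∑-cong (allFin n) λ x → ∑ᶠ-pick (f x) (𝟙 (adj G i x) * φ (x , d x i))))
           (trans (∑-swap (allFin n) (allFin n) _) (∑-cong (allFin n) λ x → ∑-cong (allFin n) λ i → cong (λ b → 𝟙 b * φ (x , d x i)) (Graph.sym G i x)))) ⟩
    ∑ᶠ (λ i → ∑ᶠ (λ c → φ (i , c))) + ∑ᶠ (λ x → ∑ᶠ (λ i → 𝟙 (adj G x i) * φ (x , d x i))) ∎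
    where open ≤-Reasoning

  -- Interference between proposals

  module Clash (S : Fin n → Fin n → Bool) (S-sym : ∀ x y → S x y ≡ S y x) where

    clash : Claim → Claim → Bool
    clash (y , e) (y′ , e′) = (y == y′) ∨ (S y y′ ∧ (e == e′))

    clash-sym : ∀ t u → clash t u ≡ clash u t
    clash-sym (y , e) (y′ , e′) = cong₂ _∨_ (==-sym y y′) (cong₂ _∧_ (S-sym y y′) (==-sym e e′))

    interferes : Letter → Letter → Bool
    interferes x y = not (proj₁ x == proj₁ y) ∧ any (λ t → any (clash t) (claims y)) (claims x)

    interferes-sym : ∀ x y → interferes x y ≡ interferes y x
    interferes-sym x y = cong₂ (λ a b → not a ∧ b) (==-sym (proj₁ x) (proj₁ y)) (any-any-sym clash clash-sym (claims x) (claims y))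

    interferes-irrefl : ∀ x → interferes x x ≡ false
    interferes-irrefl x rewrite ==-refl (proj₁ x) = refl

    interferes-intro : ∀ {x y t u} → proj₁ x ≢ proj₁ y → t ∈ claims x → u ∈ claims y → clash t u ≡ true → interferes x y ≡ true
    interferes-intro {x} {y} {t} {u} ne t∈ u∈ e = cong₂ (λ a b → not a ∧ b) (≢⇒== ne)
      (any-∈ (λ t → any (clash t) (claims y)) t∈ (any-∈ (clash t) u∈ e))

    interferes-elim : ∀ x y → interferes x y ≡ true → ∃ λ t → ∃ λ u → t ∈ claims x × u ∈ claims y × clash t u ≡ true
    interferes-elim x y e with any-elim (λ t → any (clash t) (claims y)) (claims x) (proj₂ (∧-true {not (proj₁ x == proj₁ y)} e))
    ... | t , t∈ , e₁ with any-elim (clash t) (claims y) e₁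
    ...   | u , u∈ , e₂ = t , u , t∈ , u∈ , e₂

    module _ (S≤ : ∀ y → ∑ᶠ (𝟙 ∘ S y) ≤ 2 * k) where

      -- Proposers recolouring themselves account for `k` claims on `y` and one claim of `e` for
      -- each `S`-neighbour. Displaced vertices account for at most `k` claims on `y` and, by
      -- `d-two`, two claims of `e` for each `S`-neighbour. As a letter makes at most 4 claims, it
      -- interferes with at most `32 * k` letters.
      clash-count : ∀ t → ∑ᶠ (λ i → ∑ vals (λ a → ∑ (claims (i , a)) (𝟙 ∘ clash t))) ≤ 8 * k
      clash-count t@(y , e) = begin
        ∑ᶠ (λ i → ∑ vals (λ a → ∑ (claims (i , a)) (𝟙 ∘ clash t)))
          ≤⟨ ∑-claims (𝟙 ∘ clash t) ⟩
        ∑ᶠ (λ i → ∑ᶠ (λ c → 𝟙 (clash t (i , c)))) + ∑ᶠ (λ x → ∑ᶠ (λ i → 𝟙 (adj G x i) * 𝟙 (clash t (x , d x i))))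
          ≤⟨ +-mono-≤ heads fixes ⟩
        (k + 2 * k) + (k + 2 * k * 2)
          ≡⟨ l k ⟩
        8 * k ∎
        where
        open ≤-Reasoning
        l : ∀ k → (k + 2 * k) + (k + 2 * k * 2) ≡ 8 * k
        l = solve-∀
        split : ∀ x c → 𝟙 (clash t (x , c)) ≤ 𝟙 (y == x) + 𝟙 (S y x) * 𝟙 (e == c)
        split x c = ≤-trans (𝟙-∨ (y == x) _) (+-monoʳ-≤ (𝟙 (y == x)) (≤-reflexive (𝟙-∧ (S y x) (e == c))))
        heads : ∑ᶠ (λ i → ∑ᶠ (λ c → 𝟙 (clash t (i , c)))) ≤ k + 2 * k
        heads = begin
          ∑ᶠ (λ i → ∑ᶠ (λ c → 𝟙 (clash t (i , c))))
            ≤⟨ ∑-mono (allFin n) (λ i → ≤-trans (∑-mono (allFin k) (split i)) (≤-reflexive (∑-+ (allFin k) _ _))) ⟩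
          ∑ᶠ (λ i → ∑ (allFin k) (λ _ → 𝟙 (y == i)) + ∑ᶠ (λ c → 𝟙 (S y i) * 𝟙 (e == c)))
            ≡⟨ ∑-cong (allFin n) (λ i → cong₂ _+_ (trans (∑-const (allFin k) (𝟙 (y == i))) (cong (_* 𝟙 (y == i)) (length-allFin k))) (∑ᶠ-pick e (𝟙 (S y i)))) ⟩
          ∑ᶠ (λ i → k * 𝟙 (y == i) + 𝟙 (S y i))
            ≡⟨ ∑-+ (allFin n) _ _ ⟩
          ∑ᶠ (λ i → k * 𝟙 (y == i)) + ∑ᶠ (𝟙 ∘ S y)
            ≤⟨ +-mono-≤ (≤-reflexive (∑ᶠ-pick y k)) (S≤ y) ⟩
          k + 2 * k ∎
        fixes : ∑ᶠ (λ x → ∑ᶠ (λ i → 𝟙 (adj G x i) * 𝟙 (clash t (x , d x i)))) ≤ k + 2 * k * 2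
        fixes = begin
          ∑ᶠ (λ x → ∑ᶠ (λ i → 𝟙 (adj G x i) * 𝟙 (clash t (x , d x i))))
            ≤⟨ ∑-mono (allFin n) per-vertex ⟩
          ∑ᶠ (λ x → k * 𝟙 (y == x) + 𝟙 (S y x) * 2)
            ≡⟨ trans (∑-+ (allFin n) _ _) (cong₂ _+_ (∑ᶠ-pick y k) (sym (∑-*ʳ (allFin n) (𝟙 ∘ S y) 2))) ⟩
          k + ∑ᶠ (𝟙 ∘ S y) * 2
            ≤⟨ +-monoʳ-≤ k (*-monoˡ-≤ 2 (S≤ y)) ⟩
          k + 2 * k * 2 ∎
          where
          distr : ∀ a b s c → a * (b + s * c) ≡ a * b + s * (a * c)
          distr = solve-∀
          per-vertex : ∀ x → ∑ᶠ (λ i → 𝟙 (adj G x i) * 𝟙 (clash t (x , d x i))) ≤ k * 𝟙 (y == x) + 𝟙 (S y x) * 2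
          per-vertex x = begin
            ∑ᶠ (λ i → 𝟙 (adj G x i) * 𝟙 (clash t (x , d x i)))
              ≤⟨ ∑-mono (allFin n) (λ i → ≤-trans (*-monoʳ-≤ (𝟙 (adj G x i)) (split x (d x i))) (≤-reflexive (distr (𝟙 (adj G x i)) (𝟙 (y == x)) (𝟙 (S y x)) (𝟙 (e == d x i))))) ⟩
            ∑ᶠ (λ i → 𝟙 (adj G x i) * 𝟙 (y == x) + 𝟙 (S y x) * (𝟙 (adj G x i) * 𝟙 (e == d x i)))
              ≡⟨ trans (∑-+ (allFin n) _ _) (cong₂ _+_ (sym (∑-*ʳ (allFin n) (𝟙 ∘ adj G x) (𝟙 (y == x)))) (sym (∑-*ˡ (allFin n) (λ i → 𝟙 (adj G x i) * 𝟙 (e == d x i)) (𝟙 (S y x))))) ⟩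
            ∑ᶠ (𝟙 ∘ adj G x) * 𝟙 (y == x) + 𝟙 (S y x) * ∑ᶠ (λ i → 𝟙 (adj G x i) * 𝟙 (e == d x i))
              ≤⟨ +-mono-≤ (*-monoˡ-≤ (𝟙 (y == x)) (deg≤ x)) (*-monoʳ-≤ (𝟙 (S y x)) (≤-trans (≤-reflexive (∑-cong (allFin n) λ i → cong (λ b → 𝟙 (adj G x i) * 𝟙 b) (==-sym e (d x i)))) (d-two x e))) ⟩
            k * 𝟙 (y == x) + 𝟙 (S y x) * 2 ∎

      interferes-count : ∀ x → ∑ᶠ (λ i → ∑ vals (λ a → 𝟙 (interferes x (i , a)))) ≤ 32 * k
      interferes-count x = begin
        ∑ᶠ (λ i → ∑ vals (λ a → 𝟙 (interferes x (i , a))))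
          ≤⟨ ∑-mono (allFin n) (λ i → ∑-mono vals λ a → ≤-trans (𝟙-mono (λ e → proj₂ (∧-true {not (proj₁ x == i)} e))) (𝟙-any-any clash (claims x) (claims (i , a)))) ⟩
        ∑ᶠ (λ i → ∑ vals (λ a → ∑ (claims x) (λ t → ∑ (claims (i , a)) (𝟙 ∘ clash t))))
          ≡⟨ trans (∑-cong (allFin n) λ i → ∑-swap vals (claims x) _) (∑-swap (allFin n) (claims x) _) ⟩
        ∑ (claims x) (λ t → ∑ᶠ (λ i → ∑ vals (λ a → ∑ (claims (i , a)) (𝟙 ∘ clash t))))
          ≤⟨ ∑-≤const (claims x) (8 * k) clash-count ⟩
        length (claims x) * (8 * k)
          ≤⟨ *-monoˡ-≤ (8 * k) (length-claims x) ⟩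
        4 * (8 * k)
          ≡⟨ sym (*-assoc 4 8 k) ⟩
        32 * k ∎
        where open ≤-Reasoning

  claimed-count : ∀ v → ∑ᶠ (λ i → ∑ vals (λ a → ∑ (claims (i , a)) (λ t → 𝟙 (adj G v (proj₁ t))))) ≤ 2 * k * k
  claimed-count v = begin
    ∑ᶠ (λ i → ∑ vals (λ a → ∑ (claims (i , a)) (λ t → 𝟙 (adj G v (proj₁ t)))))
      ≤⟨ ∑-claims (λ t → 𝟙 (adj G v (proj₁ t))) ⟩
    ∑ᶠ (λ i → ∑ (allFin k) (λ _ → 𝟙 (adj G v i))) + ∑ᶠ (λ x → ∑ᶠ (λ i → 𝟙 (adj G x i) * 𝟙 (adj G v x)))
      ≤⟨ +-mono-≤
           (≤-reflexive (trans (∑-cong (allFin n) λ i → trans (∑-const (allFin k) (𝟙 (adj G v i))) (cong (_* 𝟙 (adj G v i)) (length-allFin k)))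
                               (sym (∑-*ˡ (allFin n) (𝟙 ∘ adj G v) k))))
           (≤-trans (∑-mono (allFin n) λ x → ≤-trans (≤-reflexive (sym (∑-*ʳ (allFin n) (𝟙 ∘ adj G x) (𝟙 (adj G v x))))) (*-monoˡ-≤ (𝟙 (adj G v x)) (deg≤ x)))
                    (≤-reflexive (sym (∑-*ˡ (allFin n) (𝟙 ∘ adj G v) k)))) ⟩
    k * ∑ᶠ (𝟙 ∘ adj G v) + k * ∑ᶠ (𝟙 ∘ adj G v)
      ≤⟨ +-mono-≤ (*-monoʳ-≤ k (deg≤ v)) (*-monoʳ-≤ k (deg≤ v)) ⟩
    k * k + k * k
      ≡⟨ l k ⟩
    2 * k * k ∎
    where
    open ≤-Reasoning
    l : ∀ k → k * k + k * k ≡ 2 * k * k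
    l = solve-∀

  module Adjacent = Clash (adj G) (Graph.sym G)

  -- Adjacency alone protects properness and decides acceptance. For the analysis at `v`, two
  -- neighbours of `v` must also not receive the same colour, which would spoil uniqueness there.
  near : Fin n → Fin n → Fin n → Bool
  near v y y′ = adj G y y′ ∨ (adj G v y ∧ adj G v y′)

  near-sym : ∀ v y y′ → near v y y′ ≡ near v y′ y
  near-sym v y y′ = cong₂ _∨_ (Graph.sym G y y′) (∧-comm (adj G v y) (adj G v y′))

  near-count : ∀ v y → ∑ᶠ (𝟙 ∘ near v y) ≤ 2 * k
  near-count v y = begin
    ∑ᶠ (𝟙 ∘ near v y)
      ≤⟨ ∑-mono (allFin n) (λ x → ≤-trans (𝟙-∨ (adj G y x) _) (+-monoʳ-≤ (𝟙 (adj G y x)) (𝟙-mono λ e → proj₂ (∧-true {adj G v y} e)))) ⟩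
    ∑ᶠ (λ x → 𝟙 (adj G y x) + 𝟙 (adj G v x))
      ≡⟨ ∑-+ (allFin n) (𝟙 ∘ adj G y) (𝟙 ∘ adj G v) ⟩
    ∑ᶠ (𝟙 ∘ adj G y) + ∑ᶠ (𝟙 ∘ adj G v)
      ≤⟨ +-mono-≤ (deg≤ y) (deg≤ v) ⟩
    k + k
      ≡⟨ cong (k +_) (sym (+-identityʳ k)) ⟩
    2 * k ∎
    where open ≤-Reasoning

  module Around (v : Fin n) = Clash (near v) (near-sym v)

  adjacent⇒around : ∀ v x y → Adjacent.interferes x y ≡ true → Around.interferes v x y ≡ true
  adjacent⇒around v x y e with Adjacent.interferes-elim x y e
  ... | (y₁ , e₁) , (y₂ , e₂) , t∈ , u∈ , c = Around.interferes-intro v {x} {y}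
      (λ eq → true≢false (trans (cong (_== proj₁ y) eq) (==-refl (proj₁ y))) (not-true (proj₁ (∧-true {not (proj₁ x == proj₁ y)} e)))) t∈ u∈ (weaken c)
    where
    weaken : ((y₁ == y₂) ∨ (adj G y₁ y₂ ∧ (e₁ == e₂))) ≡ true → Around.clash v (y₁ , e₁) (y₂ , e₂) ≡ true
    weaken c with y₁ == y₂ | adj G y₁ y₂
    ... | true | _ = refl
    ... | false | true = c

  -- Carrying out the accepted proposals

  accepted : Word (Fin n) (Maybe (Fin k)) → Letter → Bool
  accepted H x = not (any (Adjacent.interferes x) H)

  changes : Word (Fin n) (Maybe (Fin k)) → List Claim
  changes H = concatMap (λ x → if accepted H x then claims x else []) H

  -- Unclaimed vertices keep `f`. That the first claim wins is immaterial for accepted changes, by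
  -- `changes-functional`.
  assign : List Claim → Fin n → Fin k
  assign [] y = f y
  assign ((x , e) ∷ cs) y = if x == y then e else assign cs y

  assign-cases : ∀ cs y → (y , assign cs y) ∈ cs ⊎ (assign cs y ≡ f y × ∀ e → ¬ (y , e) ∈ cs)
  assign-cases [] y = inj₂ (refl , λ e ())
  assign-cases ((x , e) ∷ cs) y with x == y in eq | assign-cases cs y
  ... | true | _ = inj₁ (here (cong (_, e) (sym (==⇒≡ eq))))
  ... | false | inj₁ m = inj₁ (there m)
  ... | false | inj₂ (h , none) = inj₂ (h , λ { e′ (here refl) → true≢false (==-refl y) eq ; e′ (there m) → none e′ m })

  changes⁻ : ∀ {H t} → t ∈ changes H → ∃ λ x → x ∈ H × accepted H x ≡ true × t ∈ claims x
  changes⁻ {H} {t} = go H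
    where
    go : ∀ K → t ∈ concatMap (λ x → if accepted H x then claims x else []) K → ∃ λ x → x ∈ K × accepted H x ≡ true × t ∈ claims x
    go (x ∷ K) m with ∈-++⁻ (if accepted H x then claims x else []) m
    ... | inj₂ m′ = let y , a , b , c = go K m′ in y , there a , b , c
    ... | inj₁ m′ with accepted H x in e
    ...   | true = x , here refl , e , m′

  changes⁺ : ∀ {H x t} → x ∈ H → accepted H x ≡ true → t ∈ claims x → t ∈ changes H
  changes⁺ {H} {x} {t} x∈ acc t∈ = go H x∈
    where
    go : ∀ K → x ∈ K → t ∈ concatMap (λ x → if accepted H x then claims x else []) K
    go (_ ∷ K) (here refl) = ∈-++⁺ˡ (subst (λ b → t ∈ (if b then claims x else [])) (sym acc) t∈)
    go (y ∷ K) (there m) = ∈-++⁺ʳ (if accepted H y then claims y else []) (go K m)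

  claims-functional : ∀ x {y e e′} → (y , e) ∈ claims x → (y , e′) ∈ claims x → e ≡ e′
  claims-functional (w , a) m m′ with claims-elim {w} {a} m | claims-elim {w} {a} m′
  ... | c , refl , inj₁ refl | _ , refl , inj₁ refl = refl
  ... | c , refl , inj₂ (x , _ , _ , refl) | _ , refl , inj₂ (_ , _ , _ , refl) = refl
  ... | c , refl , inj₁ refl | _ , refl , inj₂ (_ , aw , _ , refl) = ⊥-elim (true≢false aw (irrefl G w))
  ... | c , refl , inj₂ (_ , aw , _ , refl) | _ , refl , inj₁ refl = ⊥-elim (true≢false aw (irrefl G w))

  unique-letter : ∀ (H : Word (Fin n) (Maybe (Fin k))) → Unique (map proj₁ H) → ∀ {x y} → x ∈ H → y ∈ H → proj₁ x ≡ proj₁ y → x ≡ y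
  unique-letter (h ∷ H) (p ∷ u) (here refl) (here refl) e = refl
  unique-letter (h ∷ H) (p ∷ u) (here refl) (there m) e = contradiction e (lookup p (∈-map⁺ proj₁ m))
  unique-letter (h ∷ H) (p ∷ u) (there m) (here refl) e = contradiction (sym e) (lookup p (∈-map⁺ proj₁ m))
  unique-letter (h ∷ H) (p ∷ u) (there m) (there m′) e = unique-letter H u m m′ e

  module Result (H : Word (Fin n) (Maybe (Fin k))) (H-all : map proj₁ H ≡ allFin n) where

    recoloured : Fin n → Fin k
    recoloured = assign (changes H)

    H-unique : ∀ {x y} → x ∈ H → y ∈ H → proj₁ x ≡ proj₁ y → x ≡ y
    H-unique = unique-letter H (subst Unique (sym H-all) (allFin⁺ n))

    accepted⇒ : ∀ {x y t u} → accepted H x ≡ true → y ∈ H → t ∈ claims x → u ∈ claims y → proj₁ x ≢ proj₁ y →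
      Adjacent.clash t u ≡ true → ⊥
    accepted⇒ {x} {y} acc y∈ t∈ u∈ ne c = true≢false
      (any-∈ (Adjacent.interferes x) y∈ (Adjacent.interferes-intro {x} {y} ne t∈ u∈ c)) (not-true acc)

    changes-functional : ∀ {y e e′} → (y , e) ∈ changes H → (y , e′) ∈ changes H → e ≡ e′
    changes-functional {y} {e} {e′} m m′ with changes⁻ {H} m | changes⁻ {H} m′
    ... | x , x∈ , acc , t∈ | x′ , x′∈ , _ , t′∈ with proj₁ x ≟ᶠ proj₁ x′
    ...   | yes eq with H-unique x∈ x′∈ eq
    ...     | refl = claims-functional x t∈ t′∈
    changes-functional {y} {e} {e′} m m′ | x , x∈ , acc , t∈ | x′ , x′∈ , _ , t′∈ | no ne =
      ⊥-elim (accepted⇒ {x} {x′} acc x′∈ t∈ t′∈ ne (cong (_∨ (adj G y y ∧ (e == e′))) (==-refl y)))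

    recoloured≡ : ∀ {y e} → (y , e) ∈ changes H → recoloured y ≡ e
    recoloured≡ {y} {e} m with assign-cases (changes H) y
    ... | inj₁ m′ = changes-functional m′ m
    ... | inj₂ (_ , none) = contradiction m (none e)

    -- If `u` proposed the move, a neighbour with the proposed colour would have been displaced. If
    -- `u` was displaced by `i`, its replacement colour occurs on no neighbour other than `i`, and
    -- `i` itself changes.
    kept≢moved : ∀ {u w} → (u , recoloured u) ∈ changes H → (∀ e → ¬ (w , e) ∈ changes H) → adj G u w ≡ true →
      f w ≢ recoloured u
    kept≢moved {u} {w} m none a with changes⁻ {H} m
    ... | (i , b) , x∈ , acc , t∈ with claims-elim {i} {b} t∈
    ...   | c , refl , inj₁ eq = λ e → none (d w i) (changes⁺ x∈ acc (claims-fix t∈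
              (subst (λ z → adj G z w ≡ true) (cong proj₁ eq) a) (trans e (cong proj₂ eq))))
    ...   | c , refl , inj₂ (x , ax , fx , eq) = subst (f w ≢_) (sym (cong proj₂ eq))
              (d-available x i (adj-sym G deg< ax) w (subst (λ z → adj G z w ≡ true) (cong proj₁ eq) a) w≢i)
      where
      w≢i : w ≢ i
      w≢i w≡i with claims-head′ t∈
        where
        claims-head′ : ∀ {t} → t ∈ claims (i , just c) → (i , c) ∈ claims (i , just c)
        claims-head′ t∈ with length (class i c) ≤ᵇ 3
        ... | true = here refl
      ... | h = none c (subst (λ z → (z , c) ∈ changes H) (sym w≡i) (changes⁺ x∈ acc h))

    -- The new case is two changed neighbours. Under different letters, equal colours would clash.
    -- Under the same letter they cannot both be displaced, as displaced vertices share an old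
    -- colour; and a displaced vertex avoids its old colour, the one the proposer takes.
    recoloured-proper : Proper G recoloured
    recoloured-proper u w a with assign-cases (changes H) u | assign-cases (changes H) w
    ... | inj₂ (eu , _) | inj₂ (ew , _) = subst₂ _≢_ (sym eu) (sym ew) (proper u w a)
    ... | inj₁ m | inj₂ (ew , none) = λ e → kept≢moved m none a (trans (sym ew) (sym e))
    ... | inj₂ (eu , none) | inj₁ m = λ e → kept≢moved m none (adj-sym G deg< a) (trans (sym eu) e)
    ... | inj₁ m | inj₁ m′ with changes⁻ {H} m | changes⁻ {H} m′
    ...   | (i , b) , x∈ , acc , t∈ | (j , b′) , x′∈ , _ , t′∈ with i ≟ᶠ j
    ...     | no ne = λ e → accepted⇒ {i , b} {j , b′} acc x′∈ t∈ t′∈ ne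
                (trans (cong₂ (λ p q → (u == w) ∨ (p ∧ q)) a (trans (cong (_== recoloured w) e) (==-refl (recoloured w)))) (∨-zeroʳ (u == w)))
    ...     | yes eq with H-unique x∈ x′∈ eq
    ...       | refl with claims-elim {i} {b} t∈ | claims-elim {i} {b} t′∈
    ...         | c , refl , inj₁ p | _ , refl , inj₁ q = ⊥-elim (true≢false (subst₂ (λ y z → adj G y z ≡ true) (cong proj₁ p) (cong proj₁ q) a) (irrefl G i))
    ...         | c , refl , inj₁ p | _ , refl , inj₂ (x , ax , fx , q) = λ e → d≢ x i (adj-sym G deg< ax) (trans (sym (cong proj₂ q)) (trans (sym e) (trans (cong proj₂ p) (sym fx))))
    ...         | c , refl , inj₂ (x , ax , fx , p) | _ , refl , inj₁ q = λ e → d≢ x i (adj-sym G deg< ax) (trans (sym (cong proj₂ p)) (trans e (trans (cong proj₂ q) (sym fx))))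
    ...         | c , refl , inj₂ (x , ax , fx , p) | _ , refl , inj₂ (y , ay , fy , q) = ⊥-elim (proper x y (subst₂ (λ y z → adj G y z ≡ true) (cong proj₁ p) (cong proj₁ q) a) (trans fx (sym fy)))

  -- Useful proposals and their locality

  open Uniqueness G
  open Balls G deg<

  target : Fin n → Letter → Bool
  target v (w , nothing) = false
  target v (w , just c) = adj G v w ∧ ((multiplicity (adj G v) f c ≡ᵇ 0) ∧ (length (class w c) ≤ᵇ 3))

  open Tails {Fin n} vals using (size)

  class-sum : ∀ w → ∑ᶠ (λ c → length (class w c)) ≡ ∑ᶠ (𝟙 ∘ adj G w)
  class-sum w = trans (∑-cong (allFin k) λ c → trans (length-filterᵇ _ (allFin n)) (∑-cong (allFin n) λ x → 𝟙-∧ (adj G w x) (f x == c)))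
    (∑-multiplicity (adj G w) f)

  -- By `absent-bound` about half of the colours are absent at `v`. For each neighbour `w` at most a
  -- quarter are lost to void proposals, since the classes at `w` have total size at most `k` and a
  -- lost one has at least four members. A quarter remains.
  target-bound : ∀ v → ∑ᶠ (𝟙 ∘ adj G v) * k ≤ 4 * size (target v) (allFin n) + 2 * (∑ᶠ (𝟙 ∘ adj G v) * uniques f v)
  target-bound v = +-cancelʳ-≤ (D * (3 * k)) (D * k) (4 * s + 2 * (D * u)) (begin
    D * k + D * (3 * k)                         ≡⟨ l₁ D k ⟩
    2 * (D * (2 * k))                           ≤⟨ *-monoʳ-≤ 2 (*-monoʳ-≤ D (absent-bound f v)) ⟩
    2 * (D * (2 * Z + (D + u)))                 ≡⟨ l₂ D Z u ⟩
    D * (4 * Z) + (2 * (D * u) + 2 * (D * D))   ≤⟨ +-mono-≤ targets (+-monoʳ-≤ (2 * (D * u)) (*-monoʳ-≤ 2 (*-monoʳ-≤ D (deg≤ v)))) ⟩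
    (4 * s + D * k) + (2 * (D * u) + 2 * (D * k)) ≡⟨ l₃ s D k u ⟩
    (4 * s + 2 * (D * u)) + D * (3 * k)         ∎)
    where
    open ≤-Reasoning
    D = ∑ᶠ (𝟙 ∘ adj G v)
    u = uniques f v
    Z = absent f v
    s = size (target v) (allFin n)
    l₁ : ∀ D k → D * k + D * (3 * k) ≡ 2 * (D * (2 * k))
    l₁ = solve-∀
    l₂ : ∀ D Z u → 2 * (D * (2 * Z + (D + u))) ≡ D * (4 * Z) + (2 * (D * u) + 2 * (D * D))
    l₂ = solve-∀
    l₃ : ∀ s D k u → (4 * s + D * k) + (2 * (D * u) + 2 * (D * k)) ≡ (4 * s + 2 * (D * u)) + D * (3 * k)
    l₃ = solve-∀
    light : Fin n → Fin k → Bool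
    light w c = (multiplicity (adj G v) f c ≡ᵇ 0) ∧ (length (class w c) ≤ᵇ 3)
    per-colour : ∀ b l → 4 * 𝟙 b ≤ 4 * 𝟙 (b ∧ (l ≤ᵇ 3)) + l
    per-colour false l = z≤n
    per-colour true l with l ≤? 3
    ... | yes le rewrite ≤ᵇ-true le = m≤m+n 4 l
    ... | no gt = ≤-trans (≰⇒> gt) (m≤n+m l _)
    per-vertex : ∀ w → 4 * Z ≤ 4 * ∑ᶠ (𝟙 ∘ light w) + k
    per-vertex w = begin
      4 * Z                                                                ≡⟨ ∑-*ˡ (allFin k) _ 4 ⟩
      ∑ᶠ (λ c → 4 * 𝟙 (multiplicity (adj G v) f c ≡ᵇ 0))                   ≤⟨ ∑-mono (allFin k) (λ c → per-colour (multiplicity (adj G v) f c ≡ᵇ 0) (length (class w c))) ⟩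
      ∑ᶠ (λ c → 4 * 𝟙 (light w c) + length (class w c))                    ≡⟨ trans (∑-+ (allFin k) _ _) (cong₂ _+_ (sym (∑-*ˡ (allFin k) (𝟙 ∘ light w) 4)) (class-sum w)) ⟩
      4 * ∑ᶠ (𝟙 ∘ light w) + ∑ᶠ (𝟙 ∘ adj G w)                              ≤⟨ +-monoʳ-≤ _ (deg≤ w) ⟩
      4 * ∑ᶠ (𝟙 ∘ light w) + k                                             ∎
    s≡ : s ≡ ∑ᶠ (λ w → 𝟙 (adj G v w) * ∑ᶠ (𝟙 ∘ light w))
    s≡ = ∑-cong (allFin n) λ w → trans (∑-vals (λ a → 𝟙 (target v (w , a))) refl)
      (trans (∑-cong (allFin k) λ c → 𝟙-∧ (adj G v w) (light w c)) (sym (∑-*ˡ (allFin k) (𝟙 ∘ light w) (𝟙 (adj G v w)))))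
    l₄ : ∀ a t k → a * (4 * t + k) ≡ 4 * (a * t) + a * k
    l₄ = solve-∀
    targets : D * (4 * Z) ≤ 4 * s + D * k
    targets = begin
      D * (4 * Z)
        ≡⟨ ∑-*ʳ (allFin n) (𝟙 ∘ adj G v) (4 * Z) ⟩
      ∑ᶠ (λ w → 𝟙 (adj G v w) * (4 * Z))
        ≤⟨ ∑-mono (allFin n) (λ w → ≤-trans (*-monoʳ-≤ (𝟙 (adj G v w)) (per-vertex w)) (≤-reflexive (l₄ (𝟙 (adj G v w)) (∑ᶠ (𝟙 ∘ light w)) k))) ⟩
      ∑ᶠ (λ w → 4 * (𝟙 (adj G v w) * ∑ᶠ (𝟙 ∘ light w)) + 𝟙 (adj G v w) * k)
        ≡⟨ trans (∑-+ (allFin n) _ _) (cong₂ _+_ (trans (sym (∑-*ˡ (allFin n) _ 4)) (cong (4 *_) (sym s≡))) (sym (∑-*ʳ (allFin n) (𝟙 ∘ adj G v) k))) ⟩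
      4 * s + D * k ∎

  module Survive (v : Fin n) = Blocking vals (target v) (Around.interferes v) (Around.interferes-sym v) (Around.interferes-irrefl v)

  claimed : Fin n → Letter → ℕ
  claimed v x = ∑ (claims x) (λ t → 𝟙 (adj G v (proj₁ t)))

  claimed≤4 : ∀ v x → claimed v x ≤ 4
  claimed≤4 v x = ≤-trans (∑-≤const (claims x) 1 λ t → 𝟙≤1 _) (≤-trans (≤-reflexive (*-identityʳ _)) (length-claims x))

  claims-close : ∀ x {t} → t ∈ claims x → close (proj₁ x) (proj₁ t) ≡ true
  claims-close (w , a) t∈ with claims-elim {w} {a} t∈
  ... | c , refl , inj₁ refl = close-refl w
  ... | c , refl , inj₂ (x , aw , _ , refl) = adj⇒close aw

  claims-close′ : ∀ x {t} → t ∈ claims x → close (proj₁ t) (proj₁ x) ≡ true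
  claims-close′ x {t} t∈ = trans (close-sym (proj₁ t) (proj₁ x)) (claims-close x t∈)

  -- Radius 4: from `v` to a neighbour that proposes, to a vertex it claims, to a clashing vertex,
  -- to the proposer claiming that one.
  ball : Fin n → Fin n → Bool
  ball = within 4

  target-near : ∀ v x → target v x ≡ true → adj G v (proj₁ x) ≡ true
  target-near v (w , just c) e = proj₁ (∧-true {adj G v w} e)

  target-ball : ∀ v x → target v x ≡ true → ball v (proj₁ x) ≡ true
  target-ball v x e = within-step 3 (proj₁ x) (adj⇒close (target-near v x e)) (within-refl 3 (proj₁ x))

  interferes-ball : ∀ v x y → target v x ≡ true → Around.interferes v x y ≡ true → ball v (proj₁ y) ≡ true
  interferes-ball v x y e r with Around.interferes-elim v x y r
  ... | t , u , t∈ , u∈ , c with ∨-true {proj₁ t == proj₁ u} c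
  ...   | inj₁ eq = within-step 3 (proj₁ x) (adj⇒close (target-near v x e)) (within-step 2 (proj₁ t) (claims-close x t∈)
            (within-step 1 (proj₁ u) (cong (_∨ adj G (proj₁ t) (proj₁ u)) eq) (within-step 0 (proj₁ y) (claims-close′ y u∈) (==-refl (proj₁ y)))))
  ...   | inj₂ c′ with ∨-true {adj G (proj₁ t) (proj₁ u)} (proj₁ (∧-true c′))
  ...     | inj₁ a = within-step 3 (proj₁ x) (adj⇒close (target-near v x e)) (within-step 2 (proj₁ t) (claims-close x t∈)
              (within-step 1 (proj₁ u) (adj⇒close a) (within-step 0 (proj₁ y) (claims-close′ y u∈) (==-refl (proj₁ y)))))
  ...     | inj₂ a = within-step 3 (proj₁ u) (adj⇒close (proj₂ (∧-true {adj G v (proj₁ t)} a)))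
              (within-step 2 (proj₁ y) (claims-close′ y u∈) (within-refl 2 (proj₁ y)))

  -- The inner `any` is restricted first and only at targets, because only letters interfering with
  -- a target are known to lie in the ball.
  survivors-local : ∀ v H → Survive.survivors v H ≡ Survive.survivors v (restrict (ball v) H)
  survivors-local v H = trans (∑-cong H step) (restrict-∑ (ball v) F outside H)
    where
    F = λ x → 𝟙 (target v x ∧ not (any (Around.interferes v x) (restrict (ball v) H)))
    step : ∀ x → 𝟙 (target v x ∧ not (any (Around.interferes v x) H)) ≡ F x
    step x with target v x in e
    ... | false = refl
    ... | true = cong (𝟙 ∘ not) (restrict-any (ball v) (Around.interferes v x) (λ y → interferes-ball v x y e) H)
    outside : ∀ x → ball v (proj₁ x) ≡ false → F x ≡ 0
    outside x e with target v x in e′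
    ... | false = refl
    ... | true = ⊥-elim (true≢false (target-ball v x e′) e)

  claimed-local : ∀ v H → ∑ H (claimed v) ≡ ∑ (restrict (ball v) H) (claimed v)
  claimed-local v = restrict-∑ (ball v) (claimed v) outside
    where
    outside : ∀ x → ball v (proj₁ x) ≡ false → claimed v x ≡ 0
    outside x e = trans (∑-cong-∈ (claims x) {G = λ _ → 0} λ {t} t∈ → cong 𝟙 (¬true⇒false λ a → true≢false
        (within-step 3 (proj₁ t) (adj⇒close a) (within-step 2 (proj₁ x) (claims-close′ x t∈) (within-refl 2 (proj₁ x)))) e))
      (∑-zero (claims x) λ _ → refl)

  -- Unique neighbours after recolouring

  module Counting (H : Word (Fin n) (Maybe (Fin k))) (H-all : map proj₁ H ≡ allFin n) where

    open Result H H-all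

    -- The proposal is accepted, so `w` takes `c`, which was absent at `v`. Another neighbour of `v`
    -- can acquire `c` neither through a different letter, which would clash under `near v`, nor as
    -- a vertex displaced by `w`, which leaves colour `c`.
    survivor-unique : ∀ v x → x ∈ H → target v x ≡ true → any (Around.interferes v x) H ≡ false → unique recoloured v (proj₁ x) ≡ true
    survivor-unique v x@(w , just c) x∈ e free = unique-intro recoloured v w a λ u a′ ne same →
      differs u a′ ne (trans same new)
      where
      a = proj₁ (∧-true {adj G v w} e)
      light = proj₂ (∧-true {adj G v w} e)
      absent-c : ∀ u → adj G v u ≡ true → f u ≢ c
      absent-c = multiplicity-zero (adj G v) f c (≡ᵇ-sound (proj₁ (∧-true {multiplicity (adj G v) f c ≡ᵇ 0} light)))
      head∈ : (w , c) ∈ claims x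
      head∈ = claims-head (proj₂ (∧-true {multiplicity (adj G v) f c ≡ᵇ 0} light))
      acc : accepted H x ≡ true
      acc = cong not (¬true⇒false λ t → let y , y∈ , e′ = any-elim (Adjacent.interferes x) H t in
        true≢false (any-∈ (Around.interferes v x) y∈ (adjacent⇒around v x y e′)) free)
      new : recoloured w ≡ c
      new = recoloured≡ (changes⁺ x∈ acc head∈)
      differs : ∀ u → adj G v u ≡ true → u ≢ w → recoloured u ≢ c
      differs u a′ ne with assign-cases (changes H) u
      ... | inj₂ (eu , _) = λ e → absent-c u a′ (trans (sym eu) e)
      ... | inj₁ m with changes⁻ {H} m
      ...   | (i , b) , y∈ , _ , t∈ with w ≟ᶠ i
      ...     | no ne′ = λ eq → true≢false (any-∈ (Around.interferes v x) y∈ (Around.interferes-intro v {x} {i , b} ne′ head∈ t∈ (clashing eq))) free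
        where
        clashing : recoloured u ≡ c → Around.clash v (w , c) (u , recoloured u) ≡ true
        clashing eq rewrite a | a′ | trans (cong (c ==_) eq) (==-refl c) | ∨-zeroʳ (adj G w u) = ∨-zeroʳ (w == u)
      ...     | yes eq with H-unique x∈ y∈ eq
      ...       | refl with claims-elim {w} {just c} t∈
      ...         | _ , refl , inj₁ q = contradiction (cong proj₁ q) ne
      ...         | _ , refl , inj₂ (y , ay , fy , q) = λ eq → d≢ y w (adj-sym G deg< ay) (trans (sym (cong proj₂ q)) (trans eq (sym fy)))

    survivors≤uniques : ∀ v → Survive.survivors v H ≤ uniques recoloured v
    survivors≤uniques v = begin
      ∑ H (λ x → 𝟙 (target v x ∧ not (any (Around.interferes v x) H)))
        ≤⟨ ∑-mono-∈ H (λ {x} x∈ → 𝟙-mono λ e → survivor-unique v x x∈ (proj₁ (∧-true {target v x} e)) (not-true (proj₂ (∧-true {target v x} e)))) ⟩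
      ∑ H (λ x → 𝟙 (unique recoloured v (proj₁ x)))
        ≡⟨ sym (∑-map proj₁ H (𝟙 ∘ unique recoloured v)) ⟩
      ∑ (map proj₁ H) (𝟙 ∘ unique recoloured v)
        ≡⟨ cong (λ is → ∑ is (𝟙 ∘ unique recoloured v)) H-all ⟩
      uniques recoloured v ∎
      where open ≤-Reasoning

    moved : Fin n → Fin n → Bool
    moved v u = adj G v u ∧ not (recoloured u == f u)

    -- Rejected proposals are counted too: this keeps the bound a sum of one independent term per
    -- letter.
    moved≤claimed : ∀ v → ∑ᶠ (𝟙 ∘ moved v) ≤ ∑ H (claimed v)
    moved≤claimed v = begin
      ∑ᶠ (𝟙 ∘ moved v)
        ≤⟨ ∑-mono (allFin n) per-vertex ⟩
      ∑ᶠ (λ u → ∑ H (λ x → ∑ (claims x) (λ t → 𝟙 (adj G v (proj₁ t)) * 𝟙 (proj₁ t == u))))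
        ≡⟨ trans (∑-swap (allFin n) H _) (∑-cong H λ x → trans (∑-swap (allFin n) (claims x) _) (∑-cong (claims x) λ t → ∑ᶠ-pick (proj₁ t) (𝟙 (adj G v (proj₁ t))))) ⟩
      ∑ H (claimed v) ∎
      where
      open ≤-Reasoning
      per-vertex : ∀ u → 𝟙 (moved v u) ≤ ∑ H (λ x → ∑ (claims x) (λ t → 𝟙 (adj G v (proj₁ t)) * 𝟙 (proj₁ t == u)))
      per-vertex u with moved v u in e
      ... | false = z≤n
      ... | true with assign-cases (changes H) u
      ...   | inj₂ (eu , _) = ⊥-elim (true≢false (trans (cong (_== f u) eu) (==-refl (f u))) (not-true (proj₂ (∧-true {adj G v u} e))))
      ...   | inj₁ m with changes⁻ {H} m
      ...     | x , x∈ , _ , t∈ = ≤-trans (≤-reflexive (sym one))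
                (≤-trans (≤∑ (λ t → 𝟙 (adj G v (proj₁ t)) * 𝟙 (proj₁ t == u)) t∈) (≤∑ (λ x → ∑ (claims x) (λ t → 𝟙 (adj G v (proj₁ t)) * 𝟙 (proj₁ t == u))) x∈))
        where
        one : 𝟙 (adj G v u) * 𝟙 (u == u) ≡ 1
        one rewrite proj₁ (∧-true {adj G v u} e) | ==-refl u = refl

    -- A vertex that loses uniqueness either moved itself or shares its colour with a vertex that moved; distinct unique
    -- vertices having distinct colours, the latter happens at most once for each vertex that moved.
    uniques-stable : ∀ v → uniques f v ≤ uniques recoloured v + 2 * ∑ H (claimed v)
    uniques-stable v = begin
      uniques f v
        ≤⟨ ∑-mono (allFin n) per-vertex ⟩
      ∑ᶠ (λ w → 𝟙 (unique recoloured v w) + (𝟙 (moved v w) + ∑ᶠ (thief w)))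
        ≡⟨ trans (∑-+ (allFin n) _ _) (cong (uniques recoloured v +_) (∑-+ (allFin n) _ _)) ⟩
      uniques recoloured v + (∑ᶠ (𝟙 ∘ moved v) + ∑ᶠ (λ w → ∑ᶠ (thief w)))
        ≤⟨ +-monoʳ-≤ (uniques recoloured v) (+-mono-≤ (moved≤claimed v) (≤-trans thieves (moved≤claimed v))) ⟩
      uniques recoloured v + (∑ H (claimed v) + ∑ H (claimed v))
        ≡⟨ cong (λ e → uniques recoloured v + (∑ H (claimed v) + e)) (sym (+-identityʳ _)) ⟩
      uniques recoloured v + 2 * ∑ H (claimed v) ∎
      where
      open ≤-Reasoning
      thief : Fin n → Fin n → ℕ
      thief w u = 𝟙 (moved v u) * 𝟙 ((recoloured u == f w) ∧ unique f v w)
      thieves : ∑ᶠ (λ w → ∑ᶠ (thief w)) ≤ ∑ᶠ (𝟙 ∘ moved v)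
      thieves = begin
        ∑ᶠ (λ w → ∑ᶠ (thief w))
          ≡⟨ ∑-swap (allFin n) (allFin n) thief ⟩
        ∑ᶠ (λ u → ∑ᶠ (λ w → thief w u))
          ≡⟨ ∑-cong (allFin n) (λ u → sym (∑-*ˡ (allFin n) (λ w → 𝟙 ((recoloured u == f w) ∧ unique f v w)) (𝟙 (moved v u)))) ⟩
        ∑ᶠ (λ u → 𝟙 (moved v u) * ∑ᶠ (λ w → 𝟙 ((recoloured u == f w) ∧ unique f v w)))
          ≤⟨ ∑-mono (allFin n) (λ u → ≤-trans (*-monoʳ-≤ (𝟙 (moved v u)) (∑ᶠ-single _ 1 (λ w → 𝟙≤1 _) (same u))) (≤-reflexive (*-identityʳ _))) ⟩
        ∑ᶠ (𝟙 ∘ moved v) ∎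
        where
        same : ∀ u w w′ → 0 < 𝟙 ((recoloured u == f w) ∧ unique f v w) → 0 < 𝟙 ((recoloured u == f w′) ∧ unique f v w′) → w ≡ w′
        same u w w′ p q with ∧-true {recoloured u == f w} (𝟙-pos p) | ∧-true {recoloured u == f w′} (𝟙-pos q)
        ... | e , uw | e′ , uw′ with w ≟ᶠ w′
        ...   | yes eq = eq
        ...   | no ne = ⊥-elim (proj₂ (unique-elim f v w′ uw′) w (proj₁ (unique-elim f v w uw)) ne (trans (sym (==⇒≡ e)) (==⇒≡ e′)))
      per-vertex : ∀ w → 𝟙 (unique f v w) ≤ 𝟙 (unique recoloured v w) + (𝟙 (moved v w) + ∑ᶠ (thief w))
      per-vertex w with unique f v w in eu | unique recoloured v w in er
      ... | false | _ = z≤n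
      ... | true | true = s≤s z≤n
      ... | true | false with unique-elim f v w eu
      ...   | a , alone with recoloured w ≟ᶠ f w
      ...     | no ne rewrite a = s≤s z≤n
      ...     | yes kept with non-unique recoloured v w a er
      ...       | u , a′ , ne , same = ≤-trans (≤-reflexive (sym one)) (≤-trans (≤∑ᶠ (λ u → 𝟙 (moved v u) * 𝟙 ((recoloured u == f w) ∧ true)) u) (m≤n+m _ (𝟙 (adj G v w ∧ false))))
        where
        same′ : recoloured u ≡ f w
        same′ = trans same kept
        one : 𝟙 (moved v u) * 𝟙 ((recoloured u == f w) ∧ true) ≡ 1
        one rewrite a′ | ≢⇒== {i = recoloured u} {f u} (λ e → alone u a′ ne (trans (sym e) same′)) | trans (cong (_== f w) same′) (==-refl (f w)) = refl

  -- Concentration and the local lemma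

  module Concentration (Δ y z : ℕ) (z≤Δ : z * 1000000 ≤ Δ) (k≡ : k ≡ suc Δ) (k≤y : k ≤ y * 1000000)
    (y≤z : y * 5 ≤ z * 6) (z≤y : z ≤ y) (0<z : 0 < z) (big : k ^ 4 * k ^ 4 * 20 ≤ 2 ^ z) where

    open Words {Fin n} vals
    open Tails {Fin n} vals hiding (size)
    open Thresholds y z y≤z 0<z

    D : Fin n → ℕ
    D v = ∑ᶠ (𝟙 ∘ adj G v)

    0<k : 0 < k
    0<k = subst (0 <_) (sym k≡) z<s

    Q≡ : Q ≡ k * 200
    Q≡ = trans length-vals (trans (cong (k * 199 +_) (sym (*-identityʳ k))) (sym (*-distribˡ-+ k 199 1)))

    0<Q : 0 < Q
    0<Q = subst (0 <_) (sym Q≡) (0<* 0<k z<s)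

    -- 160 and 250 are 200 · 4/5 and 200 · 5/4, the extreme rates that the two tail bounds permit.
    upper-rate : 5 * (k * 160) ≤ 4 * Q
    upper-rate = ≤-reflexive (trans (*-comm 5 (k * 160)) (trans (*-assoc k 160 5)
      (sym (trans (cong (4 *_) Q≡) (trans (*-comm 4 (k * 200)) (*-assoc k 200 4))))))

    lower-rate : 5 * Q ≤ 4 * (k * 250)
    lower-rate = ≤-reflexive (trans (cong (5 *_) Q≡) (trans (trans (*-comm 5 (k * 200)) (*-assoc k 200 5))
      (sym (trans (*-comm 4 (k * 250)) (*-assoc k 250 4)))))

    vertices : List (Fin n)
    vertices = allFin n

    -- The mean is at most 2k²/Q = k/100, thus 10000 units of `y`, and 12500 is 5/4 of that. The 24
    -- is `M + 4 * suc M` for `M = 4` claims per letter. The 5 only matches the other case.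
    claimed-tail : ∀ v → count vertices (λ H → y * 12500 + z * 24 ≤ᵇ ∑ H (claimed v)) * 2 ^ z ≤ 5 * Q ^ length vertices
    claimed-tail v = ≤-trans (*-monoˡ-≤ (2 ^ z) (E-mono vertices λ H e → 𝟙-mono (pointwise H e)))
      (≤-trans (upper-tail (λ _ → claimed v) 4 (λ _ → claimed≤4 v) 0<Q vertices (k * 160) (y * 12500) z upper-rate) (m≤n*m _ 5))
      where
      open ≤-Reasoning
      l : ∀ a k b y → k * a * (y * b) ≡ k * (y * (a * b)) 
      l = solve-∀
      total-claims : 2 * k * k ≤ k * 160 * (y * 12500)
      total-claims = begin
        2 * k * k                 ≡⟨ trans (cong (_* k) (*-comm 2 k)) (*-assoc k 2 k) ⟩
        k * (2 * k)               ≤⟨ *-monoʳ-≤ k (*-monoʳ-≤ 2 k≤y) ⟩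
        k * (2 * (y * 1000000))   ≡⟨ cong (k *_) (trans (*-comm 2 (y * 1000000)) (*-assoc y 1000000 2)) ⟩
        k * (y * 2000000)         ≡⟨ sym (l 160 k 12500 y) ⟩
        k * 160 * (y * 12500)     ∎
      pointwise : ∀ H → map proj₁ H ≡ vertices → (y * 12500 + z * 24 ≤ᵇ ∑ H (claimed v)) ≡ true →
        ((y * 12500 + z * 24 ≤ᵇ total (λ _ → claimed v) [] H) ∧ (drift (λ _ → claimed v) [] H ≤ᵇ k * 160 * (y * 12500))) ≡ true
      pointwise H e t = cong₂ _∧_
        (trans (cong (y * 12500 + z * 24 ≤ᵇ_) (total-const (claimed v) [] H)) t)
        (≤ᵇ-true (≤-trans (≤-reflexive (trans (drift-const (claimed v) [] H) (cong (λ is → ∑ is (λ i → ∑ vals (λ a → claimed v (i , a)))) e)))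
                          (≤-trans (claimed-count v) total-claims)))

    survivors-rare : ∀ v → Δ * 8000 ≤ D v * 8001 → uniques f v ≤ y * 25200 →
      count vertices (λ H → Survive.survivors v H ≤ᵇ y * 125) * 2 ^ z ≤ 5 * Q ^ length vertices
    survivors-rare v large few with floor (size (target v) vertices) (k * 800) (0<* 0<k z<s)
    -- The divisor 800 is 160 · 160 / 32: two upper bounds at rate `k * 160` with `32 * k`
    -- interfering letters. Rounded up, `suc β` bounds the interference; rounded down, `β` bounds
    -- `s` from below. The `z * 2` covers the slack for `M = 32 * k`, as `M + 4 * suc M` is
    -- `k * 160 + 4`.
    ... | β , lo , hi , greatest = Survive.survivors-tail v 0<Q (32 * k) z vertices (Around.interferes-count v (near-count v))
        (k * 160) (k * 250) (k * 160 * suc β) (suc β + z * 2) (y * 125) upper-rate lower-rate load-small slack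
        (enough-targets β β-large k _ lo)
      where
      open ≤-Reasoning
      s = size (target v) vertices
      β-large : z * 150 ≤ β
      β-large = greatest (z * 150) (many-targets Δ (D v) k s (uniques f v) z≤Δ (subst (Δ ≤_) (sym k≡) (n≤1+n Δ)) large few (target-bound v))
      l₁ : ∀ k B a b → k * a * B * (k * b) ≡ k * k * B * (a * b)
      l₁ = solve-∀
      l₂ : ∀ k B a → k * a * (k * a * B) ≡ k * k * B * (a * a)
      l₂ = solve-∀
      load-small : s * (32 * k) ≤ k * 160 * (k * 160 * suc β)
      load-small = begin
        s * (32 * k)                       ≡⟨ cong (s *_) (*-comm 32 k) ⟩
        s * (k * 32)                       ≤⟨ *-monoˡ-≤ (k * 32) (<⇒≤ hi) ⟩
        k * 800 * suc β * (k * 32)         ≡⟨ l₁ k (suc β) 800 32 ⟩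
        k * k * suc β * 25600              ≡⟨ sym (l₂ k (suc β) 160) ⟩
        k * 160 * (k * 160 * suc β)        ∎
      l₃ : ∀ m → m + 4 * suc m ≡ m * 5 + 4
      l₃ = solve-∀
      l₄ : ∀ k z a b → z * (k * (a * b)) ≡ k * a * (z * b)
      l₄ = solve-∀
      slack : k * 160 * suc β + z * (32 * k + 4 * suc (32 * k)) ≤ k * 160 * (suc β + z * 2)
      slack = begin
        k * 160 * suc β + z * (32 * k + 4 * suc (32 * k))
          ≡⟨ cong (λ e → k * 160 * suc β + z * e) (trans (l₃ (32 * k)) (cong (_+ 4) (trans (cong (_* 5) (*-comm 32 k)) (*-assoc k 32 5)))) ⟩
        k * 160 * suc β + z * (k * 160 + 4)
          ≤⟨ +-monoʳ-≤ (k * 160 * suc β) (*-monoʳ-≤ z (+-monoʳ-≤ (k * 160) (≤-trans (*-monoˡ-≤ 4 0<k) (scale k 4 160)))) ⟩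
        k * 160 * suc β + z * (k * 160 + k * 160)
          ≡⟨ cong (k * 160 * suc β +_) (trans (cong (z *_) (sym (*-distribˡ-+ k 160 160))) (l₄ k z 160 2)) ⟩
        k * 160 * suc β + k * 160 * (z * 2)
          ≡⟨ sym (*-distribˡ-+ (k * 160) (suc β) (z * 2)) ⟩
        k * 160 * (suc β + z * 2) ∎

    low steady : Fin n → Bool
    low v = D v * 8001 ≤ᵇ Δ * 8000
    steady v = y * 25200 ≤ᵇ uniques f v

    -- `low` and `steady` depend on `f` alone, so each vertex has one fixed kind of failure. A
    -- vertex of low degree has none: its conflicts never exceed its degree.
    bad : Fin n → Word (Fin n) (Maybe (Fin k)) → Bool
    bad v H = if low v then false else
      (if steady v then (y * 12500 + z * 24 ≤ᵇ ∑ H (claimed v)) else (Survive.survivors v H ≤ᵇ y * 125))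

    bad-rare : ∀ v → count vertices (bad v) * 2 ^ z ≤ 5 * Q ^ length vertices
    bad-rare v = go (low v) (steady v) refl refl
      where
      go : ∀ p q → low v ≡ p → steady v ≡ q → count vertices (λ H → if p then false else
        (if q then (y * 12500 + z * 24 ≤ᵇ ∑ H (claimed v)) else (Survive.survivors v H ≤ᵇ y * 125))) * 2 ^ z ≤ 5 * Q ^ length vertices
      go true _ _ _ = ≤-trans (≤-reflexive (cong (_* 2 ^ z) (trans (E-const vertices 0) (*-zeroʳ (Q ^ length vertices))))) z≤n
      go false true _ _ = claimed-tail v
      go false false p q = survivors-rare v (≰ᵇ⇒≥ p) (≰ᵇ⇒≥ q)

    bad-local : ∀ v H → bad v H ≡ bad v (restrict (ball v) H)
    bad-local v H = cong₂ (λ a b → if low v then false else (if steady v then a else b))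
      (cong (y * 12500 + z * 24 ≤ᵇ_) (claimed-local v H)) (cong (_≤ᵇ y * 125) (survivors-local v H))

    degree-bound : ℕ
    degree-bound = k ^ 4 * k ^ 4

    bad-rare′ : ∀ v → count vertices (bad v) * (4 * degree-bound) ≤ Q ^ length vertices
    bad-rare′ v = *-cancelˡ-≤ 5 (begin
      5 * (c * (4 * degree-bound))     ≡⟨ l c degree-bound ⟩
      c * (degree-bound * 20)          ≤⟨ *-monoʳ-≤ c big ⟩
      c * 2 ^ z                        ≤⟨ bad-rare v ⟩
      5 * Q ^ length vertices          ∎)
      where
      open ≤-Reasoning
      c = count vertices (bad v)
      l : ∀ c e → 5 * (c * (4 * e)) ≡ c * (e * 20)
      l = solve-∀

    open LocalLemma vertices bad ball (meet 4) degree-bound 0<Q (0<* (0<^ k 4 0<k) (0<^ k 4 0<k))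
      bad-local (disjoint 4) bad-rare′

    recolouring : ∃ λ (g : Fin n → Fin k) → Proper G g × (∀ v → conflicts G g v * 8001 ≤ Δ * 8000)
    recolouring = let H , H-all , good = avoidable vertices (meet-count 4) in from H H-all good
      where
      from : ∀ H → map proj₁ H ≡ vertices → avoid vertices H ≡ true → ∃ λ (g : Fin n → Fin k) → Proper G g × (∀ v → conflicts G g v * 8001 ≤ Δ * 8000)
      from H H-all good = recoloured , recoloured-proper , calm
        where
        open Result H H-all
        open Counting H H-all
        D≤Δ : ∀ v → D v ≤ Δ
        D≤Δ v = s≤s⁻¹ (subst (D v <_) k≡ (deg< v))
        Δ≤y : Δ ≤ y * 1000000
        Δ≤y = ≤-trans (n≤1+n Δ) (subst (_≤ y * 1000000) k≡ k≤y)
        calm : ∀ v → conflicts G recoloured v * 8001 ≤ Δ * 8000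
        calm v = go (low v) (steady v) refl refl (avoid-sound good (∈-allFin v))
          where
          c = conflicts G recoloured v
          go : ∀ p q → low v ≡ p → steady v ≡ q → (if p then false else
            (if q then (y * 12500 + z * 24 ≤ᵇ ∑ H (claimed v)) else (Survive.survivors v H ≤ᵇ y * 125))) ≡ false → c * 8001 ≤ Δ * 8000
          go true _ p _ _ = ≤-trans
            (*-monoˡ-≤ 8001 (≤-trans (m≤m+n c _) (≤-reflexive (conflicts+uniques recoloured v)))) (≤ᵇ-sound p)
          go false true _ q e = peaceful Δ c _ (D v) (conflicts+uniques recoloured v) (D≤Δ v) Δ≤y
            (stable _ _ (≤-trans (≤ᵇ-sound q) (uniques-stable v)) (≰ᵇ⇒≥ e) z≤y)
          go false false _ _ e = peaceful Δ c _ (D v) (conflicts+uniques recoloured v) (D≤Δ v) Δ≤y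
            (≤-trans (≰ᵇ⇒≥ e) (survivors≤uniques v))

-- Choice of the parameters

*-≤-comm : ∀ a b c d → a * b ≤ c * d → b * a ≤ d * c
*-≤-comm a b c d = subst₂ _≤_ (*-comm a b) (*-comm c d)

-- With `j` the quotient of `Δ` by `κ`, the units `z = j * 9` and `y = suc j * 9` enclose Δ/1000000.
-- The factor 9 provides the ninth power of 2ʲ that beats the degree-8 polynomial.
sufficiently-large : ∀ κ → κ ≡ 9 * 1000000 → ∀ Δ → κ * (κ ^ 8 * 20) ≤ Δ → (n : ℕ) (G : Graph n) → MaxDegree G Δ →
  Σ (Fin n → Fin (suc Δ)) λ f → Proper G f × PeacefulFrac G f 8000 8001 Δ
sufficiently-large κ κ≡ Δ large n G (degree≤ , _) =
  let g , g-proper , calm = recolouring in g , g-proper , λ v → *-≤-comm (conflicts G g v) 8001 Δ 8000 (calm v)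
  where
  0<κ : 0 < κ
  0<κ = subst (0 <_) (sym κ≡) z<s
  quotient = floor Δ κ 0<κ
  j = proj₁ quotient
  j-large : κ ^ 8 * 20 ≤ j
  j-large = proj₂ (proj₂ (proj₂ quotient)) (κ ^ 8 * 20) large
  -- Makes 5 · (j + 1) at most 6j, that is, `y * 5 ≤ z * 6`.
  5≤j : 5 ≤ j
  5≤j = ≤-trans (≤ᵇ⇒≤ 5 20 _) (≤-trans (m≤n*m 20 (κ ^ 8) {{>-nonZero (0<^ κ 8 0<κ)}}) j-large)
  million : ∀ i → i * 9 * 1000000 ≡ i * κ
  million i = trans (*-assoc i 9 1000000) (cong (i *_) (sym κ≡))
  k≤ : suc Δ ≤ suc j * κ
  k≤ = ≤-trans (proj₁ (proj₂ (proj₂ quotient))) (≤-reflexive (*-comm κ (suc j)))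
  deg< : ∀ v → ∑ᶠ (𝟙 ∘ adj G v) < suc Δ
  deg< v = s≤s (≤-trans (≤-reflexive (sym (countB≡∑ (adj G v) (allFin n)))) (degree≤ v))
  greedy = greedy-colouring G deg< zero
  f = proj₁ greedy
  module S (x : Fin n) = Substitute (adj G x) f (f x) (λ w a e → proj₂ greedy x w a (sym e)) (deg< x)
  module C = Recolouring.Concentration G deg< f (proj₂ greedy) S.new S.new≢ S.available S.two
  l₁ : ∀ j → suc j * 9 * 5 ≡ (5 + j * 5) * 9
  l₁ = solve-∀
  l₂ : ∀ j → j * 9 * 6 ≡ (j + j * 5) * 9
  l₂ = solve-∀
  open C Δ (suc j * 9) (j * 9)
    (≤-trans (≤-reflexive (trans (million j) (*-comm j κ))) (proj₁ (proj₂ quotient)))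
    refl
    (≤-trans k≤ (≤-reflexive (sym (million (suc j)))))
    (subst₂ _≤_ (sym (l₁ j)) (sym (l₂ j)) (*-monoˡ-≤ 9 (+-monoˡ-≤ (j * 5) 5≤j)))
    (*-monoˡ-≤ 9 (n≤1+n j))
    (0<* (≤-trans z<s 5≤j) z<s)
    (power-beats-polynomial κ j (suc Δ) k≤ (≤-trans j-large (n≤1+n j)))

theorem5 : Σ ℕ λ Δ₀ → (Δ : ℕ) → Δ₀ ≤ Δ →
    (n : ℕ) (G : Graph n) → MaxDegree G Δ →
    Σ (Fin n → Fin (suc Δ)) λ f → Proper G f × PeacefulFrac G f 8000 8001 Δ
theorem5 = 9000000 * (9000000 ^ 8 * 20) , sufficiently-large 9000000 refl
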